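{- A commutative weakly distance-regular digraph $\Gamma$ is semicomplete multipartite if and only if $\Gamma$ is isomorphic to one of the following digraphs: (i) an $n$-coclique extension of $\mathrm{Cay}(\mathbb{Z}_6,\{1,2\})$, where $n\geq 1$; (ii) an $l$-coclique extension of a semicomplete weakly distance-regular digraph with girth $2$ or $3$, where $l\geq 2$; (iii) an $n$-coclique extension of $\Sigma\circ C_4$, where $\Sigma$ is a semicomplete weakly distance-regular digraph with girth $3$ and $n\geq 1$; (iv) an $n$-coclique extension of a doubly regular $(k,l)$-team tournament of Type II with parameters $\left(\frac{(k-2)l}{4},\frac{(k-2)l}{4},\frac{l^2(k-1)}{4(l-1)}\right)$, where $k,l\geq 2$ and $n\geq 1$; (v) a doubly regular $(k,m)$-team semicomplete multipartite digraph of Type II, where $k,m\geq 2$.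
   Context: A digraph $\Gamma$ has a finite nonempty vertex set $V\Gamma$ and an arc set $A\Gamma$ of ordered pairs of distinct vertices; $N^+(x)=\{y:(x,y)\in A\Gamma\}$, $N^-(x)=\{y:(y,x)\in A\Gamma\}$. A path of length $r$ from $x$ to $y$ is a sequence $x=w_0,\dots,w_r=y$ with $(w_{t-1},w_t)\in A\Gamma$; a circuit of length $r$ is a path $(w_0,\dots,w_{r-1})$ with $(w_{r-1},w_0)\in A\Gamma$; the girth is the length of a shortest circuit (girth 2 means some two vertices are joined by arcs in both directions). $\partial(x,y)$ is the length of a shortest path from $x$ to $y$; $\Gamma$ is strongly connected if all these are finite. The two-way distance is $\tilde\partial(x,y)=(\partial(x,y),\partial(y,x))$, $\tilde\partial(\Gamma)$ is the set of all two-way distances, and $\Gamma_{\tilde i}=\{(x,y):\tilde\partial(x,y)=\tilde i\}$. A strongly connected digraph $\Gamma$ is weakly distance-regular if $A\Gamma$ is not a symmetric relation and for all $\tilde i,\tilde j,\tilde h\in\tilde\partial(\Gamma)$ the number $p^{\tilde h}_{\tilde i,\tilde j}=|\{z:(x,z)\in\Gamma_{\tilde i},(z,y)\in\Gamma_{\tilde j}\}|$ is the same for all $(x,y)\in\Gamma_{\tilde h}$ (i.e. $(V\Gamma,\{\Gamma_{\tilde i}\})$ is a non-symmetric association scheme); it is commutative if moreover $p^{\tilde h}_{\tilde i,\tilde j}=p^{\tilde h}_{\tilde j,\tilde i}$ always. The underlying graph of $\Gamma$ has vertex set $V\Gamma$ with $x\sim y$ iff $(x,y)\in A\Gamma$ or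 $(y,x)\in A\Gamma$. $\Gamma$ is semicomplete if its underlying graph is complete, and semicomplete multipartite if its underlying graph is a complete multipartite graph $K_{n_1,\dots,n_m}$ with $m\geq 2$ parts (partite sets) and all $n_i\geq 2$. The lexicographic product $\Gamma\circ\Sigma$ has vertex set $V\Gamma\times V\Sigma$, with $((u_1,u_2),(v_1,v_2))$ an arc iff $(u_1,v_1)\in A\Gamma$, or $u_1=v_1$ and $(u_2,v_2)\in A\Sigma$. An $m$-coclique extension of $\Gamma$ is $\Gamma\circ\overline{K}_m$, where $\overline{K}_m$ has $m$ vertices and no arcs. $\mathrm{Cay}(\mathbb{Z}_6,\{1,2\})$ has vertex set $\mathbb{Z}_6$ and arcs $(x,x+1),(x,x+2)$. $C_4$ is the directed cycle of length 4. $K^m_r$ denotes the complete multipartite graph with $m$ parts each of size $r$. An $(m,r)$-team semicomplete multipartite digraph ($m,r\geq2$) is a digraph with underlying graph $K^m_r$; an $(m,r)$-team tournament is such a digraph with girth at least 3. A regular $(m,r)$-team tournament (every vertex has the same in- and out-degree) with adjacency matrix $A$ is a doubly regular $(m,r)$-team tournament with parameters $(\alpha,\beta,\gamma)$ if $A^2=\alpha A+\beta A^{\top}+\gamma(J-I-A-A^{\top})$ ($J$ all-ones, $I$ identity). With partite sets $V_1,\dots,V_m$, it is of Type II if $\beta=\alpha$, $r$ is even, and $|N^+(x)\cap V_i|=r/2$ for every $i$ and every $x\notin V_i$. For a digraph $\Gamma$ let $E\Gamma=\{(x,y):(x,y),(y,x)\in A\Gamma\}$, $\overline{\Gamma}=(V\Gamma,E\Gamma)$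 and $\vec\Gamma=(V\Gamma,A\Gamma\setminus E\Gamma)$. Let $\Gamma$ be an $(m,r)$-team semicomplete multipartite digraph, regular of some valency, with partite sets $V_1,\dots,V_m$; let $A_0$ and $A_1$ be the adjacency matrices of $\overline\Gamma$ and $\vec\Gamma$. $\Gamma$ is doubly regular if there are integers $t,\alpha_s,\beta_s,\gamma_s,\eta_s$ ($s=0,1,2$) with $A_iA_j=t\delta_{0,i+j}I+\alpha_{i+j}A_1+\beta_{i+j}A_1^{\top}+\gamma_{i+j}A_0+\eta_{i+j}(J-I-A_1-A_1^{\top}-A_0)$ for all $i,j\in\{0,1\}$. For $x\in V_i$ and $j\neq i$ let $A_j^+(x)=\{y\in V_j:(x,y)\in A\vec\Gamma\}$ and $E_j(x)=\{y\in V_j:(x,y)\in E\Gamma\}$. Such a $\Gamma$ is of Type II if $\beta_1+\beta_2-\alpha_1-\alpha_2=0$ and for every pair $i\neq j$ the values $|E_j(x)|$ ($x\in V_i$) are all equal to some $e_{ij}$, the values $|A_j^+(x)|$ ($x\in V_i$) are all equal to some $c_{ij}$, and $c_{ij}=c_{ji}=\frac{r-e_{ij}}{2}$. -}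

module Defs where

open import Data.Bool using (Bool; true; false; _∧_; _∨_; not; if_then_else_)
open import Data.Nat as ℕ using (ℕ; zero; suc; _≤_; _<_; _%_)
open import Data.Integer as ℤ using (ℤ; +_; 0ℤ; 1ℤ)
open import Data.Fin using (Fin; zero; suc; toℕ; remQuot; _≟_)
open import Data.Product using (Σ; _×_; _,_; proj₁; proj₂; ∃; ∃-syntax)
open import Data.Sum using (_⊎_)
open import Relation.Nullary using (¬_; ⌊_⌋)
open import Relation.Binary.PropositionalEquality using (_≡_; _≢_)
open import Function.Bundles using (_↔_; Inverse)

anyFin : ∀ {n} → (Fin n → Bool) → Bool
anyFin {zero}  f = false
anyFin {suc n} f = f zero ∨ anyFin (λ i → f (suc i))

countFin : ∀ {n} → (Fin n → Bool) → ℕ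
countFin {zero}  f = 0
countFin {suc n} f = (if f zero then 1 else 0) ℕ.+ countFin (λ i → f (suc i))

sumFin : ∀ {n} → (Fin n → ℤ) → ℤ
sumFin {zero}  f = 0ℤ
sumFin {suc n} f = f zero ℤ.+ sumFin (λ i → f (suc i))

anyBelow : ℕ → (ℕ → Bool) → Bool
anyBelow zero    f = false
anyBelow (suc d) f = anyBelow d f ∨ f d

_==_ : ∀ {n} → Fin n → Fin n → Bool
x == y = ⌊ x ≟ y ⌋

-- Digraphs on vertex set Fin n.  'adj' is any Boolean relation; the arc
-- set is the set of pairs (x , y) with x ≠ y and adj x y (so arcs are
-- always pairs of distinct vertices).

record Digraph : Set where
  constructor mkDigraph
  field
    n   : ℕ
    adj : Fin n → Fin n → Bool

  V : Set
  V = Fin n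

  arc : V → V → Bool
  arc x y = adj x y ∧ not (x == y)

open Digraph public

module _ (Γ : Digraph) where

  walk : ℕ → V Γ → V Γ → Bool
  walk zero    x y = x == y
  walk (suc r) x y = anyFin (λ z → arc Γ x z ∧ walk r z y)

  isDist : V Γ → V Γ → ℕ → Bool
  isDist x y d = walk d x y ∧ not (anyBelow d (λ r → walk r x y))

  isTwoWay : V Γ → V Γ → ℕ × ℕ → Bool
  isTwoWay x y (a , b) = isDist x y a ∧ isDist y x b

  pNum : V Γ → V Γ → ℕ × ℕ → ℕ × ℕ → ℕ
  pNum x y i j = countFin (λ z → isTwoWay x z i ∧ isTwoWay z y j)

  StronglyConnected : Set
  StronglyConnected = ∀ x y → ∃[ d ] walk d x y ≡ true

  NonSymmetric : Set
  NonSymmetric = ∃[ x ] ∃[ y ] (arc Γ x y ≡ true × arc Γ y x ≡ false)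

  WeaklyDistanceRegular : Set
  WeaklyDistanceRegular =
    StronglyConnected × NonSymmetric ×
    (∀ (h i j : ℕ × ℕ) (x y x' y' : V Γ) →
       isTwoWay x y h ≡ true → isTwoWay x' y' h ≡ true →
       pNum x y i j ≡ pNum x' y' i j)

  Commutative : Set
  Commutative =
    ∀ (h i j : ℕ × ℕ) (x y : V Γ) → isTwoWay x y h ≡ true →
      pNum x y i j ≡ pNum x y j i

  und : V Γ → V Γ → Bool
  und x y = arc Γ x y ∨ arc Γ y x

  Semicomplete : Set
  Semicomplete = ∀ x y → x ≢ y → und x y ≡ true

  MultipartiteBy : ∀ {m} → (V Γ → Fin m) → Set
  MultipartiteBy p = ∀ x y → und x y ≡ not (p x == p y)

  SemicompleteMultipartite : Set
  SemicompleteMultipartite =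
    ∃[ m ] Σ (V Γ → Fin m) λ p →
      2 ≤ m × (∀ i → 2 ≤ countFin (λ x → p x == i)) × MultipartiteBy p

  Girth : ℕ → Set
  Girth g = 1 ≤ g × (∃[ x ] walk g x x ≡ true) ×
            (∀ r x → 1 ≤ r → r < g → walk r x x ≡ false)

  GirthAtLeast3 : Set
  GirthAtLeast3 = ∀ x → walk 2 x x ≡ false

  outdeg indeg : V Γ → ℕ
  outdeg x = countFin (λ y → arc Γ x y)
  indeg  x = countFin (λ y → arc Γ y x)

  Regular : Set
  Regular = ∃[ k ] ∀ x → outdeg x ≡ k × indeg x ≡ k

  TeamBy : (m r : ℕ) → (V Γ → Fin m) → Set
  TeamBy m r p = 2 ≤ m × 2 ≤ r ×
                 (∀ i → countFin (λ x → p x == i) ≡ r) × MultipartiteBy p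

Mat : ℕ → Set
Mat n = Fin n → Fin n → ℤ

module _ {n : ℕ} where
  infixl 7 _⊗_ _·_
  infixl 6 _⊕_ _⊖_
  infix 4 _≈ₘ_

  _⊗_ : Mat n → Mat n → Mat n
  (A ⊗ B) x y = sumFin (λ z → A x z ℤ.* B z y)

  _⊕_ _⊖_ : Mat n → Mat n → Mat n
  (A ⊕ B) x y = A x y ℤ.+ B x y
  (A ⊖ B) x y = A x y ℤ.- B x y

  _·_ : ℤ → Mat n → Mat n
  (c · A) x y = c ℤ.* A x y

  ᵀ : Mat n → Mat n
  ᵀ A x y = A y x

  Jm Im : Mat n
  Jm x y = 1ℤ
  Im x y = if x == y then 1ℤ else 0ℤ

  fromBool : (Fin n → Fin n → Bool) → Mat n
  fromBool R x y = if R x y then 1ℤ else 0ℤ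

  _≈ₘ_ : Mat n → Mat n → Set
  A ≈ₘ B = ∀ x y → A x y ≡ B x y

module _ (Γ : Digraph) where

  adjMat : Mat (n Γ)
  adjMat = fromBool (arc Γ)

  DRTeamTournamentBy : (m r : ℕ) → (V Γ → Fin m) → ℤ → ℤ → ℤ → Set
  DRTeamTournamentBy m r p α β γ =
    TeamBy Γ m r p × GirthAtLeast3 Γ × Regular Γ ×
    (adjMat ⊗ adjMat ≈ₘ
      (α · adjMat ⊕ β · ᵀ adjMat ⊕ γ · (Jm ⊖ Im ⊖ adjMat ⊖ ᵀ adjMat)))

  DRTeamTournamentTypeII : (m r : ℕ) → ℤ → ℤ → ℤ → Set
  DRTeamTournamentTypeII m r α β γ =
    Σ (V Γ → Fin m) λ p →
      DRTeamTournamentBy m r p α β γ × β ≡ α × (∃[ h ] r ≡ 2 ℕ.* h) ×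
      (∀ i x → p x ≢ i →
         2 ℕ.* countFin (λ y → arc Γ x y ∧ (p y == i)) ≡ r)

  sym? asym? : V Γ → V Γ → Bool
  sym?  x y = arc Γ x y ∧ arc Γ y x
  asym? x y = arc Γ x y ∧ not (arc Γ y x)

  A₀ A₁ : Mat (n Γ)
  A₀ = fromBool sym?
  A₁ = fromBool asym?

  Amat : Fin 2 → Mat (n Γ)
  Amat zero    = A₀
  Amat (suc _) = A₁

  idx : Fin 2 → Fin 2 → Fin 3
  idx zero    zero    = zero
  idx zero    (suc _) = suc zero
  idx (suc _) zero    = suc zero
  idx (suc _) (suc _) = suc (suc zero)

  δ0 : Fin 3 → ℤ
  δ0 zero    = 1ℤ
  δ0 (suc _) = 0ℤ

  DRSCMPEqns : ℤ → (α β γ η : Fin 3 → ℤ) → Set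
  DRSCMPEqns t α β γ η =
    ∀ (i j : Fin 2) → let s = idx i j in
      Amat i ⊗ Amat j ≈ₘ
        ((t ℤ.* δ0 s) · Im ⊕ α s · A₁ ⊕ β s · ᵀ A₁ ⊕ γ s · A₀
          ⊕ η s · (Jm ⊖ Im ⊖ A₁ ⊖ ᵀ A₁ ⊖ A₀))

  eSize aSize : ∀ {m} → (V Γ → Fin m) → V Γ → Fin m → ℕ
  eSize p x j = countFin (λ y → (p y == j) ∧ sym? x y)
  aSize p x j = countFin (λ y → (p y == j) ∧ asym? x y)

  DRTeamSCMPTypeII : (m r : ℕ) → Set
  DRTeamSCMPTypeII m r =
    Σ (V Γ → Fin m) λ p →
    TeamBy Γ m r p × Regular Γ ×
    Σ ℤ λ t → Σ (Fin 3 → ℤ) λ α → Σ (Fin 3 → ℤ) λ β →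
    Σ (Fin 3 → ℤ) λ γ → Σ (Fin 3 → ℤ) λ η →
      DRSCMPEqns t α β γ η ×
      (β (suc zero) ℤ.+ β (suc (suc zero))
         ℤ.- α (suc zero) ℤ.- α (suc (suc zero)) ≡ 0ℤ) ×
      Σ (Fin m → Fin m → ℕ) λ e → Σ (Fin m → Fin m → ℕ) λ c →
        ∀ i j → i ≢ j →
          (∀ x → p x ≡ i → eSize p x j ≡ e i j × aSize p x j ≡ c i j) ×
          c i j ≡ c j i × 2 ℕ.* c i j ℕ.+ e i j ≡ r

_∘ₗ_ : Digraph → Digraph → Digraph
Γ ∘ₗ Δ = mkDigraph (n Γ ℕ.* n Δ) λ u v →
  let u₁ = proj₁ (remQuot {n Γ} (n Δ) u) ; u₂ = proj₂ (remQuot {n Γ} (n Δ) u)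
      v₁ = proj₁ (remQuot {n Γ} (n Δ) v) ; v₂ = proj₂ (remQuot {n Γ} (n Δ) v)
  in arc Γ u₁ v₁ ∨ ((u₁ == v₁) ∧ arc Δ u₂ v₂)

emptyDigraph : ℕ → Digraph
emptyDigraph m = mkDigraph m (λ _ _ → false)

cocliqueExt : Digraph → ℕ → Digraph
cocliqueExt Γ m = Γ ∘ₗ emptyDigraph m

cay6 : Digraph
cay6 = mkDigraph 6 λ x y →
  ⌊ toℕ y ℕ.≟ (toℕ x ℕ.+ 1) % 6 ⌋ ∨ ⌊ toℕ y ℕ.≟ (toℕ x ℕ.+ 2) % 6 ⌋

C4 : Digraph
C4 = mkDigraph 4 λ x y → ⌊ toℕ y ℕ.≟ (toℕ x ℕ.+ 1) % 4 ⌋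

_≅_ : Digraph → Digraph → Set
Γ ≅ Δ = Σ (V Γ ↔ V Δ) λ f →
  ∀ x y → arc Δ (Inverse.to f x) (Inverse.to f y) ≡ arc Γ x y

{-# OPTIONS --safe #-}
-- Twins, i.e. vertices with the same out-neighbours, are the pairs with as many common out-neighbours as
-- possible, so being twins is a union of classes of the scheme, and Γ is a coclique extension of its
-- twin quotient Δ, which is again commutative weakly distance-regular.  If all vertices of a part are
-- twins, Δ is semicomplete.  Otherwise distinct vertices of a part of Δ are at two-way distance (2,2),
-- and the arcs of Δ have types (1,1), (1,2) or (1,3).  For an invariant relation the number of
-- neighbours of x in the part of y depends only on the two parts, by commutativity.  If the one-way arcs
-- form a single class, this makes Δ of Type II.  If both (1,2) and (1,3) occur, no triangle passes
-- through a (1,3)-arc, so the (1,3)-arcs map every part to a single part: either the parts are paired off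
-- and Δ = Σ ∘ C₄, or three parts are permuted cyclically and Δ = Cay(Z₆,{1,2}).
module Submission where

open import Defs
open import Data.Bool using (Bool; true; false; _∧_; _∨_; not; if_then_else_)
open import Data.Bool.Properties using (∧-comm; ∧-assoc; ∧-zeroʳ; ∧-identityʳ; ∨-identityʳ; not-involutive) renaming (_≟_ to _≟ᵇ_)
open import Data.Empty using (⊥)
open import Data.Fin using (Fin; zero; suc; remQuot; combine; toℕ; fromℕ<) renaming (_≟_ to _≟ᶠ_)
open import Data.Fin.Properties using (remQuot-combine; combine-remQuot; toℕ-injective; toℕ-fromℕ<; toℕ<n; all?)
import Data.Nat
open import Data.Nat using (ℕ; zero; suc; _≤_; _<_; z≤n; s≤s; _∸_; _+_; nonZero) renaming (_*_ to _*ℕ_)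
open import Data.Nat.Properties using (+-*-semiring)
import Data.Nat.Properties
module ℕₚ = Data.Nat.Properties
open import Data.Product using (Σ; _×_; _,_; proj₁; proj₂; ∃-syntax)
open import Data.Sum using (_⊎_; inj₁; inj₂; [_,_]′)
open import Function using (id; case_of_)
open import Function.Bundles using (_⇔_; mk⇔; mk↔ₛ′; Inverse)
open import Relation.Binary.Definitions using (tri<; tri≈; tri>)
open import Relation.Binary.PropositionalEquality using (_≡_; _≢_; refl; sym; trans; cong; cong₂; subst; subst₂; module ≡-Reasoning)
open import Relation.Nullary using (¬_; Dec; yes; no; ⌊_⌋; contradiction)
open import Algebra.Properties.Semiring.Sum +-*-semiring using (sum; ∑-comm; sum-cong-≗; ∑-distrib-+)
open import Data.Nat.Tactic.RingSolver using (solve-∀)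
open import Data.Nat.DivMod using (_mod_)
open import Relation.Nullary.Decidable using (from-yes)
import Data.Integer
module ℤ = Data.Integer
import Data.Integer.Properties
module ℤₚ = Data.Integer.Properties
import Data.Integer.Tactic.RingSolver
module ℤ-Solver = Data.Integer.Tactic.RingSolver

-- Two facts drive the case analysis. Absence of twins: two mates, that is, distinct vertices x and
-- y of one part, are joined by a path x → z → y whose second arc is one-way, so some two parts have
-- arcs running both ways between them, although a single arc may be one-way. Absence of short
-- returns: for an arc x → y of type (1,3) there is no walk y → w → x, so outside the parts
-- concerned every in-neighbour of x is one of y and every out-neighbour of y is one of x. Since all
-- vertices have equal valencies, these inclusions can be compared by size, and where the comparison
-- closes up they become equalities; this is what ties the (1,3)-arcs to whole parts. What remains
-- is arithmetic: paths made of two (1,3)-arcs are counted in two ways, and the resulting equations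
-- have only the solution with valency one and parts of size two.

bool : ∀ b → b ≡ true ⊎ b ≡ false
bool true  = inj₁ refl
bool false = inj₂ refl

clash : ∀ {ℓ} {A : Set ℓ} {b} → b ≡ true → b ≡ false → A
clash refl ()

bool-ext : ∀ {a b} → (a ≡ true → b ≡ true) → (b ≡ true → a ≡ true) → a ≡ b
bool-ext {true}  {b}     f g = sym (f refl)
bool-ext {false} {true}  f g = g refl
bool-ext {false} {false} f g = refl

≢true⇒≡false : ∀ {b} → ¬ b ≡ true → b ≡ false
≢true⇒≡false {true}  h = contradiction refl h
≢true⇒≡false {false} h = refl

∧-true : ∀ {a b} → a ≡ true → b ≡ true → a ∧ b ≡ true
∧-true refl refl = refl

∧-true⁻ : ∀ {a b} → a ∧ b ≡ true → a ≡ true × b ≡ true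
∧-true⁻ {true} {true} _ = refl , refl

∨-trueˡ : ∀ {a b} → a ≡ true → a ∨ b ≡ true
∨-trueˡ refl = refl

∨-trueʳ : ∀ {a b} → b ≡ true → a ∨ b ≡ true
∨-trueʳ {true}  _ = refl
∨-trueʳ {false} h = h

∨-true⁻ : ∀ {a b} → a ∨ b ≡ true → a ≡ true ⊎ b ≡ true
∨-true⁻ {true}  _ = inj₁ refl
∨-true⁻ {false} h = inj₂ h

∨-false⁻ : ∀ {a b} → a ∨ b ≡ false → a ≡ false × b ≡ false
∨-false⁻ {false} {false} _ = refl , refl

not-true : ∀ {a} → a ≡ false → not a ≡ true
not-true refl = refl

not-true⁻ : ∀ {a} → not a ≡ true → a ≡ false
not-true⁻ {false} _ = refl

not-false⁻ : ∀ {a} → not a ≡ false → a ≡ true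
not-false⁻ {true} _ = refl

⌊⌋-true : ∀ {A : Set} (d : Dec A) → A → ⌊ d ⌋ ≡ true
⌊⌋-true (yes _) _ = refl
⌊⌋-true (no ¬a) a = contradiction a ¬a

⌊⌋-true⁻ : ∀ {A : Set} (d : Dec A) → ⌊ d ⌋ ≡ true → A
⌊⌋-true⁻ (yes a) _ = a

⌊⌋-false : ∀ {A : Set} (d : Dec A) → ¬ A → ⌊ d ⌋ ≡ false
⌊⌋-false (yes a) ¬a = contradiction a ¬a
⌊⌋-false (no _)  _  = refl

⌊⌋-false⁻ : ∀ {A : Set} (d : Dec A) → ⌊ d ⌋ ≡ false → ¬ A
⌊⌋-false⁻ (no ¬a) _ = ¬a

module _ {n : ℕ} where

  ==⇒≡ : ∀ {x y : Fin n} → (x == y) ≡ true → x ≡ y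
  ==⇒≡ {x} {y} = ⌊⌋-true⁻ (x ≟ᶠ y)

  ==-refl : ∀ (x : Fin n) → (x == x) ≡ true
  ==-refl x = ⌊⌋-true (x ≟ᶠ x) refl

  ≡⇒== : ∀ {x y : Fin n} → x ≡ y → (x == y) ≡ true
  ≡⇒== {x} refl = ==-refl x

  ≢⇒== : ∀ {x y : Fin n} → x ≢ y → (x == y) ≡ false
  ≢⇒== {x} {y} = ⌊⌋-false (x ≟ᶠ y)

  ==⇒≢ : ∀ {x y : Fin n} → (x == y) ≡ false → x ≢ y
  ==⇒≢ {x} {y} = ⌊⌋-false⁻ (x ≟ᶠ y)

  ==-sym : ∀ (x y : Fin n) → (x == y) ≡ (y == x)
  ==-sym x y = bool-ext (λ h → ≡⇒== (sym (==⇒≡ h))) (λ h → ≡⇒== (sym (==⇒≡ h)))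

==-cong-injective : ∀ {m n} (f : Fin m → Fin n) → (∀ {x y} → f x ≡ f y → x ≡ y) →
                    ∀ x y → (f x == f y) ≡ (x == y)
==-cong-injective f inj x y =
  bool-ext (λ h → ≡⇒== (inj (==⇒≡ h))) (λ h → ≡⇒== (cong f (==⇒≡ h)))

-- Counting over finite types

anyFin-true : ∀ {n} (f : Fin n → Bool) i → f i ≡ true → anyFin f ≡ true
anyFin-true f zero    h = ∨-trueˡ h
anyFin-true f (suc i) h = ∨-trueʳ {f zero} (anyFin-true (λ j → f (suc j)) i h)

anyFin-true⁻ : ∀ {n} (f : Fin n → Bool) → anyFin f ≡ true → ∃[ i ] f i ≡ true
anyFin-true⁻ {suc n} f h with ∨-true⁻ {f zero} h
... | inj₁ p = zero , p
... | inj₂ p with anyFin-true⁻ (λ j → f (suc j)) p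
...   | i , q = suc i , q

anyFin-false⁻ : ∀ {n} (f : Fin n → Bool) → anyFin f ≡ false → ∀ i → f i ≡ false
anyFin-false⁻ f h i = ≢true⇒≡false λ p → clash (anyFin-true f i p) h

anyFin-cong : ∀ {n} {f g : Fin n → Bool} → (∀ i → f i ≡ g i) → anyFin f ≡ anyFin g
anyFin-cong {zero}  h = refl
anyFin-cong {suc n} h = cong₂ _∨_ (h zero) (anyFin-cong (λ i → h (suc i)))

𝟙 : Bool → ℕ
𝟙 b = if b then 1 else 0

count≡sum : ∀ {n} (f : Fin n → Bool) → countFin f ≡ sum (λ i → 𝟙 (f i))
count≡sum {zero}  f = refl
count≡sum {suc n} f = cong (𝟙 (f zero) +_) (count≡sum (λ i → f (suc i)))

count-cong : ∀ {n} {f g : Fin n → Bool} → (∀ i → f i ≡ g i) → countFin f ≡ countFin g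
count-cong {zero}  h = refl
count-cong {suc n} h = cong₂ _+_ (cong 𝟙 (h zero)) (count-cong (λ i → h (suc i)))

𝟙-mono : ∀ {a b} → (a ≡ true → b ≡ true) → 𝟙 a ≤ 𝟙 b
𝟙-mono {false} h = z≤n
𝟙-mono {true}  h rewrite h refl = s≤s z≤n

count-⊆ : ∀ {n} {f g : Fin n → Bool} → (∀ i → f i ≡ true → g i ≡ true) →
          countFin f ≤ countFin g
count-⊆ {zero}  h = z≤n
count-⊆ {suc n} h = ℕₚ.+-mono-≤ (𝟙-mono (h zero)) (count-⊆ (λ i → h (suc i)))

count-⊂ : ∀ {n} {f g : Fin n → Bool} → (∀ i → f i ≡ true → g i ≡ true) →
          ∀ i → g i ≡ true → f i ≡ false → countFin f < countFin g
count-⊂ {f = f} {g} h zero gi fi rewrite gi | fi = s≤s (count-⊆ (λ i → h (suc i)))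
count-⊂ h (suc i) gi fi =
  ℕₚ.+-mono-≤-< (𝟙-mono (h zero)) (count-⊂ (λ i → h (suc i)) i gi fi)

-- The equality case of an inclusion; through it equations between valencies become statements about
-- single vertices.
count-⊆-≥ : ∀ {n} {f g : Fin n → Bool} → (∀ i → f i ≡ true → g i ≡ true) →
            countFin g ≤ countFin f → ∀ i → g i ≡ true → f i ≡ true
count-⊆-≥ {f = f} h le i gi with bool (f i)
... | inj₁ fi = fi
... | inj₂ fi = contradiction le (ℕₚ.<⇒≱ (count-⊂ h i gi fi))

count-split : ∀ {n} (f g : Fin n → Bool) →
              countFin f ≡ countFin (λ i → f i ∧ g i) + countFin (λ i → f i ∧ not (g i))
count-split f g = begin
  countFin f ≡⟨ count≡sum f ⟩
  sum (λ i → 𝟙 (f i)) ≡⟨ sum-cong-≗ (λ i → lem (f i) (g i)) ⟩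
  sum (λ i → 𝟙 (f i ∧ g i) + 𝟙 (f i ∧ not (g i))) ≡⟨ ∑-distrib-+ (λ i → 𝟙 (f i ∧ g i)) _ ⟩
  sum (λ i → 𝟙 (f i ∧ g i)) + sum (λ i → 𝟙 (f i ∧ not (g i)))
    ≡⟨ cong₂ _+_ (count≡sum (λ i → f i ∧ g i)) (count≡sum (λ i → f i ∧ not (g i))) ⟨
  _ ∎
  where
  open ≡-Reasoning
  lem : ∀ a b → 𝟙 a ≡ 𝟙 (a ∧ b) + 𝟙 (a ∧ not b)
  lem true true   = refl
  lem true false  = refl
  lem false true  = refl
  lem false false = refl

count-⊎ : ∀ {n} {h f g : Fin n → Bool} →
          (∀ i → f i ≡ true → h i ≡ true) → (∀ i → g i ≡ true → h i ≡ true) →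
          (∀ i → h i ≡ true → f i ≡ true ⊎ g i ≡ true) →
          (∀ i → f i ≡ true → g i ≡ false) → countFin h ≡ countFin f + countFin g
count-⊎ {h = h} {f} {g} fh gh hfg disj =
  trans (count-split h f) (cong₂ _+_
    (count-cong λ i → bool-ext (λ p → proj₂ (∧-true⁻ {h i} p)) (λ p → ∧-true (fh i p) p))
    (count-cong λ i → bool-ext
      (λ p → [ (λ q → clash q (not-true⁻ (proj₂ (∧-true⁻ {h i} p)))) , (λ q → q) ]′
             (hfg i (proj₁ (∧-true⁻ p))))
      (λ p → ∧-true (gh i p) (not-true (≢true⇒≡false λ q → clash p (disj i q))))))

count-pos : ∀ {n} (f : Fin n → Bool) i → f i ≡ true → 1 ≤ countFin f
count-pos f zero    h rewrite h = s≤s z≤n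
count-pos f (suc i) h = ℕₚ.≤-trans (count-pos (λ j → f (suc j)) i h) (ℕₚ.m≤n+m _ _)

count-pos⁻ : ∀ {n} (f : Fin n → Bool) → 1 ≤ countFin f → ∃[ i ] f i ≡ true
count-pos⁻ {suc n} f h with bool (f zero)
... | inj₁ p = zero , p
... | inj₂ p rewrite p with count-pos⁻ (λ j → f (suc j)) h
...   | i , q = suc i , q

count-none : ∀ {n} {f : Fin n → Bool} → (∀ i → f i ≡ false) → countFin f ≡ 0
count-none {zero}  h = refl
count-none {suc n} h rewrite h zero = count-none (λ i → h (suc i))

count-all : ∀ {n} {f : Fin n → Bool} → (∀ i → f i ≡ true) → countFin f ≡ n
count-all {zero}  h = refl
count-all {suc n} h rewrite h zero = cong suc (count-all (λ i → h (suc i)))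

count-singleton : ∀ {n} (x : Fin n) → countFin (x ==_) ≡ 1
count-singleton {suc n} zero    = cong suc (count-none {n} {λ i → zero == suc i} (λ i → ≢⇒== {x = zero} {suc i} λ ()))
count-singleton (suc x) =
  trans (count-cong (λ i → ==-cong-injective suc (λ { refl → refl }) x i)) (count-singleton x)

count-two : ∀ {n} (f : Fin n → Bool) {x y} → f x ≡ true → f y ≡ true → x ≢ y → 2 ≤ countFin f
count-two f {x} {y} fx fy x≢y =
  subst (_< countFin f) (count-singleton x)
    (count-⊂ (λ i h → subst (λ z → f z ≡ true) (==⇒≡ h) fx) y fy (≢⇒== x≢y))

count-two⁻ : ∀ {n} (f : Fin n → Bool) {x} → f x ≡ true → 2 ≤ countFin f →
             ∃[ y ] f y ≡ true × x ≢ y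
count-two⁻ f {x} fx le with count-pos⁻ (λ y → f y ∧ not (x == y)) (ℕₚ.+-cancelˡ-≤ 1 _ _
    (subst (2 ≤_) (trans (count-split f (x ==_)) (cong (_+ countFin (λ y → f y ∧ not (x == y)))
      (trans (count-cong λ i → bool-ext (λ h → proj₂ (∧-true⁻ {f i} h))
               (λ h → ∧-true (subst (λ z → f z ≡ true) (==⇒≡ h) fx) h))
             (count-singleton x)))) le))
... | y , h = y , proj₁ (∧-true⁻ h) , ==⇒≢ (not-true⁻ (proj₂ (∧-true⁻ {f y} h)))

count-unique : ∀ {n} (f : Fin n → Bool) {x y} → countFin f ≤ 1 → f x ≡ true → f y ≡ true → x ≡ y
count-unique f {x} {y} le fx fy with x ≟ᶠ y
... | yes p = p
... | no  p = contradiction (ℕₚ.≤-trans (count-two f fx fy p) le) λ { (s≤s ()) }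

-- If g were contained in f, the point y would make f strictly larger. The typical use is with
-- out-neighbourhoods, which have equal size.
count-exchange : ∀ {n} (f g : Fin n → Bool) → countFin f ≤ countFin g →
                 ∀ {y} → f y ≡ true → g y ≡ false → ∃[ z ] g z ≡ true × f z ≡ false
count-exchange f g le {y} fy gy with bool (anyFin (λ z → g z ∧ not (f z)))
... | inj₁ h with anyFin-true⁻ _ h
...   | z , p = z , proj₁ (∧-true⁻ p) , not-true⁻ (proj₂ (∧-true⁻ {g z} p))
count-exchange f g le {y} fy gy | inj₂ h =
  clash (count-⊆-≥ g⊆f le y fy) gy
  where
  g⊆f : ∀ i → g i ≡ true → f i ≡ true
  g⊆f i gi with bool (f i)
  ... | inj₁ fi = fi
  ... | inj₂ fi = clash (∧-true gi (not-true fi)) (anyFin-false⁻ _ h i)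

sum-zero : ∀ {n} {f : Fin n → ℕ} → (∀ i → f i ≡ 0) → sum f ≡ 0
sum-zero {zero}  h = refl
sum-zero {suc n} h = cong₂ _+_ (h zero) (sum-zero (λ i → h (suc i)))

sum-const-on : ∀ {n} (f : Fin n → Bool) c → sum (λ i → 𝟙 (f i) *ℕ c) ≡ countFin f *ℕ c
sum-const-on {zero}  f c = refl
sum-const-on {suc n} f c =
  trans (cong (𝟙 (f zero) *ℕ c +_) (sum-const-on (λ i → f (suc i)) c))
        (sym (ℕₚ.*-distribʳ-+ c (𝟙 (f zero)) _))

double-count : ∀ {m n} (r : Fin m → Fin n → Bool) →
               sum (λ x → countFin (r x)) ≡ sum (λ y → countFin (λ x → r x y))
double-count r = begin
  sum (λ x → countFin (r x)) ≡⟨ sum-cong-≗ (λ x → count≡sum (r x)) ⟩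
  sum (λ x → sum (λ y → 𝟙 (r x y))) ≡⟨ ∑-comm (λ x y → 𝟙 (r x y)) ⟩
  sum (λ y → sum (λ x → 𝟙 (r x y))) ≡⟨ sum-cong-≗ (λ y → count≡sum (λ x → r x y)) ⟨
  _ ∎
  where open ≡-Reasoning

count-guard : ∀ {n} b (f : Fin n → Bool) → countFin (λ i → b ∧ f i) ≡ 𝟙 b *ℕ countFin f
count-guard true  f = sym (ℕₚ.+-identityʳ _)
count-guard {n} false f = count-none {n} {λ _ → false} λ _ → refl

-- Relations and commutative association schemes

Rel : ℕ → Set
Rel n = Fin n → Fin n → Bool

infix 30 _ᵒ
_ᵒ : ∀ {n} → Rel n → Rel n
(ρ ᵒ) x y = ρ y x

-- An entry of the product of the 0-1 matrices of ρ and σ; for two classes of a scheme it is an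
-- intersection number.
N : ∀ {n} → Rel n → Rel n → Fin n → Fin n → ℕ
N ρ σ x y = countFin (λ z → ρ x z ∧ σ z y)

_⨾_ : ∀ {n} → Rel n → Rel n → Rel n
(ρ ⨾ σ) x y = anyFin (λ z → ρ x z ∧ σ z y)

⨾-true : ∀ {n} (ρ σ : Rel n) {x y} z → ρ x z ≡ true → σ z y ≡ true → (ρ ⨾ σ) x y ≡ true
⨾-true ρ σ {x} {y} z h k = anyFin-true (λ w → ρ x w ∧ σ w y) z (∧-true h k)

⨾-true⁻ : ∀ {n} (ρ σ : Rel n) {x y} → (ρ ⨾ σ) x y ≡ true → ∃[ z ] ρ x z ≡ true × σ z y ≡ true
⨾-true⁻ ρ σ {x} {y} h with anyFin-true⁻ (λ z → ρ x z ∧ σ z y) h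
... | z , p = z , ∧-true⁻ p

N-pos : ∀ {n} (ρ σ : Rel n) x y → (ρ ⨾ σ) x y ≡ true → 1 ≤ N ρ σ x y
N-pos ρ σ x y h with anyFin-true⁻ (λ z → ρ x z ∧ σ z y) h
... | z , p = count-pos (λ z → ρ x z ∧ σ z y) z p

N-pos⁻ : ∀ {n} (ρ σ : Rel n) x y → 1 ≤ N ρ σ x y → (ρ ⨾ σ) x y ≡ true
N-pos⁻ ρ σ x y h with count-pos⁻ (λ z → ρ x z ∧ σ z y) h
... | z , p = anyFin-true (λ z → ρ x z ∧ σ z y) z p

-- A commutative association scheme on Fin n, given by the type of each pair.  A relation is
-- invariant if it is a union of classes.
record Scheme (n : ℕ) : Set where
  field
    ty : Fin n → Fin n → ℕ × ℕ

  Inv : Rel n → Set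
  Inv ρ = ∀ {x y x' y'} → ty x y ≡ ty x' y' → ρ x y ≡ ρ x' y'

  field
    ty-diag : ∀ x y → ty x x ≡ ty y y
    ty-flip : ∀ {x y x' y'} → ty x y ≡ ty x' y' → ty y x ≡ ty y' x'
    N-inv   : ∀ {ρ σ} → Inv ρ → Inv σ → ∀ {x y x' y'} → ty x y ≡ ty x' y' → N ρ σ x y ≡ N ρ σ x' y'
    N-comm  : ∀ {ρ σ} → Inv ρ → Inv σ → ∀ x y → N ρ σ x y ≡ N σ ρ x y

  flip-inv : ∀ {ρ} → Inv ρ → Inv (ρ ᵒ)
  flip-inv iρ e = iρ (ty-flip e)

  ∧-inv : ∀ {ρ σ} → Inv ρ → Inv σ → Inv (λ x y → ρ x y ∧ σ x y)
  ∧-inv iρ iσ e = cong₂ _∧_ (iρ e) (iσ e)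

  ∨-inv : ∀ {ρ σ} → Inv ρ → Inv σ → Inv (λ x y → ρ x y ∨ σ x y)
  ∨-inv iρ iσ e = cong₂ _∨_ (iρ e) (iσ e)

  not-inv : ∀ {ρ} → Inv ρ → Inv (λ x y → not (ρ x y))
  not-inv iρ e = cong not (iρ e)

  all-inv : Inv (λ _ _ → true)
  all-inv _ = refl

  ⨾-inv : ∀ {ρ σ} → Inv ρ → Inv σ → Inv (ρ ⨾ σ)
  ⨾-inv {ρ} {σ} iρ iσ e = bool-ext (half e) (half (sym e))
    where
    half : ∀ {x y x' y'} → ty x y ≡ ty x' y' → (ρ ⨾ σ) x y ≡ true → (ρ ⨾ σ) x' y' ≡ true
    half {x} {y} {x'} {y'} e h =
      N-pos⁻ ρ σ x' y' (subst (1 ≤_) (N-inv {ρ} {σ} iρ iσ e) (N-pos ρ σ x y h))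

  deg : Rel n → Fin n → ℕ
  deg ρ x = countFin (ρ x)

  -- A valency is a path count along ρ and the full relation at a diagonal pair, and all diagonal
  -- pairs have one type.
  deg-const : ∀ {ρ} → Inv ρ → ∀ x y → deg ρ x ≡ deg ρ y
  deg-const {ρ} iρ x y = begin
    deg ρ x                ≡⟨ count-cong (λ z → ∧-identityʳ (ρ x z)) ⟨
    N ρ (λ _ _ → true) x x ≡⟨ N-inv iρ all-inv (ty-diag x y) ⟩
    N ρ (λ _ _ → true) y y ≡⟨ count-cong (λ z → ∧-identityʳ (ρ y z)) ⟩
    deg ρ y                ∎
    where open ≡-Reasoning

  -- At a diagonal pair, commuting ρ with the full relation exchanges successors and predecessors.
  deg-flip : ∀ {ρ} → Inv ρ → ∀ x y → deg (ρ ᵒ) x ≡ deg ρ y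
  deg-flip {ρ} iρ x y = begin
    deg (ρ ᵒ) x            ≡⟨⟩
    N (λ _ _ → true) ρ x x ≡⟨ N-comm all-inv iρ x x ⟩
    N ρ (λ _ _ → true) x x ≡⟨ count-cong (λ z → ∧-identityʳ (ρ x z)) ⟩
    deg ρ x                ≡⟨ deg-const iρ x y ⟩
    deg ρ y                ∎
    where open ≡-Reasoning

-- From single classes to unions of classes

count-fibres : ∀ {m n} (f : Fin n → Fin m) (h : Fin n → Bool) →
               countFin h ≡ sum (λ k → countFin (λ z → (f z == k) ∧ h z))
count-fibres f h = begin
  countFin h                                           ≡⟨ count≡sum h ⟩
  sum (λ z → 𝟙 (h z))                                  ≡⟨ sum-cong-≗ (λ z → fibre z (h z)) ⟨
  sum (λ z → countFin (λ k → (f z == k) ∧ h z))        ≡⟨ double-count (λ z k → (f z == k) ∧ h z) ⟩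
  sum (λ k → countFin (λ z → (f z == k) ∧ h z))        ∎
  where
  open ≡-Reasoning
  fibre : ∀ z b → countFin (λ k → (f z == k) ∧ b) ≡ 𝟙 b
  fibre z b = begin
    countFin (λ k → (f z == k) ∧ b) ≡⟨ count-cong (λ k → ∧-comm (f z == k) b) ⟩
    countFin (λ k → b ∧ (f z == k)) ≡⟨ count-guard b (f z ==_) ⟩
    𝟙 b *ℕ countFin (f z ==_)       ≡⟨ cong (𝟙 b *ℕ_) (count-singleton (f z)) ⟩
    𝟙 b *ℕ 1                        ≡⟨ ℕₚ.*-identityʳ (𝟙 b) ⟩
    𝟙 b                             ∎

module Expansion {n K} (tyIx : Fin n → Fin n → Fin K) where

  p : Fin n → Fin n → Fin K → Fin K → ℕ
  p x y k l = countFin (λ z → (tyIx x z == k) ∧ (tyIx z y == l))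

  Constant : Rel n → Set
  Constant ρ = ∀ {x y x' y'} → tyIx x y ≡ tyIx x' y' → ρ x y ≡ ρ x' y'

  -- The common value of ρ on the class k. An empty class gets false, which is harmless because no
  -- path runs through it.
  value : Rel n → Fin K → Bool
  value ρ k = anyFin (λ x → anyFin (λ y → (tyIx x y == k) ∧ ρ x y))

  value-correct : ∀ {ρ} → Constant ρ → ∀ x y → value ρ (tyIx x y) ≡ ρ x y
  value-correct {ρ} c x y = bool-ext
    (λ h → case anyFin-true⁻ (λ x' → anyFin (λ y' → (tyIx x' y' == tyIx x y) ∧ ρ x' y')) h of λ { (x' , h') →
       case anyFin-true⁻ (λ y' → (tyIx x' y' == tyIx x y) ∧ ρ x' y') h' of λ { (y' , q) →
       trans (c (sym (==⇒≡ (proj₁ (∧-true⁻ q))))) (proj₂ (∧-true⁻ {tyIx x' y' == tyIx x y} q)) } })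
    (λ h → anyFin-true (λ x' → anyFin (λ y' → (tyIx x' y' == tyIx x y) ∧ ρ x' y')) x
       (anyFin-true (λ y' → (tyIx x y' == tyIx x y) ∧ ρ x y') y (∧-true (==-refl (tyIx x y)) h)))

  -- ρ and σ are unions of classes, so sorting the middle vertex by its classes towards x and y
  -- writes the count as a sum of intersection numbers, each with coefficient 0 or 1 independent of
  -- the pair.
  N-expand : ∀ {ρ σ} → Constant ρ → Constant σ → ∀ x y →
             N ρ σ x y ≡ sum (λ k → sum (λ l → 𝟙 (value ρ k ∧ value σ l) *ℕ p x y k l))
  N-expand {ρ} {σ} cρ cσ x y = begin
    N ρ σ x y
      ≡⟨ count-fibres (tyIx x) (λ z → ρ x z ∧ σ z y) ⟩
    sum (λ k → countFin (λ z → (tyIx x z == k) ∧ (ρ x z ∧ σ z y)))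
      ≡⟨ sum-cong-≗ (λ k → count-fibres (λ z → tyIx z y) (λ z → (tyIx x z == k) ∧ (ρ x z ∧ σ z y))) ⟩
    sum (λ k → sum (λ l → countFin (λ z → (tyIx z y == l) ∧ ((tyIx x z == k) ∧ (ρ x z ∧ σ z y)))))
      ≡⟨ sum-cong-≗ (λ k → sum-cong-≗ (λ l → trans (count-cong (step k l))
           (count-guard (value ρ k ∧ value σ l) (λ z → (tyIx x z == k) ∧ (tyIx z y == l))))) ⟩
    _ ∎
    where
    open ≡-Reasoning
    step : ∀ k l z → (tyIx z y == l) ∧ ((tyIx x z == k) ∧ (ρ x z ∧ σ z y)) ≡
                     (value ρ k ∧ value σ l) ∧ ((tyIx x z == k) ∧ (tyIx z y == l))
    step k l z = bool-ext
      (λ h → let q , h' = ∧-true⁻ {tyIx z y == l} h ; r , h″ = ∧-true⁻ {tyIx x z == k} h'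
                 a , b = ∧-true⁻ {ρ x z} h″ in
         ∧-true (∧-true (trans (cong (value ρ) (sym (==⇒≡ r))) (trans (value-correct cρ x z) a))
                        (trans (cong (value σ) (sym (==⇒≡ q))) (trans (value-correct cσ z y) b)))
                (∧-true r q))
      (λ h → let v , h' = ∧-true⁻ {value ρ k ∧ value σ l} h ; r , q = ∧-true⁻ {tyIx x z == k} h'
                 a , b = ∧-true⁻ {value ρ k} v in
         ∧-true q (∧-true r (∧-true
           (trans (sym (value-correct cρ x z)) (trans (cong (value ρ) (==⇒≡ r)) a))
           (trans (sym (value-correct cσ z y)) (trans (cong (value σ) (==⇒≡ q)) b)))))

  module _ {ρ σ} (cρ : Constant ρ) (cσ : Constant σ) where

    N-constant : ∀ {x y x' y'} → (∀ k l → p x y k l ≡ p x' y' k l) → N ρ σ x y ≡ N ρ σ x' y'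
    N-constant {x} {y} {x'} {y'} e = begin
      N ρ σ x y ≡⟨ N-expand cρ cσ x y ⟩
      _ ≡⟨ sum-cong-≗ (λ k → sum-cong-≗ (λ l → cong (𝟙 (value ρ k ∧ value σ l) *ℕ_) (e k l))) ⟩
      _ ≡⟨ N-expand cρ cσ x' y' ⟨
      N ρ σ x' y' ∎
      where open ≡-Reasoning

    N-commute : ∀ {x y} → (∀ k l → p x y k l ≡ p x y l k) → N ρ σ x y ≡ N σ ρ x y
    N-commute {x} {y} e = begin
      N ρ σ x y ≡⟨ N-expand cρ cσ x y ⟩
      sum (λ k → sum (λ l → 𝟙 (value ρ k ∧ value σ l) *ℕ p x y k l))
        ≡⟨ sum-cong-≗ (λ k → sum-cong-≗ (λ l →
             cong₂ _*ℕ_ (cong 𝟙 (∧-comm (value ρ k) (value σ l))) (e k l))) ⟩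
      sum (λ k → sum (λ l → 𝟙 (value σ l ∧ value ρ k) *ℕ p x y l k))
        ≡⟨ ∑-comm (λ k l → 𝟙 (value σ l ∧ value ρ k) *ℕ p x y l k) ⟩
      _ ≡⟨ N-expand cσ cρ x y ⟨
      N σ ρ x y ∎
      where open ≡-Reasoning

-- Distances and two-way distances

anyBelow-true⁻ : ∀ d f → anyBelow d f ≡ true → ∃[ r ] r < d × f r ≡ true
anyBelow-true⁻ (suc d) f h with ∨-true⁻ {anyBelow d f} h
... | inj₂ p = d , ℕₚ.≤-refl , p
... | inj₁ p with anyBelow-true⁻ d f p
...   | r , lt , q = r , ℕₚ.m≤n⇒m≤1+n lt , q

anyBelow-true : ∀ d f {r} → r < d → f r ≡ true → anyBelow d f ≡ true
anyBelow-true (suc d) f {r} (s≤s r≤d) h with ℕₚ.m≤n⇒m<n∨m≡n r≤d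
... | inj₁ lt   = ∨-trueˡ (anyBelow-true d f lt h)
... | inj₂ refl = ∨-trueʳ {anyBelow d f} h

opaque
  least-true : ∀ (f : ℕ → Bool) d → f d ≡ true → ∃[ e ] f e ≡ true × (∀ r → f r ≡ true → e ≤ r)
  least-true f d h with bool (f 0)
  ... | inj₁ p = 0 , p , λ _ _ → z≤n
  least-true f zero    h | inj₂ p = clash h p
  least-true f (suc d) h | inj₂ p with least-true (λ r → f (suc r)) d h
  ... | e , q , m = suc e , q , λ { zero r → clash r p ; (suc r) s → s≤s (m r s) }

≤-sum : ∀ {n} (f : Fin n → ℕ) i → f i ≤ sum f
≤-sum f zero    = ℕₚ.m≤m+n _ _
≤-sum f (suc i) = ℕₚ.≤-trans (≤-sum (λ j → f (suc j)) i) (ℕₚ.m≤n+m _ _)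

module Distance (Γ : Digraph) (connected : StronglyConnected Γ) where

  shortest : ∀ x y → ∃[ e ] walk Γ e x y ≡ true × (∀ r → walk Γ r x y ≡ true → e ≤ r)
  shortest x y = least-true (λ r → walk Γ r x y) (proj₁ (connected x y)) (proj₂ (connected x y))

  δ : V Γ → V Γ → ℕ
  δ x y = proj₁ (shortest x y)

  δ-walk : ∀ x y → walk Γ (δ x y) x y ≡ true
  δ-walk x y = proj₁ (proj₂ (shortest x y))

  δ-least : ∀ {x y r} → walk Γ r x y ≡ true → δ x y ≤ r
  δ-least {x} {y} {r} = proj₂ (proj₂ (shortest x y)) r

  ty : V Γ → V Γ → ℕ × ℕ
  ty x y = δ x y , δ y x

  isDist⇒δ : ∀ {x y d} → isDist Γ x y d ≡ true → δ x y ≡ d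
  isDist⇒δ {x} {y} {d} h = ℕₚ.≤-antisym (δ-least (proj₁ (∧-true⁻ h))) (ℕₚ.≮⇒≥ λ lt →
    clash (anyBelow-true d (λ r → walk Γ r x y) lt (δ-walk x y))
          (not-true⁻ (proj₂ (∧-true⁻ {walk Γ d x y} h))))

  isDist-δ : ∀ x y → isDist Γ x y (δ x y) ≡ true
  isDist-δ x y = ∧-true (δ-walk x y) (not-true (≢true⇒≡false λ h →
    case anyBelow-true⁻ (δ x y) (λ r → walk Γ r x y) h of λ { (r , lt , w) → ℕₚ.<⇒≱ lt (δ-least w) }))

  isTwoWay⇒ty : ∀ {x y i} → isTwoWay Γ x y i ≡ true → ty x y ≡ i
  isTwoWay⇒ty {x} {y} {a , b} h =
    cong₂ _,_ (isDist⇒δ (proj₁ (∧-true⁻ h))) (isDist⇒δ (proj₂ (∧-true⁻ {isDist Γ x y a} h)))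

  isTwoWay-ty : ∀ x y → isTwoWay Γ x y (ty x y) ≡ true
  isTwoWay-ty x y = ∧-true (isDist-δ x y) (isDist-δ y x)

  δ-refl : ∀ x → δ x x ≡ 0
  δ-refl x = ℕₚ.n≤0⇒n≡0 (δ-least {r = 0} (==-refl x))

  δ≡0 : ∀ {x y} → δ x y ≡ 0 → x ≡ y
  δ≡0 {x} {y} e = ==⇒≡ (subst (λ r → walk Γ r x y ≡ true) e (δ-walk x y))

  arc⇒walk : ∀ {x y} → arc Γ x y ≡ true → walk Γ 1 x y ≡ true
  arc⇒walk {x} {y} h = ⨾-true (arc Γ) _==_ y h (==-refl y)

  walk⇒arc : ∀ {x y} → walk Γ 1 x y ≡ true → arc Γ x y ≡ true
  walk⇒arc {x} {y} h with ⨾-true⁻ (arc Γ) _==_ h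
  ... | z , a , e = subst (λ w → arc Γ x w ≡ true) (==⇒≡ e) a

  step-walk : ∀ {x y z r} → arc Γ x y ≡ true → walk Γ r y z ≡ true → walk Γ (suc r) x z ≡ true
  step-walk {x} {y} {z} {r} h w = ⨾-true (arc Γ) (walk Γ r) y h w

  arc-irrefl : ∀ x → arc Γ x x ≡ false
  arc-irrefl x = trans (cong (λ b → adj Γ x x ∧ not b) (==-refl x)) (∧-zeroʳ (adj Γ x x))

  arc⇒≢ : ∀ {x y} → arc Γ x y ≡ true → x ≢ y
  arc⇒≢ {x} h refl = clash h (arc-irrefl x)

  arc⇒δ : ∀ {x y} → arc Γ x y ≡ true → δ x y ≡ 1
  arc⇒δ {x} {y} h = ℕₚ.≤-antisym (δ-least (arc⇒walk h)) (ℕₚ.n≢0⇒n>0 λ e → arc⇒≢ h (δ≡0 e))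

  δ≡1 : ∀ {x y} → δ x y ≡ 1 → arc Γ x y ≡ true
  δ≡1 {x} {y} e = walk⇒arc (subst (λ r → walk Γ r x y ≡ true) e (δ-walk x y))

  δ≥2 : ∀ {x y} → x ≢ y → arc Γ x y ≡ false → 2 ≤ δ x y
  δ≥2 x≢y ¬xy = ℕₚ.≤∧≢⇒< (ℕₚ.n≢0⇒n>0 λ q → x≢y (δ≡0 q)) (λ q → clash (δ≡1 (sym q)) ¬xy)

  δ-two : ∀ {x y} → x ≢ y → arc Γ x y ≡ false → walk Γ 2 x y ≡ true → δ x y ≡ 2
  δ-two x≢y ¬xy w = ℕₚ.≤-antisym (δ-least w) (δ≥2 x≢y ¬xy)

  abstract
    -- The sum is a convenient strict upper bound for all distances. It places the two-way distances
    -- in a finite type, as `Expansion` requires.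
    bound : ℕ
    bound = suc (sum (λ x → sum (δ x)))

    δ<bound : ∀ x y → δ x y < bound
    δ<bound x y = s≤s (ℕₚ.≤-trans (≤-sum (δ x) y) (≤-sum (λ x → sum (δ x)) x))

  tyIx : V Γ → V Γ → Fin (bound *ℕ bound)
  tyIx x y = combine (fromℕ< (δ<bound x y)) (fromℕ< (δ<bound y x))

  decode : Fin (bound *ℕ bound) → ℕ × ℕ
  decode k = toℕ (proj₁ (remQuot {bound} bound k)) , toℕ (proj₂ (remQuot {bound} bound k))

  decode-tyIx : ∀ x y → decode (tyIx x y) ≡ ty x y
  decode-tyIx x y = trans
    (cong (λ ij → toℕ (proj₁ ij) , toℕ (proj₂ ij))
          (remQuot-combine {bound} {bound} (fromℕ< (δ<bound x y)) (fromℕ< (δ<bound y x))))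
    (cong₂ _,_ (toℕ-fromℕ< (δ<bound x y)) (toℕ-fromℕ< (δ<bound y x)))

  tyIx-decode : ∀ x y k → ty x y ≡ decode k → tyIx x y ≡ k
  tyIx-decode x y k e = trans (cong₂ combine
      (toℕ-injective (trans (toℕ-fromℕ< (δ<bound x y)) (cong proj₁ e)))
      (toℕ-injective (trans (toℕ-fromℕ< (δ<bound y x)) (cong proj₂ e))))
    (combine-remQuot {bound} bound k)

  isTwoWay-tyIx : ∀ x y k → (tyIx x y == k) ≡ isTwoWay Γ x y (decode k)
  isTwoWay-tyIx x y k = bool-ext
    (λ h → subst (λ i → isTwoWay Γ x y i ≡ true)
             (trans (sym (decode-tyIx x y)) (cong decode (==⇒≡ h))) (isTwoWay-ty x y))
    (λ h → ≡⇒== (tyIx-decode x y k (isTwoWay⇒ty h)))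

-- The association scheme of a weakly distance-regular digraph

module _ (Γ : Digraph) (wdr : WeaklyDistanceRegular Γ) (comm : Commutative Γ) where

  open Distance Γ (proj₁ wdr)

  -- The hypotheses concern single two-way distances; `Expansion` carries them over to arbitrary
  -- unions of classes.
  scheme : Scheme (n Γ)
  scheme = record
    { ty      = ty
    ; ty-diag = λ x y → cong₂ _,_ (trans (δ-refl x) (sym (δ-refl y))) (trans (δ-refl x) (sym (δ-refl y)))
    ; ty-flip = λ e → cong₂ _,_ (cong proj₂ e) (cong proj₁ e)
    ; N-inv   = λ iρ iσ {x} {y} {x'} {y'} e → N-constant (constant iρ) (constant iσ) λ k l → begin
        p x y k l ≡⟨ p≡pNum x y k l ⟩
        pNum Γ x y (decode k) (decode l)
          ≡⟨ proj₂ (proj₂ wdr) (ty x y) (decode k) (decode l) x y x' y' (isTwoWay-ty x y)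
               (subst (λ i → isTwoWay Γ x' y' i ≡ true) (sym e) (isTwoWay-ty x' y')) ⟩
        pNum Γ x' y' (decode k) (decode l) ≡⟨ p≡pNum x' y' k l ⟨
        p x' y' k l ∎
    ; N-comm  = λ iρ iσ x y → N-commute (constant iρ) (constant iσ) λ k l → begin
        p x y k l ≡⟨ p≡pNum x y k l ⟩
        pNum Γ x y (decode k) (decode l) ≡⟨ comm (ty x y) (decode k) (decode l) x y (isTwoWay-ty x y) ⟩
        pNum Γ x y (decode l) (decode k) ≡⟨ p≡pNum x y l k ⟨
        p x y l k ∎
    }
    where
    open ≡-Reasoning
    open Expansion tyIx

    p≡pNum : ∀ x y k l → p x y k l ≡ pNum Γ x y (decode k) (decode l)
    p≡pNum x y k l = count-cong λ z → cong₂ _∧_ (isTwoWay-tyIx x z k) (isTwoWay-tyIx z y l)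

    constant : ∀ {ρ : Rel (n Γ)} → (∀ {x y x' y'} → ty x y ≡ ty x' y' → ρ x y ≡ ρ x' y') → Constant ρ
    constant iρ {x} {y} {x'} {y'} e =
      iρ (trans (sym (decode-tyIx x y)) (trans (cong decode e) (decode-tyIx x' y')))

  arc-inv : Scheme.Inv scheme (arc Γ)
  arc-inv q = bool-ext (λ h → δ≡1 (trans (sym (cong proj₁ q)) (arc⇒δ h)))
                       (λ h → δ≡1 (trans (cong proj₁ q) (arc⇒δ h)))

-- Quotients and coordinates of lexicographic products

record Enumeration {n} (f : Fin n → Bool) (c : ℕ) : Set where
  field
    enum           : Fin c → Fin n
    enum-true      : ∀ i → f (enum i) ≡ true
    index          : ∀ x → f x ≡ true → Fin c
    enum-index     : ∀ x h → enum (index x h) ≡ x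
    enum-injective : ∀ {i j} → enum i ≡ enum j → i ≡ j

enumeration : ∀ {n} (f : Fin n → Bool) → Enumeration f (countFin f)
enumeration {zero} f = record
  { enum = λ () ; enum-true = λ () ; index = λ () ; enum-index = λ () ; enum-injective = λ {i} → case i of λ () }
enumeration {suc n} f with f zero in eq | enumeration (λ i → f (suc i))
... | true | e = record
  { enum           = λ { zero → zero ; (suc i) → suc (enum i) }
  ; enum-true      = λ { zero → eq ; (suc i) → enum-true i }
  ; index          = λ { zero _ → zero ; (suc x) h → suc (index x h) }
  ; enum-index     = λ { zero _ → refl ; (suc x) h → cong suc (enum-index x h) }
  ; enum-injective = λ { {zero} {zero} _ → refl ; {suc i} {suc j} p → cong suc (enum-injective (suc-inj p)) }
  }
  where
  open Enumeration e
  suc-inj : ∀ {m} {i j : Fin m} → suc i ≡ suc j → i ≡ j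
  suc-inj refl = refl
... | false | e = record
  { enum           = λ i → suc (enum i)
  ; enum-true      = enum-true
  ; index          = λ { zero h → clash h eq ; (suc x) h → index x h }
  ; enum-index     = λ { zero h → clash h eq ; (suc x) h → cong suc (enum-index x h) }
  ; enum-injective = λ p → enum-injective (suc-inj p)
  }
  where
  open Enumeration e
  suc-inj : ∀ {m} {i j : Fin m} → suc i ≡ suc j → i ≡ j
  suc-inj refl = refl

least-element : ∀ {n} (f : Fin n → Bool) x → f x ≡ true →
                ∃[ y ] f y ≡ true × (∀ z → f z ≡ true → toℕ y ≤ toℕ z)
least-element {suc n} f x h with bool (f zero)
... | inj₁ p = zero , p , λ _ _ → z≤n
least-element {suc n} f zero    h | inj₂ p = clash h p
least-element {suc n} f (suc x) h | inj₂ p with least-element (λ i → f (suc i)) x h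
... | y , q , m = suc y , q , λ { zero r → clash r p ; (suc z) r → s≤s (m z r) }

record Equivalence {n} (F : Rel n) : Set where
  field
    reflexive  : ∀ x → F x x ≡ true
    symmetric  : ∀ {x y} → F x y ≡ true → F y x ≡ true
    transitive : ∀ {x y z} → F x y ≡ true → F y z ≡ true → F x z ≡ true

  class-cong : ∀ {x y} → F x y ≡ true → ∀ z → F x z ≡ F y z
  class-cong h z = bool-ext (transitive (symmetric h)) (transitive h)

  class-congʳ : ∀ {x y} → F x y ≡ true → ∀ z → F z x ≡ F z y
  class-congʳ h z = bool-ext (λ k → transitive k h) (λ k → transitive k (symmetric h))

record Quotient {n} (F : Rel n) : Set where
  field
    size   : ℕ
    π      : Fin n → Fin size
    repr   : Fin size → Fin n
    π-repr : ∀ i → π (repr i) ≡ i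
    π-cong : ∀ {x y} → F x y ≡ true → π x ≡ π y
    π-≡    : ∀ {x y} → π x ≡ π y → F x y ≡ true

  repr-related : ∀ x → F x (repr (π x)) ≡ true
  repr-related x = π-≡ (sym (π-repr (π x)))

  π-≢ : ∀ {x y} → F x y ≡ false → π x ≢ π y
  π-≢ h e = clash (π-≡ e) h

opaque
  -- Each class is represented by its least vertex, and the classes are numbered by enumerating the
  -- vertices that represent themselves.
  quotient : ∀ {n} {F : Rel n} → Equivalence F → Quotient F
  quotient {n} {F} E = record
    { size   = countFin isRep
    ; π      = λ x → index (rep x) (isRep-rep x)
    ; repr   = enum
    ; π-repr = λ i → enum-injective (trans (enum-index _ _) (==⇒≡ (enum-true i)))
    ; π-cong = λ {x} {y} h → enum-injective
                 (trans (enum-index _ _) (trans (rep-cong h) (sym (enum-index _ _))))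
    ; π-≡    = λ {x} {y} e → transitive (F-rep x) (symmetric (subst (λ z → F y z ≡ true)
                 (trans (sym (enum-index _ (isRep-rep y)))
                        (trans (cong enum (sym e)) (enum-index _ (isRep-rep x)))) (F-rep y)))
    }
    where
    open Equivalence E
    rep : Fin n → Fin n
    rep x = proj₁ (least-element (F x) x (reflexive x))

    F-rep : ∀ x → F x (rep x) ≡ true
    F-rep x = proj₁ (proj₂ (least-element (F x) x (reflexive x)))

    rep-least : ∀ x y → F x y ≡ true → toℕ (rep x) ≤ toℕ y
    rep-least x = proj₂ (proj₂ (least-element (F x) x (reflexive x)))

    rep-cong : ∀ {x y} → F x y ≡ true → rep x ≡ rep y
    rep-cong {x} {y} h = toℕ-injective (ℕₚ.≤-antisym
      (rep-least x (rep y) (transitive h (F-rep y)))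
      (rep-least y (rep x) (transitive (symmetric h) (F-rep x))))

    isRep : Fin n → Bool
    isRep x = rep x == x

    isRep-rep : ∀ x → isRep (rep x) ≡ true
    isRep-rep x = ≡⇒== (sym (rep-cong (F-rep x)))

    open Enumeration (enumeration isRep)

record _≃×_ (A : Set) (B : Set × Set) : Set where
  field
    to      : A → proj₁ B × proj₂ B
    from    : proj₁ B × proj₂ B → A
    to-from : ∀ p → to (from p) ≡ p
    from-to : ∀ x → from (to x) ≡ x

lex-arc : ∀ (Δ Σ' : Digraph) i k j l →
          arc (Δ ∘ₗ Σ') (combine i k) (combine j l) ≡ arc Δ i j ∨ ((i == j) ∧ arc Σ' k l)
lex-arc Δ Σ' i k j l = trans
  (cong (_∧ not (combine i k == combine j l))
    (cong₂ joined (remQuot-combine {n Δ} {n Σ'} i k) (remQuot-combine {n Δ} {n Σ'} j l)))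
  -- The test for distinct vertices built into `arc` is automatic here, since neither factor has
  -- loops.
  (bool-ext (λ h → proj₁ (∧-true⁻ h)) (λ h → ∧-true h (not-true (≢⇒== (distinct (∨-true⁻ h))))))
  where
  joined : V Δ × V Σ' → V Δ × V Σ' → Bool
  joined (i , k) (j , l) = arc Δ i j ∨ ((i == j) ∧ arc Σ' k l)

  irrefl : ∀ (Γ : Digraph) x → arc Γ x x ≡ true → ⊥
  irrefl Γ x h = clash (==-refl x) (not-true⁻ (proj₂ (∧-true⁻ {adj Γ x x} h)))

  distinct : arc Δ i j ≡ true ⊎ (i == j) ∧ arc Σ' k l ≡ true → combine i k ≢ combine j l
  distinct p e with trans (sym (remQuot-combine i k)) (trans (cong (remQuot {n Δ} (n Σ')) e) (remQuot-combine j l))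
  distinct (inj₁ h) e | refl = irrefl Δ i h
  distinct (inj₂ h) e | refl = irrefl Σ' k (proj₂ (∧-true⁻ {i == i} h))

lex-iso : ∀ (Γ Δ Σ' : Digraph) (φ : V Γ ≃× (V Δ , V Σ')) → let open _≃×_ φ in
          (∀ p q → arc Γ (from p) (from q) ≡
                   arc Δ (proj₁ p) (proj₁ q) ∨ ((proj₁ p == proj₁ q) ∧ arc Σ' (proj₂ p) (proj₂ q))) →
          Γ ≅ (Δ ∘ₗ Σ')
lex-iso Γ Δ Σ' φ arcs =
  mk↔ₛ′ (λ x → combine (proj₁ (to x)) (proj₂ (to x))) (λ u → from (remQuot {n Δ} (n Σ') u))
    (λ u → trans (cong (λ p → combine (proj₁ p) (proj₂ p)) (to-from _)) (combine-remQuot {n Δ} (n Σ') u))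
    (λ x → trans (cong from (remQuot-combine (proj₁ (to x)) (proj₂ (to x)))) (from-to x)) ,
  λ x y → trans (lex-arc Δ Σ' _ _ _ _)
    (trans (sym (arcs (to x) (to y))) (cong₂ (arc Γ) (from-to x) (from-to y)))
  where open _≃×_ φ

module _ {n} {F : Rel n} (E : Equivalence F) (Q : Quotient F) where
  open Equivalence E
  open Quotient Q

  -- The class of every representative is enumerated; equal class sizes let one index type serve all
  -- classes.
  class-coordinates : ∀ {t} → (∀ x → countFin (F x) ≡ t) →
                      Σ (Fin n ≃× (Fin size , Fin t)) λ φ → ∀ p → π (_≃×_.from φ p) ≡ proj₁ p
  class-coordinates {t} const = record
    { to = to ; from = from
    ; to-from = λ p → from-injective (from-to (from p))
    ; from-to = from-to
    } , π-from
    where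
    e : ∀ i → Enumeration (F (repr i)) t
    e i = subst (Enumeration (F (repr i))) (const (repr i)) (enumeration (F (repr i)))
    open Enumeration

    to : Fin n → Fin size × Fin t
    to x = π x , index (e (π x)) x (symmetric (repr-related x))

    from : Fin size × Fin t → Fin n
    from (i , k) = enum (e i) k

    from-to : ∀ x → from (to x) ≡ x
    from-to x = enum-index (e (π x)) x _

    π-from : ∀ p → π (from p) ≡ proj₁ p
    π-from (i , k) = trans (sym (π-cong (enum-true (e i) k))) (π-repr i)

    from-injective : ∀ {p q} → from p ≡ from q → p ≡ q
    from-injective {i , k} {j , l} h with trans (sym (π-from (i , k))) (trans (cong π h) (π-from (j , l)))
    ... | refl = cong (i ,_) (enum-injective (e i) h)

  count-∘π : ∀ {t} → (∀ x → countFin (F x) ≡ t) → (f : Fin size → Bool) →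
             countFin (λ x → f (π x)) ≡ countFin f *ℕ t
  count-∘π {t} const f = begin
    countFin (λ x → f (π x))
      ≡⟨ count-fibres π (λ x → f (π x)) ⟩
    sum (λ i → countFin (λ x → (π x == i) ∧ f (π x)))
      ≡⟨ sum-cong-≗ (λ i → trans (count-cong (λ x → lem i x)) (count-guard (f i) (λ x → F (repr i) x))) ⟩
    sum (λ i → 𝟙 (f i) *ℕ countFin (F (repr i)))
      ≡⟨ sum-cong-≗ (λ i → cong (𝟙 (f i) *ℕ_) (const (repr i))) ⟩
    sum (λ i → 𝟙 (f i) *ℕ t)
      ≡⟨ sum-const-on f t ⟩
    countFin f *ℕ t ∎
    where
    open ≡-Reasoning
    lem : ∀ i x → (π x == i) ∧ f (π x) ≡ f i ∧ F (repr i) x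
    lem i x = bool-ext
      (λ h → let e , k = ∧-true⁻ {π x == i} h in
        ∧-true (subst (λ j → f j ≡ true) (==⇒≡ e) k)
               (subst (λ j → F (repr j) x ≡ true) (==⇒≡ e) (symmetric (repr-related x))))
      (λ h → let k , e = ∧-true⁻ {f i} h ; e' = trans (sym (π-cong e)) (π-repr i) in
        ∧-true (≡⇒== e') (subst (λ j → f j ≡ true) (sym e') k))

-- Collapsing an invariant equivalence relation

-- Weak distance-regularity survives the collapse because distances between different classes do not change.
module Collapse (Γ : Digraph) (wdr : WeaklyDistanceRegular Γ) (comm : Commutative Γ)
                {F : Rel (n Γ)} (E : Equivalence F) (Q : Quotient F)
                (inv : Scheme.Inv (scheme Γ wdr comm) F)
                (lift : ∀ {x x' y y'} → F x x' ≡ true → F y y' ≡ true → F x y ≡ false →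
                        arc Γ x y ≡ arc Γ x' y') where
  open Equivalence E
  open Quotient Q
  open Scheme (scheme Γ wdr comm) hiding (ty)
  open Distance Γ (proj₁ wdr)

  Γ/F : Digraph
  Γ/F = mkDigraph size (λ i j → arc Γ (repr i) (repr j))

  arc-/ : ∀ {x y} → F x y ≡ false → arc Γ/F (π x) (π y) ≡ arc Γ x y
  arc-/ {x} {y} h = trans
    (trans (cong (λ b → arc Γ (repr (π x)) (repr (π y)) ∧ not b) (≢⇒== (π-≢ h))) (∧-identityʳ _))
    (sym (lift (repr-related x) (repr-related y) h))

  arc-/⁻ : ∀ {x y} → arc Γ/F (π x) (π y) ≡ true → arc Γ x y ≡ true
  arc-/⁻ {x} {y} h = trans (sym (arc-/ (≢true⇒≡false λ k →
    clash (≡⇒== (π-cong k)) (not-true⁻ (proj₂ (∧-true⁻ {arc Γ (repr (π x)) (repr (π y))} h)))))) h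

  -- An arc between classes is present between all their members, so a walk lifts with both ends
  -- prescribed. Length zero is excluded because x and y may be different members of one class.
  walk-up : ∀ r {x y} → walk Γ/F (suc r) (π x) (π y) ≡ true → walk Γ (suc r) x y ≡ true
  walk-up zero {x} {y} h with ⨾-true⁻ (arc Γ/F) _==_ h
  ... | i , a , e = arc⇒walk (arc-/⁻ (subst (λ j → arc Γ/F (π x) j ≡ true) (==⇒≡ e) a))
  walk-up (suc r) {x} {y} h with ⨾-true⁻ (arc Γ/F) (walk Γ/F (suc r)) h
  ... | i , a , w = step-walk {r = suc r} (arc-/⁻ (subst (λ j → arc Γ/F (π x) j ≡ true) (sym (π-repr i)) a))
                      (walk-up r (subst (λ j → walk Γ/F (suc r) j (π y) ≡ true) (sym (π-repr i)) w))

  -- Steps inside a class disappear in the projection, so the walk may get shorter.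
  walk-down : ∀ r {x y} → walk Γ r x y ≡ true → ∃[ s ] s ≤ r × walk Γ/F s (π x) (π y) ≡ true
  walk-down zero {x} h = 0 , z≤n , ≡⇒== (cong π (==⇒≡ h))
  walk-down (suc r) {x} {y} h with ⨾-true⁻ (arc Γ) (walk Γ r) h
  ... | z , a , w with walk-down r w | bool (F x z)
  ...   | s , le , v | inj₁ k = s , ℕₚ.m≤n⇒m≤1+n le , subst (λ j → walk Γ/F s j (π y) ≡ true) (sym (π-cong k)) v
  ...   | s , le , v | inj₂ k = suc s , s≤s le , ⨾-true (arc Γ/F) (walk Γ/F s) (π z) (trans (arc-/ k) a) v

  connected-/ : StronglyConnected Γ/F
  connected-/ i j with walk-down (δ (repr i) (repr j)) (δ-walk (repr i) (repr j))
  ... | s , _ , w = s , subst₂ (λ a b → walk Γ/F s a b ≡ true) (π-repr i) (π-repr j) w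

  private module D = Distance Γ/F connected-/

  δ-/ : ∀ {x y} → F x y ≡ false → D.δ (π x) (π y) ≡ δ x y
  δ-/ {x} {y} h = ℕₚ.≤-antisym lower (upper (D.δ (π x) (π y)) refl)
    where
    lower : D.δ (π x) (π y) ≤ δ x y
    lower with walk-down (δ x y) (δ-walk x y)
    ... | s , le , w = ℕₚ.≤-trans (D.δ-least w) le
    upper : ∀ d → D.δ (π x) (π y) ≡ d → δ x y ≤ d
    upper zero    e = contradiction (D.δ≡0 e) (π-≢ h)
    upper (suc d) e = δ-least (walk-up d (subst (λ r → walk Γ/F r (π x) (π y) ≡ true) e (D.δ-walk (π x) (π y))))

  ty-/ : ∀ {x y} → F x y ≡ false → D.ty (π x) (π y) ≡ ty x y
  ty-/ h = cong₂ _,_ (δ-/ h) (δ-/ (≢true⇒≡false λ k → clash (symmetric k) h))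

  ty-diag-/ : ∀ i → D.ty i i ≡ (0 , 0)
  ty-diag-/ i = cong₂ _,_ (D.δ-refl i) (D.δ-refl i)

  ty-/-inv : ∀ {x y x' y'} → ty x y ≡ ty x' y' → D.ty (π x) (π y) ≡ D.ty (π x') (π y')
  ty-/-inv {x} {y} {x'} {y'} e with bool (F x y)
  ... | inj₂ h = trans (ty-/ h) (trans e (sym (ty-/ (trans (sym (inv e)) h))))
  ... | inj₁ h rewrite π-cong h | π-cong (trans (sym (inv e)) h) =
    trans (ty-diag-/ (π y)) (sym (ty-diag-/ (π y')))

  pulled : ℕ × ℕ → Rel (n Γ)
  pulled i x y = isTwoWay Γ/F (π x) (π y) i

  pulled-inv : ∀ i → Inv (pulled i)
  pulled-inv i {x} {y} {x'} {y'} e = bool-ext (half e) (half (sym e))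
    where
    half : ∀ {x y x' y'} → ty x y ≡ ty x' y' → pulled i x y ≡ true → pulled i x' y' ≡ true
    half {x} {y} {x'} {y'} e h =
      subst (λ j → isTwoWay Γ/F (π x') (π y') j ≡ true)
        (trans (sym (ty-/-inv e)) (D.isTwoWay⇒ty {i = i} h)) (D.isTwoWay-ty (π x') (π y'))

  module _ {t} (const : ∀ x → countFin (F x) ≡ suc t) where

    -- The pulled-back classes are invariant upstairs and each class of F contributes its full size,
    -- so constancy and commutativity descend after cancelling that size.
    pNum-/ : ∀ u v i j → N (pulled i) (pulled j) (repr u) (repr v) ≡ pNum Γ/F u v i j *ℕ suc t
    pNum-/ u v i j = trans
      (cong₂ (λ a b → countFin (λ z → isTwoWay Γ/F a (π z) i ∧ isTwoWay Γ/F (π z) b j)) (π-repr u) (π-repr v))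
      (count-∘π E Q const (λ k → isTwoWay Γ/F u k i ∧ isTwoWay Γ/F k v j))

    repr-injective : ∀ {u v} → F (repr u) (repr v) ≡ true → u ≡ v
    repr-injective {u} {v} h = trans (sym (π-repr u)) (trans (π-cong h) (π-repr v))

    diagonal : ∀ {u v u' v'} → F (repr u) (repr v) ≡ true → D.ty u v ≡ D.ty u' v' → u' ≡ v'
    diagonal {u} {v} h e with repr-injective h
    ... | refl = D.δ≡0 (trans (sym (cong proj₁ e)) (D.δ-refl v))

    -- Two representatives in one class coincide, so they give the diagonal type; for all other
    -- pairs the collapse preserves the type.
    ty-repr : ∀ {u v u' v'} → D.ty u v ≡ D.ty u' v' → ty (repr u) (repr v) ≡ ty (repr u') (repr v')
    ty-repr {u} {v} {u'} {v'} e with bool (F (repr u) (repr v)) | bool (F (repr u') (repr v'))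
    ... | inj₂ h | inj₂ k = trans (sym (ty-/ h))
            (trans (cong₂ D.ty (π-repr u) (π-repr v)) (trans e
            (trans (cong₂ D.ty (sym (π-repr u')) (sym (π-repr v'))) (ty-/ k))))
    ... | inj₁ h | _ = subst₂ (λ a b → ty (repr a) (repr v) ≡ ty (repr b) (repr v'))
            (sym (repr-injective h)) (sym (diagonal h e)) (ty-diag (repr v) (repr v'))
    ... | inj₂ h | inj₁ k = clash (subst (λ w → F (repr u) (repr w) ≡ true) (diagonal k (sym e)) (reflexive (repr u))) h

    pNum-regular : ∀ (h i j : ℕ × ℕ) u v u' v' → isTwoWay Γ/F u v h ≡ true → isTwoWay Γ/F u' v' h ≡ true →
                   pNum Γ/F u v i j ≡ pNum Γ/F u' v' i j
    pNum-regular h i j u v u' v' p q = ℕₚ.*-cancelʳ-≡ _ _ (suc t)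
      (trans (sym (pNum-/ u v i j))
        (trans (N-inv (pulled-inv i) (pulled-inv j)
                 (ty-repr (trans (D.isTwoWay⇒ty {i = h} p) (sym (D.isTwoWay⇒ty {i = h} q)))))
               (pNum-/ u' v' i j)))

    wdr-/ : (∃[ x ] ∃[ y ] F x y ≡ false × arc Γ x y ≡ true × arc Γ y x ≡ false) →
            WeaklyDistanceRegular Γ/F
    wdr-/ (x , y , h , a , b) = connected-/ ,
      (π x , π y , trans (arc-/ h) a , trans (arc-/ (≢true⇒≡false λ k → clash (symmetric k) h)) b) ,
      pNum-regular

    comm-/ : Commutative Γ/F
    comm-/ h i j u v p = ℕₚ.*-cancelʳ-≡ _ _ (suc t)
      (trans (sym (pNum-/ u v i j))
        (trans (N-comm (pulled-inv i) (pulled-inv j) (repr u) (repr v)) (pNum-/ u v j i)))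

-- Relations in a twinless multipartite digraph

record Twinless (Δ : Digraph) : Set where
  field
    wdr      : WeaklyDistanceRegular Δ
    comm     : Commutative Δ
    {parts}  : ℕ
    part     : V Δ → Fin parts
    section  : Fin parts → V Δ
    part-sec : ∀ i → part (section i) ≡ i
    multi    : MultipartiteBy Δ part
    -- Demanded for either order of x and y; equal out-degrees make this no stronger than the
    -- out-neighbourhoods being different.
    separate : ∀ {x y} → part x ≡ part y → x ≢ y → ∃[ z ] arc Δ x z ≡ true × arc Δ y z ≡ false
    mates    : ∃[ x ] ∃[ y ] part x ≡ part y × x ≢ y

module Relations {Δ : Digraph} (T : Twinless Δ) where
  open Twinless T public
  open Distance Δ (proj₁ wdr) public hiding (ty)

  X : Set
  X = V Δ

  abstract
    S : Scheme (n Δ)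
    S = scheme Δ wdr comm

    ty-δ : ∀ x y → Scheme.ty S x y ≡ (δ x y , δ y x)
    ty-δ x y = refl

    S-def : S ≡ scheme Δ wdr comm
    S-def = refl

  open Scheme S public

  -- The relations e, C, B, D turn out to be the classes of two-way distance (1,1), (1,2), (1,3), (2,2).
  abstract
    a f e two B C R D : Rel (n Δ)
    a       = arc Δ
    f x y   = a x y ∧ not (a y x)
    e x y   = a x y ∧ a y x
    two     = a ⨾ a
    B x y   = f x y ∧ not (two y x)
    C x y   = f x y ∧ two y x
    R x y   = part x == part y
    D x y   = R x y ∧ not (x == y)

    a-def : ∀ x y → a x y ≡ arc Δ x y
    a-def x y = refl

    f-def : ∀ x y → f x y ≡ a x y ∧ not (a y x)
    f-def x y = refl

    e-def : ∀ x y → e x y ≡ a x y ∧ a y x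
    e-def x y = refl

    two-def : ∀ x y → two x y ≡ (a ⨾ a) x y
    two-def x y = refl

    B-def : ∀ x y → B x y ≡ f x y ∧ not (two y x)
    B-def x y = refl

    C-def : ∀ x y → C x y ≡ f x y ∧ two y x
    C-def x y = refl

    R-def : ∀ x y → R x y ≡ (part x == part y)
    R-def x y = refl

    D-def : ∀ x y → D x y ≡ R x y ∧ not (x == y)
    D-def x y = refl

  -- ρ lies inside a single class, whereas `Inv` makes ρ a union of classes.
  Homogeneous : Rel (n Δ) → Set
  Homogeneous ρ = ∀ {x y x' y'} → ρ x y ≡ true → ρ x' y' ≡ true → ty x y ≡ ty x' y'

  module _ {x y : X} where

    R⇒part : R x y ≡ true → part x ≡ part y
    R⇒part h = ==⇒≡ (trans (sym (R-def x y)) h)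

    part⇒R : part x ≡ part y → R x y ≡ true
    part⇒R h = trans (R-def x y) (≡⇒== h)

    f⇒a : f x y ≡ true → a x y ≡ true
    f⇒a h = proj₁ (∧-true⁻ (trans (sym (f-def x y)) h))

    f⇒¬a : f x y ≡ true → a y x ≡ false
    f⇒¬a h = not-true⁻ (proj₂ (∧-true⁻ {a x y} (trans (sym (f-def x y)) h)))

    mk-f : a x y ≡ true → a y x ≡ false → f x y ≡ true
    mk-f h k = trans (f-def x y) (∧-true h (not-true k))

    e⇒a : e x y ≡ true → a x y ≡ true
    e⇒a h = proj₁ (∧-true⁻ (trans (sym (e-def x y)) h))

    e⇒aᵒ : e x y ≡ true → a y x ≡ true
    e⇒aᵒ h = proj₂ (∧-true⁻ {a x y} (trans (sym (e-def x y)) h))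

    mk-e : a x y ≡ true → a y x ≡ true → e x y ≡ true
    mk-e h k = trans (e-def x y) (∧-true h k)

    mk-two : ∀ z → a x z ≡ true → a z y ≡ true → two x y ≡ true
    mk-two z h k = trans (two-def x y) (⨾-true a a z h k)

    two⁻ : two x y ≡ true → ∃[ z ] a x z ≡ true × a z y ≡ true
    two⁻ h = ⨾-true⁻ a a (trans (sym (two-def x y)) h)

    B⇒f : B x y ≡ true → f x y ≡ true
    B⇒f h = proj₁ (∧-true⁻ (trans (sym (B-def x y)) h))

    B⇒a : B x y ≡ true → a x y ≡ true
    B⇒a h = f⇒a (B⇒f h)

    B⇒¬two : B x y ≡ true → two y x ≡ false
    B⇒¬two h = not-true⁻ (proj₂ (∧-true⁻ {f x y} (trans (sym (B-def x y)) h)))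

    C⇒f : C x y ≡ true → f x y ≡ true
    C⇒f h = proj₁ (∧-true⁻ (trans (sym (C-def x y)) h))

    C⇒a : C x y ≡ true → a x y ≡ true
    C⇒a h = f⇒a (C⇒f h)

    C⇒two : C x y ≡ true → two y x ≡ true
    C⇒two h = proj₂ (∧-true⁻ {f x y} (trans (sym (C-def x y)) h))

    f-split : f x y ≡ true → B x y ≡ true ⊎ C x y ≡ true
    f-split h with bool (two y x)
    ... | inj₁ k = inj₂ (trans (C-def x y) (∧-true h k))
    ... | inj₂ k = inj₁ (trans (B-def x y) (∧-true h (not-true k)))

    a-split : a x y ≡ true → e x y ≡ true ⊎ f x y ≡ true
    a-split h with bool (a y x)
    ... | inj₁ k = inj₁ (mk-e h k)
    ... | inj₂ k = inj₂ (mk-f h k)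

    D⇒R : D x y ≡ true → R x y ≡ true
    D⇒R h = proj₁ (∧-true⁻ (trans (sym (D-def x y)) h))

    D⇒≢ : D x y ≡ true → x ≢ y
    D⇒≢ h = ==⇒≢ (not-true⁻ (proj₂ (∧-true⁻ {R x y} (trans (sym (D-def x y)) h))))

    mk-D : R x y ≡ true → x ≢ y → D x y ≡ true
    mk-D h k = trans (D-def x y) (∧-true h (not-true (≢⇒== k)))

    und-R : a x y ∨ a y x ≡ not (R x y)
    und-R = trans (cong₂ _∨_ (a-def x y) (a-def y x)) (trans (multi x y) (cong not (sym (R-def x y))))

  R-refl : ∀ x → R x x ≡ true
  R-refl x = part⇒R refl

  R-sym : ∀ {x y} → R x y ≡ true → R y x ≡ true
  R-sym h = part⇒R (sym (R⇒part h))

  R-trans : ∀ {x y z} → R x y ≡ true → R y z ≡ true → R x z ≡ true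
  R-trans h k = part⇒R (trans (R⇒part h) (R⇒part k))

  R-equivalence : Equivalence R
  R-equivalence = record { reflexive = R-refl ; symmetric = R-sym ; transitive = R-trans }

  open Equivalence R-equivalence public using () renaming (class-cong to R-row; class-congʳ to R-col)

  ¬R-sym : ∀ {x y} → R x y ≡ false → R y x ≡ false
  ¬R-sym h = ≢true⇒≡false λ k → clash (R-sym k) h

  R-comm : ∀ x y → R x y ≡ R y x
  R-comm x y = bool-ext R-sym R-sym

  R⇒¬a : ∀ {x y} → R x y ≡ true → a x y ≡ false
  R⇒¬a {x} {y} h = proj₁ (∨-false⁻ {a x y} (trans und-R (cong not h)))

  a⇒¬R : ∀ {x y} → a x y ≡ true → R x y ≡ false
  a⇒¬R h = ≢true⇒≡false λ k → clash h (R⇒¬a k)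

  a⇒¬Rᵒ : ∀ {x y} → a x y ≡ true → R y x ≡ false
  a⇒¬Rᵒ h = ¬R-sym (a⇒¬R h)

  a-irrefl : ∀ x → a x x ≡ false
  a-irrefl x = R⇒¬a (R-refl x)

  a⇒≢ : ∀ {x y} → a x y ≡ true → x ≢ y
  a⇒≢ {x} h refl = clash h (a-irrefl x)

  a⇒≢ᵒ : ∀ {x y} → a x y ≡ true → y ≢ x
  a⇒≢ᵒ h q = a⇒≢ h (sym q)

  total : ∀ {x y} → R x y ≡ false → a x y ≡ true ⊎ a y x ≡ true
  total {x} {y} h = ∨-true⁻ {a x y} (trans und-R (cong not h))

  one-way : ∀ {x y} → R x y ≡ false → a y x ≡ false → f x y ≡ true
  one-way h k with total h
  ... | inj₁ p = mk-f p k
  ... | inj₂ p = clash p k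

  e-sym : ∀ {x y} → e x y ≡ true → e y x ≡ true
  e-sym h = mk-e (e⇒aᵒ h) (e⇒a h)

  D-sym : ∀ {x y} → D x y ≡ true → D y x ≡ true
  D-sym h = mk-D (R-sym (D⇒R h)) (λ q → D⇒≢ h (sym q))

  data Position (x y : X) : Set where
    here  : x ≡ y → Position x y
    mate  : D x y ≡ true → Position x y
    both  : e x y ≡ true → Position x y
    into  : f x y ≡ true → Position x y
    outof : f y x ≡ true → Position x y

  position : ∀ x y → Position x y
  position x y with bool (R x y) | x ≟ᶠ y
  ... | inj₁ h | yes q = here q
  ... | inj₁ h | no q  = mate (mk-D h q)
  ... | inj₂ h | _ with total h
  ...   | inj₁ k = [ both , into ]′ (a-split k)
  ...   | inj₂ k = [ (λ q → both (e-sym q)) , outof ]′ (a-split k)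

  ty-fst : ∀ {x y x' y'} → ty x y ≡ ty x' y' → δ x y ≡ δ x' y'
  ty-fst {x} {y} {x'} {y'} q = cong proj₁ (trans (sym (ty-δ x y)) (trans q (ty-δ x' y')))

  a⇒δ : ∀ {x y} → a x y ≡ true → δ x y ≡ 1
  a⇒δ {x} {y} h = arc⇒δ (trans (sym (a-def x y)) h)

  abstract
    a-inv : Inv a
    a-inv = arc-inv Δ wdr comm

    I-inv : Inv _==_
    I-inv q = bool-ext (half q) (half (sym q))
      where
      half : ∀ {x y x' y'} → ty x y ≡ ty x' y' → (x == y) ≡ true → (x' == y') ≡ true
      half {x} {y} {x'} {y'} q h = ≡⇒== (δ≡0 (trans (sym (ty-fst q))
        (subst (λ w → δ x w ≡ 0) (==⇒≡ h) (δ-refl x))))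

    -- Lying in one part means being non-adjacent in the underlying graph.
    R-inv : Inv R
    R-inv {x} {y} {x'} {y'} q = begin
      R x y                    ≡⟨ not-involutive (R x y) ⟨
      not (not (R x y))        ≡⟨ cong not und-R ⟨
      not (a x y ∨ a y x)      ≡⟨ cong not (cong₂ _∨_ (a-inv q) (a-inv (ty-flip q))) ⟩
      not (a x' y' ∨ a y' x')  ≡⟨ cong not und-R ⟩
      not (not (R x' y'))      ≡⟨ not-involutive (R x' y') ⟩
      R x' y'                  ∎
      where open ≡-Reasoning

    f-inv : Inv f
    f-inv = ∧-inv {a} {λ x y → not (a y x)} a-inv (not-inv {a ᵒ} (flip-inv {a} a-inv))

    e-inv : Inv e
    e-inv = ∧-inv {a} {a ᵒ} a-inv (flip-inv {a} a-inv)

    two-inv : Inv two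
    two-inv = ⨾-inv {a} {a} a-inv a-inv

    B-inv : Inv B
    B-inv = ∧-inv {f} {λ x y → not (two y x)} f-inv (not-inv {two ᵒ} (flip-inv {two} two-inv))

    C-inv : Inv C
    C-inv = ∧-inv {f} {two ᵒ} f-inv (flip-inv {two} two-inv)

    D-inv : Inv D
    D-inv = ∧-inv {R} {λ x y → not (x == y)} R-inv (not-inv {_==_} I-inv)

  deg-a : ∀ x y → countFin (a x) ≡ countFin (a y)
  deg-a = deg-const {a} a-inv

  deg-aᵒ : ∀ x y → countFin (λ w → a w x) ≡ countFin (λ w → a w y)
  deg-aᵒ = deg-const {a ᵒ} (flip-inv {a} a-inv)

  -- A vertex separating x from y lies outside their part, so it is adjacent to y, and the only
  -- direction left is towards y. This is where the absence of twins enters.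
  detour : ∀ {x y} → D x y ≡ true → ∃[ z ] a x z ≡ true × f z y ≡ true
  detour {x} {y} h with separate (R⇒part (D⇒R h)) (D⇒≢ h)
  ... | z , p' , q' = z , p , one-way (≢true⇒≡false λ k → clash (R-trans (D⇒R h) (R-sym k)) (a⇒¬R p)) q
    where
    p = trans (a-def x z) p'
    q = trans (a-def y z) q'

  walk-two : ∀ {x y} → two x y ≡ true → walk Δ 2 x y ≡ true
  walk-two {x} {y} h with two⁻ h
  ... | z , p , q = step-walk {r = 1} (trans (sym (a-def x z)) p) (arc⇒walk (trans (sym (a-def z y)) q))

  walk-two⁻ : ∀ {x y} → walk Δ 2 x y ≡ true → two x y ≡ true
  walk-two⁻ {x} {y} h with ⨾-true⁻ (arc Δ) (walk Δ 1) h
  ... | z , p , q = mk-two z (trans (a-def x z) p) (trans (a-def z y) (walk⇒arc q))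

  module _ {x y} (x≢y : x ≢ y) (¬xy : a x y ≡ false) where

    δ≡2 : two x y ≡ true → δ x y ≡ 2
    δ≡2 h = δ-two x≢y (trans (sym (a-def x y)) ¬xy) (walk-two h)

    δ≡3 : two x y ≡ false → walk Δ 3 x y ≡ true → δ x y ≡ 3
    δ≡3 h w = ℕₚ.≤-antisym (δ-least w) (ℕₚ.≤∧≢⇒< (δ≥2 x≢y (trans (sym (a-def x y)) ¬xy)) λ q →
      clash (walk-two⁻ (subst (λ r → walk Δ r x y ≡ true) (sym q) (δ-walk x y))) h)

  D-two : ∀ {x y} → D x y ≡ true → two x y ≡ true
  D-two h with detour h
  ... | z , p , q = mk-two z p (f⇒a q)

  hom-by : ∀ {ρ i j} → (∀ {x y} → ρ x y ≡ true → δ x y ≡ i × δ y x ≡ j) → Homogeneous ρ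
  hom-by v {x} {y} {x'} {y'} h k = trans (trans (ty-δ x y) (trans
    (cong₂ _,_ (trans (proj₁ (v h)) (sym (proj₁ (v k)))) (trans (proj₂ (v h)) (sym (proj₂ (v k))))) refl))
    (sym (ty-δ x' y'))

  D-hom : Homogeneous D
  D-hom = hom-by {D} {2} {2} λ h → dist h , dist (D-sym h)
    where
    dist : ∀ {x y} → D x y ≡ true → δ x y ≡ 2
    dist h = δ≡2 (D⇒≢ h) (R⇒¬a (D⇒R h)) (D-two h)

  e-hom : Homogeneous e
  e-hom = hom-by {e} {1} {1} λ h → a⇒δ (e⇒a h) , a⇒δ (e⇒aᵒ h)

  C-hom : Homogeneous C
  C-hom = hom-by {C} {1} {2} λ h → a⇒δ (C⇒a h) , δ≡2 (a⇒≢ᵒ (C⇒a h)) (f⇒¬a (C⇒f h)) (C⇒two h)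

  module _ {x y} (h : B x y ≡ true) where

    -- An arc y → w would close a walk y → w → x of length two, which a B-arc excludes. `pull` is
    -- the mirror image for out-neighbours of y.
    push : ∀ {w} → a w x ≡ true → R w y ≡ false → f w y ≡ true
    push {w} p q = one-way q (≢true⇒≡false λ k → clash (mk-two w k p) (B⇒¬two h))

    pull : ∀ {w} → a y w ≡ true → R x w ≡ false → f x w ≡ true
    pull {w} p q = one-way q (≢true⇒≡false λ k → clash (mk-two w p k) (B⇒¬two h))

    -- Equal out-degrees give an out-neighbour z of y that is not one of x, and by `pull` it can
    -- only lie in the part of x. Two more steps lead from z to its mate x, so the way back along a
    -- B-arc has length three.
    return : ∃[ z ] D x z ≡ true × a y z ≡ true
    return with count-exchange (a x) (a y) (ℕₚ.≤-reflexive (deg-a x y)) (B⇒a h) (a-irrefl y)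
    ... | z , p , q with bool (R x z)
    ...   | inj₁ k = z , mk-D k (λ { refl → clash p (f⇒¬a (B⇒f h)) }) , p
    ...   | inj₂ k = clash (f⇒a (pull p k)) q

  B-hom : Homogeneous B
  B-hom = hom-by {B} {1} {3} λ h →
    a⇒δ (B⇒a h) , δ≡3 (a⇒≢ᵒ (B⇒a h)) (f⇒¬a (B⇒f h)) (B⇒¬two h) (back h)
    where
    back : ∀ {x y} → B x y ≡ true → walk Δ 3 y x ≡ true
    back {x} {y} h with return h
    ... | z , d , p = step-walk {r = 2} (trans (sym (a-def y z)) p) (walk-two (D-two (D-sym d)))

  -- The number of ρ-successors of x in the part of y; by commutativity it depends only on the parts of x and y.
  cnt : Rel (n Δ) → X → X → ℕ
  cnt ρ = N ρ R

  cnt-col : ∀ ρ {x y y'} → R y y' ≡ true → cnt ρ x y ≡ cnt ρ x y'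
  cnt-col ρ {x} h = count-cong λ z → cong (ρ x z ∧_) (R-col h z)

  -- Commuting ρ with R moves the step inside a part to the front, where only the part of x matters.
  cnt-row : ∀ {ρ} → Inv ρ → ∀ {x x' y} → R x x' ≡ true → cnt ρ x y ≡ cnt ρ x' y
  cnt-row {ρ} iρ {x} {x'} {y} h = trans (N-comm {ρ} {R} iρ R-inv x y)
    (trans (count-cong λ z → cong (_∧ ρ z y) (R-row h z)) (sym (N-comm {ρ} {R} iρ R-inv x' y)))

  -- After commuting with R, the middle vertex lies in the part of x and is a ρ-predecessor of y.
  cnt-flip : ∀ {ρ} → Inv ρ → ∀ x y → cnt ρ x y ≡ cnt (ρ ᵒ) y x
  cnt-flip {ρ} iρ x y = trans (N-comm {ρ} {R} iρ R-inv x y)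
    (count-cong λ z → trans (∧-comm (R x z) (ρ z y)) (cong (ρ z y ∧_) (R-comm x z)))

  cnt-inv : ∀ {ρ} → Inv ρ → ∀ {x y x' y'} → ty x y ≡ ty x' y' → cnt ρ x y ≡ cnt ρ x' y'
  cnt-inv {ρ} iρ = N-inv {ρ} {R} iρ R-inv

  cnt-pos : ∀ {ρ x y} → ρ x y ≡ true → 1 ≤ cnt ρ x y
  cnt-pos {ρ} {x} {y} h = count-pos (λ z → ρ x z ∧ R z y) y (∧-true h (R-refl y))

  cnt-pos⁻ : ∀ {ρ x y} → 1 ≤ cnt ρ x y → ∃[ z ] ρ x z ≡ true × R z y ≡ true
  cnt-pos⁻ {ρ} {x} {y} h with count-pos⁻ (λ z → ρ x z ∧ R z y) h
  ... | z , p = z , ∧-true⁻ p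

  deg-R : ∀ x y → countFin (R x) ≡ countFin (R y)
  deg-R = deg-const {R} R-inv

  -- A vertex in the part of y that receives no arc from x must send one to x, and this arc is
  -- one-way.
  cnt-total : ∀ {x y} → R x y ≡ false → cnt a x y + cnt (f ᵒ) x y ≡ countFin (R x)
  cnt-total {x} {y} h = trans (sym (count-⊎
    {h = λ z → R z y} {λ z → a x z ∧ R z y} {λ z → (f ᵒ) x z ∧ R z y}
    (λ z k → proj₂ (∧-true⁻ {a x z} k)) (λ z k → proj₂ (∧-true⁻ {f z x} k))
    (λ z k → case bool (a x z) of λ
       { (inj₁ q) → inj₁ (∧-true q k)
       ; (inj₂ q) → inj₂ (∧-true (one-way (≢true⇒≡false λ r → clash (R-trans (R-sym r) k) h) q) k) })
    (λ z k → ≢true⇒≡false λ q → clash (proj₁ (∧-true⁻ {a x z} k)) (f⇒¬a (proj₁ (∧-true⁻ {f z x} q))))))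
    (trans (count-cong λ z → R-comm z y) (deg-R y x))

-- Double counting of two-step paths

sum-on : ∀ {n} (f : Fin n → Bool) (g : Fin n → ℕ) c → (∀ i → f i ≡ true → g i ≡ c) →
         sum (λ i → 𝟙 (f i) *ℕ g i) ≡ countFin f *ℕ c
sum-on f g c h = trans (sum-cong-≗ λ i → lem (f i) (h i)) (sum-const-on f c)
  where
  lem : ∀ b {x} → (b ≡ true → x ≡ c) → 𝟙 b *ℕ x ≡ 𝟙 b *ℕ c
  lem true  k = cong (1 *ℕ_) (k refl)
  lem false k = refl

-- Both sides count the pairs (z , y) with a ρ-step from x to z, a σ-step from z to y, and y in τ.
-- All later double counts are instances.
exchange : ∀ {n} (ρ σ : Rel n) x (τ : Fin n → Bool) →
           sum (λ y → 𝟙 (τ y) *ℕ N ρ σ x y) ≡ sum (λ z → 𝟙 (ρ x z) *ℕ countFin (λ y → σ z y ∧ τ y))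
exchange ρ σ x τ = begin
  sum (λ y → 𝟙 (τ y) *ℕ N ρ σ x y)
    ≡⟨ sum-cong-≗ (λ y → count-guard (τ y) (λ z → ρ x z ∧ σ z y)) ⟨
  sum (λ y → countFin (λ z → τ y ∧ (ρ x z ∧ σ z y)))
    ≡⟨ double-count (λ y z → τ y ∧ (ρ x z ∧ σ z y)) ⟩
  sum (λ z → countFin (λ y → τ y ∧ (ρ x z ∧ σ z y)))
    ≡⟨ sum-cong-≗ (λ z → trans (count-cong λ y → rearrange (τ y) (ρ x z) (σ z y))
                                (count-guard (ρ x z) (λ y → σ z y ∧ τ y))) ⟩
  _ ∎
  where
  open ≡-Reasoning
  rearrange : ∀ a b c → a ∧ (b ∧ c) ≡ b ∧ (c ∧ a)
  rearrange a b c = trans (∧-comm a (b ∧ c)) (∧-assoc b c a)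

-- One-way arcs forming a single class

module SingleClass {Δ : Digraph} (T : Twinless Δ) where
  open Relations T

  module _ (f-hom : Homogeneous f) where

    -- Take mates s and t with a detour s → z → t. Replacing t by s does not change `cnt f z t`. If
    -- s → z is one-way, then (z , s) has the type of (y , x), because all one-way arcs have one
    -- type. If it is a digon, its symmetric type allows z and s to be interchanged, and replacing s
    -- by t leads to (t , z), again of the type of (y , x).
    cnt-f-arc : ∀ {x y} → f x y ≡ true → cnt f x y ≡ cnt f y x
    cnt-f-arc {x} {y} h with mates
    ... | s , t , same , s≢t with detour (mk-D (part⇒R same) s≢t)
    ...   | z , p , q with a-split p
    ...     | inj₂ r = trans (cnt-inv {f} f-inv (f-hom h q))
                 (trans (cnt-col f (R-sym (part⇒R same))) (cnt-inv {f} f-inv (ty-flip (f-hom r h))))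
    ...     | inj₁ r = trans (cnt-inv {f} f-inv (f-hom h q))
                 (trans (cnt-col f (R-sym (part⇒R same)))
                 (trans (cnt-inv {f} f-inv (e-hom (e-sym r) r))
                 (trans (cnt-row {f} f-inv (part⇒R same)) (cnt-inv {f} f-inv (ty-flip (f-hom q h))))))

    cnt-f-sym : ∀ x y → cnt f x y ≡ cnt f y x
    cnt-f-sym x y with position x y
    ... | here refl = refl
    ... | mate h    = trans (cnt-row {f} f-inv (D⇒R h)) (cnt-col f (R-sym (D⇒R h)))
    ... | both h    = cnt-inv {f} f-inv (e-hom h (e-sym h))
    ... | into h    = cnt-f-arc h
    ... | outof h   = sym (cnt-f-arc h)

    split-a : (τ : X → Bool) → ∀ x →
              countFin (λ z → a x z ∧ τ z) ≡ countFin (λ z → e x z ∧ τ z) + countFin (λ z → f x z ∧ τ z)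
    split-a τ x = count-⊎ {f = λ z → e x z ∧ τ z} {λ z → f x z ∧ τ z}
      (λ z h → let p , q = ∧-true⁻ {e x z} h in ∧-true (e⇒a p) q)
      (λ z h → let p , q = ∧-true⁻ {f x z} h in ∧-true (f⇒a p) q)
      (λ z h → let p , q = ∧-true⁻ {a x z} h in
        [ (λ r → inj₁ (∧-true r q)) , (λ r → inj₂ (∧-true r q)) ]′ (a-split p))
      (λ z h → ≢true⇒≡false λ k →
        clash (e⇒aᵒ (proj₁ (∧-true⁻ {e x z} h))) (f⇒¬a (proj₁ (∧-true⁻ {f x z} k))))

    cnt-a-sym : ∀ x y → cnt a x y ≡ cnt a y x
    cnt-a-sym x y = begin
      cnt a x y             ≡⟨ split-a (λ z → R z y) x ⟩
      cnt e x y + cnt f x y ≡⟨ cong₂ _+_ (trans (cnt-flip {e} e-inv x y)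
                                 (count-cong λ z → cong (_∧ R z x) (bool-ext e-sym e-sym))) (cnt-f-sym x y) ⟩
      cnt e y x + cnt f y x ≡⟨ split-a (λ z → R z x) y ⟨
      cnt a y x             ∎
      where open ≡-Reasoning

    -- An out-neighbour of x sends a one-way arc to y, or is also an out-neighbour of y, or lies in
    -- the part of y, and these exclude each other. The last two numbers turn out symmetric in x and
    -- y, so the first one must be as well.
    deg-a-split : ∀ x y → countFin (a x) ≡ N a f x y + (N a (a ᵒ) x y + cnt a x y)
    deg-a-split x y = trans
      (count-⊎ {f = λ z → a x z ∧ f z y} {λ z → a x z ∧ not (f z y)}
        (λ z h → proj₁ (∧-true⁻ h)) (λ z h → proj₁ (∧-true⁻ h))
        (λ z h → [ (λ k → inj₁ (∧-true h k)) , (λ k → inj₂ (∧-true h (not-true k))) ]′ (bool (f z y)))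
        (λ z h → ≢true⇒≡false λ k → clash (proj₂ (∧-true⁻ {a x z} h)) (not-true⁻ (proj₂ (∧-true⁻ {a x z} k)))))
      (cong (N a f x y +_) (count-⊎ {f = λ z → a x z ∧ a y z} {λ z → a x z ∧ R z y}
        (λ z h → let p , q = ∧-true⁻ {a x z} h in ∧-true p (not-true (≢true⇒≡false λ k → clash q (f⇒¬a k))))
        (λ z h → let p , q = ∧-true⁻ {a x z} h in ∧-true p (not-true (≢true⇒≡false λ k → clash q (a⇒¬R (f⇒a k)))))
        (λ z h → let p , q = ∧-true⁻ {a x z} h in case bool (R z y) of λ
           { (inj₁ r) → inj₂ (∧-true p r)
           ; (inj₂ r) → inj₁ (∧-true p (case bool (a y z) of λ
               { (inj₁ s) → s ; (inj₂ s) → clash (one-way r s) (not-true⁻ q) })) })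
        (λ z h → ≢true⇒≡false λ k →
          clash (proj₂ (∧-true⁻ {a x z} k)) (a⇒¬Rᵒ (proj₂ (∧-true⁻ {a x z} h))))))

    -- On strict arcs this is the Type II condition β₁ + β₂ - α₁ - α₂ = 0.
    N-a-f-sym : ∀ x y → N a f x y ≡ N a f y x
    N-a-f-sym x y = ℕₚ.+-cancelʳ-≡ (N a (a ᵒ) x y + cnt a x y) _ _ (begin
      N a f x y + (N a (a ᵒ) x y + cnt a x y) ≡⟨ deg-a-split x y ⟨
      countFin (a x)                          ≡⟨ deg-a x y ⟩
      countFin (a y)                          ≡⟨ deg-a-split y x ⟩
      N a f y x + (N a (a ᵒ) y x + cnt a y x)
        ≡⟨ cong (N a f y x +_) (cong₂ _+_ (count-cong λ z → ∧-comm (a y z) (a x z)) (cnt-a-sym y x)) ⟩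
      N a f y x + (N a (a ᵒ) x y + cnt a x y) ∎)
      where open ≡-Reasoning

    N-a-f-split : ∀ x y → N a f x y ≡ N e f x y + N f f x y
    N-a-f-split x y = split-a (λ z → f z y) x

    -- Forward and backward one-way arcs are equally many by `cnt-f-sym`, and digons make up the
    -- rest of the part. This is the Type II relation between c, e and r.
    cnt-f-e-total : ∀ {x y} → R x y ≡ false → 2 *ℕ cnt f x y + cnt e x y ≡ countFin (R x)
    cnt-f-e-total {x} {y} h = begin
      2 *ℕ cnt f x y + cnt e x y          ≡⟨ arith (cnt f x y) (cnt e x y) ⟩
      cnt e x y + cnt f x y + cnt f x y   ≡⟨ cong₂ _+_ (sym (split-a (λ z → R z y) x))
                                              (trans (cnt-f-sym x y) (cnt-flip {f} f-inv y x)) ⟩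
      cnt a x y + cnt (f ᵒ) x y           ≡⟨ cnt-total h ⟩
      countFin (R x)                      ∎
      where
      open ≡-Reasoning
      arith : ∀ u w → 2 *ℕ u + w ≡ w + u + u
      arith = solve-∀

  part-size : ∀ i x → countFin (λ y → part y == i) ≡ countFin (R x)
  part-size i x = trans (count-cong λ y → trans (==-sym (part y) i)
      (trans (cong (_== part y) (sym (part-sec i))) (sym (R-def (section i) y))))
    (deg-R (section i) x)

  order : ∀ x → n Δ ≡ parts *ℕ countFin (R x)
  order x = begin
    n Δ                                                  ≡⟨ count-all {n Δ} {λ _ → true} (λ _ → refl) ⟨
    countFin {n Δ} (λ _ → true)                          ≡⟨ count-fibres part (λ _ → true) ⟩
    sum (λ i → countFin (λ z → (part z == i) ∧ true))
      ≡⟨ sum-cong-≗ (λ i → trans (count-cong λ z → ∧-identityʳ (part z == i))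
           (trans (part-size i x) (sym (ℕₚ.+-identityʳ _)))) ⟩
    sum {parts} (λ i → 𝟙 true *ℕ countFin (R x))         ≡⟨ sum-const-on {parts} (λ _ → true) (countFin (R x)) ⟩
    countFin {parts} (λ _ → true) *ℕ countFin (R x)      ≡⟨ cong (_*ℕ countFin (R x)) (count-all {parts} {λ _ → true} (λ _ → refl)) ⟩
    parts *ℕ countFin (R x)                              ∎
    where open ≡-Reasoning

  deg-R-D : ∀ x → countFin (R x) ≡ 1 + countFin (D x)
  deg-R-D x = trans (count-⊎ {f = x ==_} {D x}
      (λ z h → subst (λ w → R x w ≡ true) (==⇒≡ h) (R-refl x)) (λ z h → D⇒R h)
      (λ z h → case x ≟ᶠ z of λ { (yes q) → inj₁ (≡⇒== q) ; (no q) → inj₂ (mk-D h q) })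
      (λ z h → ≢true⇒≡false λ k → D⇒≢ k (==⇒≡ h)))
    (cong (_+ countFin (D x)) (count-singleton x))

  arc-pair : ∃[ x ] ∃[ y ] f x y ≡ true
  arc-pair with proj₁ (proj₂ wdr)
  ... | x , y , p , q = x , y , mk-f (trans (a-def x y) p) (trans (a-def y x) q)

  module _ (no-e : ∀ x y → e x y ≡ false) (f-hom : Homogeneous f) where

    a⇒f : ∀ {x y} → a x y ≡ true → f x y ≡ true
    a⇒f {x} {y} h with a-split h
    ... | inj₁ k = clash k (no-e x y)
    ... | inj₂ k = k

    a≡f : ∀ x y → a x y ≡ f x y
    a≡f x y = bool-ext a⇒f f⇒a

    cnt-a-half : ∀ {x y} → R x y ≡ false → 2 *ℕ cnt a x y ≡ countFin (R x)
    cnt-a-half {x} {y} h = begin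
      2 *ℕ cnt a x y             ≡⟨ cong (2 *ℕ_) (count-cong λ z → cong (_∧ R z y) (a≡f x z)) ⟩
      2 *ℕ cnt f x y             ≡⟨ ℕₚ.+-identityʳ _ ⟨
      2 *ℕ cnt f x y + 0         ≡⟨ cong (2 *ℕ cnt f x y +_) (count-none {f = λ z → e x z ∧ R z y} λ z →
                                      cong (_∧ R z y) (no-e x z)) ⟨
      2 *ℕ cnt f x y + cnt e x y ≡⟨ cnt-f-e-total f-hom h ⟩
      countFin (R x)             ∎
      where open ≡-Reasoning

    N-a-a-sym : ∀ x y → N a a x y ≡ N a a y x
    N-a-a-sym x y = begin
      N a a x y ≡⟨ count-cong (λ z → cong (a x z ∧_) (a≡f z y)) ⟩
      N a f x y ≡⟨ N-a-f-sym f-hom x y ⟩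
      N a f y x ≡⟨ count-cong (λ z → cong (a y z ∧_) (a≡f z x)) ⟨
      N a a y x ∎
      where open ≡-Reasoning

    a-hom : Homogeneous a
    a-hom h k = f-hom (a⇒f h) (a⇒f k)

    order-a : ∀ x → parts *ℕ countFin (R x) ≡ 2 *ℕ countFin (a x) + countFin (R x)
    order-a x = begin
      parts *ℕ countFin (R x)                                        ≡⟨ order x ⟨
      n Δ                                                            ≡⟨ count-all {n Δ} {λ _ → true} (λ _ → refl) ⟨
      countFin {n Δ} (λ _ → true)                                    ≡⟨ count-split (λ _ → true) (a x) ⟩
      countFin (a x) + countFin (λ z → not (a x z))
        ≡⟨ cong (countFin (a x) +_) (count-⊎ {f = λ z → a z x} {R x}
             (λ z h → not-true (f⇒¬a (a⇒f h))) (λ z h → not-true (R⇒¬a h))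
             (λ z h → case bool (R x z) of λ
                { (inj₁ r) → inj₂ r ; (inj₂ r) → inj₁ (f⇒a (one-way (¬R-sym r) (not-true⁻ h))) })
             (λ z h → a⇒¬Rᵒ h)) ⟩
      countFin (a x) + (countFin (λ z → a z x) + countFin (R x))
        ≡⟨ cong (λ k → countFin (a x) + (k + countFin (R x))) (deg-flip {a} a-inv x x) ⟩
      countFin (a x) + (countFin (a x) + countFin (R x))             ≡⟨ arith (countFin (a x)) (countFin (R x)) ⟩
      2 *ℕ countFin (a x) + countFin (R x)                           ∎
      where
      open ≡-Reasoning
      arith : ∀ k r → k + (k + r) ≡ 2 *ℕ k + r
      arith = solve-∀

    -- Two-step paths from x into the part of y are counted by end and by middle vertex. Every end
    -- carries the same number, whichever way its arc with x points, by `N-a-a-sym`. A middle vertex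
    -- must lie outside the part of y and then reaches half of it.
    paths-to-part : ∀ {x y} → a x y ≡ true →
      countFin (R x) *ℕ N a a x y ≡ countFin (λ z → a x z ∧ not (R z y)) *ℕ cnt a x y
    paths-to-part {x} {y} h = begin
      countFin (R x) *ℕ N a a x y
        ≡⟨ cong (_*ℕ N a a x y) (deg-R x y) ⟩
      countFin (R y) *ℕ N a a x y
        ≡⟨ sum-on (R y) (N a a x) (N a a x y) (λ y' r → end r) ⟨
      sum (λ y' → 𝟙 (R y y') *ℕ N a a x y')
        ≡⟨ exchange a a x (R y) ⟩
      sum (λ z → 𝟙 (a x z) *ℕ countFin (λ y' → a z y' ∧ R y y'))
        ≡⟨ sum-cong-≗ (λ z → middle z) ⟩
      sum (λ z → 𝟙 (a x z ∧ not (R z y)) *ℕ cnt a x y)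
        ≡⟨ sum-const-on (λ z → a x z ∧ not (R z y)) (cnt a x y) ⟩
      _ ∎
      where
      open ≡-Reasoning
      end : ∀ {y'} → R y y' ≡ true → N a a x y' ≡ N a a x y
      end {y'} r with total (≢true⇒≡false λ k → clash (R-trans k (R-sym r)) (a⇒¬R h))
      ... | inj₁ p = N-inv {a} {a} a-inv a-inv (a-hom p h)
      ... | inj₂ p = trans (N-a-a-sym x y') (N-inv {a} {a} a-inv a-inv (a-hom p h))
      half : ∀ {x y x' y'} → R x y ≡ false → R x' y' ≡ false → cnt a x y ≡ cnt a x' y'
      half {x} {y} {x'} {y'} r s = ℕₚ.*-cancelˡ-≡ _ _ 2
        (trans (cnt-a-half r) (trans (deg-R x x') (sym (cnt-a-half s))))
      middle : ∀ z → 𝟙 (a x z) *ℕ countFin (λ y' → a z y' ∧ R y y') ≡ 𝟙 (a x z ∧ not (R z y)) *ℕ cnt a x y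
      middle z with bool (R z y)
      ... | inj₁ r rewrite r | ∧-zeroʳ (a x z) = trans (cong (𝟙 (a x z) *ℕ_) (count-none λ y' → ≢true⇒≡false λ k →
              let p , q = ∧-true⁻ {a z y'} k in clash (R-trans r q) (a⇒¬R p))) (ℕₚ.*-zeroʳ (𝟙 (a x z)))
      ... | inj₂ r rewrite r | ∧-identityʳ (a x z) = cong (𝟙 (a x z) *ℕ_)
              (trans (count-cong λ y' → cong (a z y' ∧_) (R-comm y y')) (half r (a⇒¬R h)))

    -- Two-step paths from x to its mates: each middle vertex reaches half of the part of x, and
    -- never x itself, as there are no digons.
    paths-to-mates : ∀ {x y} → D x y ≡ true →
      ∀ {z w} → a z w ≡ true → countFin (D x) *ℕ N a a x y ≡ countFin (a x) *ℕ cnt a z w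
    paths-to-mates {x} {y} h {z} {w} k = begin
      countFin (D x) *ℕ N a a x y
        ≡⟨ sum-on (D x) (N a a x) (N a a x y) (λ y' d → N-inv {a} {a} a-inv a-inv (D-hom d h)) ⟨
      sum (λ y' → 𝟙 (D x y') *ℕ N a a x y')
        ≡⟨ exchange a a x (D x) ⟩
      sum (λ v → 𝟙 (a x v) *ℕ countFin (λ y' → a v y' ∧ D x y'))
        ≡⟨ sum-on (a x) _ (cnt a z w) (λ v p → middle p) ⟩
      countFin (a x) *ℕ cnt a z w ∎
      where
      open ≡-Reasoning
      middle : ∀ {v} → a x v ≡ true → countFin (λ y' → a v y' ∧ D x y') ≡ cnt a z w
      middle {v} p = trans
        (count-cong λ y' → bool-ext
          (λ q → let r , s = ∧-true⁻ {a v y'} q in ∧-true r (R-sym (D⇒R s)))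
          (λ q → let r , s = ∧-true⁻ {a v y'} q in ∧-true r (mk-D (R-sym s)
             λ { refl → clash r (f⇒¬a (a⇒f p)) })))
        (ℕₚ.*-cancelˡ-≡ (cnt a v x) (cnt a z w) 2
          (trans (cnt-a-half (a⇒¬Rᵒ p)) (trans (deg-R v z) (sym (cnt-a-half (a⇒¬R k))))))

-- Separates the exceptional term at x from the equal remaining ones, as for a sum over a part seen
-- from one of its vertices.
sum-point : ∀ {n} (τ : Fin n → Bool) (g : Fin n → ℕ) x c q → τ x ≡ true → countFin τ ≡ 1 + q →
            (∀ z → τ z ≡ true → x ≢ z → g z ≡ c) → sum (λ z → 𝟙 (τ z) *ℕ g z) ≡ g x + q *ℕ c
sum-point τ g x c q τx size h = begin
  sum (λ z → 𝟙 (τ z) *ℕ g z)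
    ≡⟨ sum-cong-≗ (λ z → split z (bool (x == z))) ⟩
  sum (λ z → 𝟙 (x == z) *ℕ g z + 𝟙 (rest z) *ℕ g z)
    ≡⟨ ∑-distrib-+ (λ z → 𝟙 (x == z) *ℕ g z) _ ⟩
  sum (λ z → 𝟙 (x == z) *ℕ g z) + sum (λ z → 𝟙 (rest z) *ℕ g z)
    ≡⟨ cong₂ _+_ (sum-on (x ==_) g (g x) (λ z e → cong g (sym (==⇒≡ e))))
                 (sum-on rest g c (λ z e → h z (proj₁ (∧-true⁻ e)) (==⇒≢ (not-true⁻ (proj₂ (∧-true⁻ {τ z} e)))))) ⟩
  countFin (x ==_) *ℕ g x + countFin rest *ℕ c
    ≡⟨ cong₂ (λ a b → a *ℕ g x + b *ℕ c) (count-singleton x) rest-size ⟩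
  1 *ℕ g x + q *ℕ c
    ≡⟨ cong (_+ q *ℕ c) (ℕₚ.*-identityˡ (g x)) ⟩
  g x + q *ℕ c ∎
  where
  open ≡-Reasoning
  rest : Fin _ → Bool
  rest z = τ z ∧ not (x == z)
  split : ∀ z → (x == z) ≡ true ⊎ (x == z) ≡ false → 𝟙 (τ z) *ℕ g z ≡ 𝟙 (x == z) *ℕ g z + 𝟙 (rest z) *ℕ g z
  split z (inj₁ e) rewrite e | ∧-zeroʳ (τ z) | subst (λ w → τ w ≡ true) (==⇒≡ e) τx = sym (ℕₚ.+-identityʳ _)
  split z (inj₂ e) rewrite e | ∧-identityʳ (τ z) = refl
  rest-size : countFin rest ≡ q
  rest-size = ℕₚ.+-cancelˡ-≡ 1 _ _ (trans (cong (_+ countFin rest) (sym (count-singleton x)))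
    (trans (sym (count-⊎ {f = x ==_} {rest}
       (λ z e → subst (λ w → τ w ≡ true) (==⇒≡ e) τx) (λ z e → proj₁ (∧-true⁻ e))
       (λ z e → [ inj₁ , (λ k → inj₂ (∧-true e (not-true k))) ]′ (bool (x == z)))
       (λ z e → ≢true⇒≡false λ k → clash e (not-true⁻ (proj₂ (∧-true⁻ {τ z} k)))))) size))

-- Arcs of types (1,2) and (1,3) occurring together

module TwoClasses {Δ : Digraph} (T : Twinless Δ)
                  (some-B : ∃[ x ] ∃[ y ] Relations.B T x y ≡ true)
                  (some-C : ∃[ x ] ∃[ y ] Relations.C T x y ≡ true) where
  open Relations T
  open SingleClass T using (deg-R-D)

  cnt-⊆ : ∀ {ρ σ : Rel (n Δ)} {x x' y} → (∀ {z} → R z y ≡ true → ρ x z ≡ true → σ x' z ≡ true) →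
          cnt ρ x y ≤ cnt σ x' y
  cnt-⊆ {ρ} {σ} {x} {x'} {y} h = count-⊆ {f = λ z → ρ x z ∧ R z y} {λ z → σ x' z ∧ R z y} λ z k →
    let p , q = ∧-true⁻ {ρ x z} k in ∧-true (h q p) q

  cnt-⊆-≥ : ∀ {ρ σ : Rel (n Δ)} {x x' y} → (∀ {z} → R z y ≡ true → ρ x z ≡ true → σ x' z ≡ true) →
            cnt σ x' y ≤ cnt ρ x y → σ x' y ≡ true → ρ x y ≡ true
  cnt-⊆-≥ {ρ} {σ} {x} {x'} {y} h le k = proj₁ (∧-true⁻ {ρ x y} (count-⊆-≥
    {f = λ z → ρ x z ∧ R z y} {λ z → σ x' z ∧ R z y}
    (λ z k → let p , q = ∧-true⁻ {ρ x z} k in ∧-true (h q p) q) le y (∧-true k (R-refl y))))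

  inflow : X → X → ℕ
  inflow x y = countFin (λ w → a w x ∧ not (R w y))

  inflow-split : ∀ x y → countFin (λ w → a w x) ≡ cnt (a ᵒ) x y + inflow x y
  inflow-split x y = count-split (λ w → a w x) (λ w → R w y)

  cancel-≤ : ∀ {m n p q} → m + q ≡ n + p → p ≤ q → m ≤ n
  cancel-≤ {m} {n} {p} {q} e h = ℕₚ.+-cancelʳ-≤ q m n (ℕₚ.≤-trans (ℕₚ.≤-reflexive e) (ℕₚ.+-monoʳ-≤ n h))

  -- Both sides are in-degrees, of y on the left and of x on the right, each split by whether the
  -- in-neighbour lies in the part of the other vertex.
  flow : ∀ {x y} → cnt a x y + inflow y x ≡ cnt (a ᵒ) x y + inflow x y
  flow {x} {y} = trans (cong (_+ inflow y x) (cnt-flip {a} a-inv x y))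
    (trans (sym (inflow-split y x)) (trans (deg-aᵒ y x) (inflow-split x y)))

  push' : ∀ {x y} → B x y ≡ true → ∀ w → a w x ∧ not (R w y) ≡ true → f w y ∧ not (R w x) ≡ true
  push' {x} {y} h w k = let p , q = ∧-true⁻ {a w x} k in
    ∧-true (push h p (not-true⁻ q)) (not-true (a⇒¬R p))

  f-inflow≤ : ∀ x y w → f w y ∧ not (R w x) ≡ true → a w y ∧ not (R w x) ≡ true
  f-inflow≤ x y w k = let p , q = ∧-true⁻ {f w y} k in ∧-true (f⇒a p) q

  -- By `push'` the inflow of x from outside the part of y is at most the inflow of y from outside
  -- the part of x. Equal in-degrees reverse the comparison for the remaining terms.
  B-out≤in : ∀ {x y} → B x y ≡ true → cnt a x y ≤ cnt (a ᵒ) x y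
  B-out≤in {x} {y} h = cancel-≤ (flow {x} {y})
    (count-⊆ {f = λ w → a w x ∧ not (R w y)} {λ w → a w y ∧ not (R w x)} λ w k → f-inflow≤ x y w (push' h w k))

  module _ {x y y'} (h : B x y ≡ true) (h' : B x y' ≡ true) (apart : R y y' ≡ false) where

    pull' : ∀ {z} → R z y' ≡ true → a y z ≡ true → f x z ≡ true
    pull' q p = pull h p (≢true⇒≡false λ k → clash (R-trans k q) (a⇒¬R (B⇒a h')))

    -- Two B-successors in different parts force a cyclic chain of inequalities between these numbers.
    squeeze : cnt f y y' ≡ cnt a y y' × cnt a y y' ≡ cnt f x y'
    squeeze = ℕₚ.≤-antisym i₁ (ℕₚ.≤-trans i₂ i₃) , ℕₚ.≤-antisym i₂ (ℕₚ.≤-trans i₃ i₁)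
      where
      i₁ : cnt f y y' ≤ cnt a y y'
      i₁ = cnt-⊆ {f} {a} (λ _ → f⇒a)
      i₂ : cnt a y y' ≤ cnt f x y'
      i₂ = cnt-⊆ {a} {f} pull'
      i₃ : cnt f x y' ≤ cnt f y y'
      i₃ = begin
        cnt f x y'       ≤⟨ cnt-⊆ {f} {a} (λ _ → f⇒a) ⟩
        cnt a x y'       ≤⟨ B-out≤in h' ⟩
        -- The two B-arcs at x have the same type, so y' may be replaced by y. In-neighbours of x in
        -- the part of y are then pushed along x → y'.
        cnt (a ᵒ) x y'   ≡⟨ cnt-inv {a ᵒ} (flip-inv {a} a-inv) (B-hom h' h) ⟩
        cnt (a ᵒ) x y    ≤⟨ cnt-⊆ {a ᵒ} {f ᵒ} (λ q p → push h' p (≢true⇒≡false λ k →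
                              clash (R-trans (R-sym q) k) apart)) ⟩
        cnt (f ᵒ) y' y   ≡⟨ cnt-flip {f} f-inv y y' ⟨
        cnt f y y'       ∎
        where open ℕₚ.≤-Reasoning

    -- Equal sizes turn the inclusions behind the chain into equalities of sets. The vertex y'
    -- itself is an f-successor of x in its part, hence one of y.
    squeezed-arc : f y y' ≡ true
    squeezed-arc = cnt-⊆-≥ {f} {a} (λ _ → f⇒a) (ℕₚ.≤-reflexive (sym (proj₁ squeeze)))
      (cnt-⊆-≥ {a} {f} pull' (ℕₚ.≤-reflexive (sym (proj₂ squeeze))) (B⇒f h'))

  -- `squeezed-arc` applies to the two successors in either order, so different parts would give
  -- one-way arcs in both directions.
  B-part : ∀ {x y y'} → B x y ≡ true → B x y' ≡ true → R y y' ≡ true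
  B-part {x} {y} {y'} h h' with bool (R y y')
  ... | inj₁ k = k
  ... | inj₂ k = clash (f⇒a (squeezed-arc h' h (¬R-sym k))) (f⇒¬a (squeezed-arc h h' k))

  -- All B-successors of a part lie in a single part; E x y says that this is the part of y.
  abstract
    E : Rel (n Δ)
    E = B ⨾ R

    mk-E : ∀ {x y} z → B x z ≡ true → R z y ≡ true → E x y ≡ true
    mk-E z = ⨾-true B R z

    E⁻ : ∀ {x y} → E x y ≡ true → ∃[ z ] B x z ≡ true × R z y ≡ true
    E⁻ = ⨾-true⁻ B R

    E-inv : Inv E
    E-inv = ⨾-inv {B} {R} B-inv R-inv

  B⇒E : ∀ {x y} → B x y ≡ true → E x y ≡ true
  B⇒E {x} {y} h = mk-E y h (R-refl y)

  E-col : ∀ {x y y'} → R y y' ≡ true → E x y ≡ true → E x y' ≡ true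
  E-col r h with E⁻ h
  ... | z , p , q = mk-E z p (R-trans q r)

  E-row : ∀ {x x' y} → R x x' ≡ true → E x y ≡ true → E x' y ≡ true
  E-row {x} {x'} {y} r h with E⁻ h
  ... | z , p , q with cnt-pos⁻ {B} {x'} {z} (subst (1 ≤_) (cnt-row {B} B-inv r) (cnt-pos {B} p))
  ...   | w , s , t = mk-E w s (R-trans t q)

  E-fun : ∀ {x y z} → E x y ≡ true → E x z ≡ true → R y z ≡ true
  E-fun h k with E⁻ h | E⁻ k
  ... | u , p , q | v , p' , q' = R-trans (R-sym q) (R-trans (B-part p p') q')

  degB : ∀ x y → countFin (B x) ≡ countFin (B y)
  degB = deg-const {B} B-inv

  degBᵒ : ∀ x y → countFin (λ z → B z x) ≡ countFin (B y)
  degBᵒ = deg-flip {B} B-inv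

  x₀ y₀ : X
  x₀ = proj₁ some-B
  y₀ = proj₁ (proj₂ some-B)

  B₀ : B x₀ y₀ ≡ true
  B₀ = proj₂ (proj₂ some-B)

  b : ℕ
  b = countFin (B x₀)

  1≤b : 1 ≤ b
  1≤b = count-pos (B x₀) y₀ B₀

  abstract
    successor : ∀ x → ∃[ y ] B x y ≡ true
    successor x = count-pos⁻ (B x) (subst (1 ≤_) (degB x₀ x) 1≤b)

    predecessor : ∀ y → ∃[ x ] B x y ≡ true
    predecessor y = count-pos⁻ (λ z → B z y) (subst (1 ≤_) (sym (degBᵒ y x₀)) 1≤b)

  cnt-B : ∀ {x y} → E x y ≡ true → cnt B x y ≡ b
  cnt-B {x} {y} h = trans (count-cong {f = λ z → B x z ∧ R z y} {B x} λ z → bool-ext (λ k → proj₁ (∧-true⁻ k))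
    (λ k → ∧-true k (E-fun (B⇒E k) h))) (degB x x₀)

  -- All b successors of x lie in the part of y, so by `cnt-flip` b predecessors of y lie in the
  -- part of x, and y has no more than b.
  Bᵒ-part : ∀ {x x' y} → B x y ≡ true → B x' y ≡ true → R x x' ≡ true
  Bᵒ-part {x} {x'} {y} h h' = R-sym (proj₂ (∧-true⁻ {B x' y} (count-⊆-≥ {f = λ z → B z y ∧ R z x} {λ z → B z y}
    (λ z k → proj₁ (∧-true⁻ k))
    (ℕₚ.≤-reflexive (trans (degBᵒ y x₀) (trans (sym (cnt-B (B⇒E h))) (cnt-flip {B} B-inv x y)))) x' h')))

  d₁ d₂ : X
  d₁ = proj₁ mates
  d₂ = proj₁ (proj₂ mates)

  D₀ : D d₁ d₂ ≡ true
  D₀ = mk-D (part⇒R (proj₁ (proj₂ (proj₂ mates)))) (proj₂ (proj₂ (proj₂ mates)))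

  -- `r'` is the part size less one; `ƛ` is the number of common B-successors of two mates.
  r' ƛ : ℕ
  r' = countFin (D x₀)
  ƛ  = N B (B ᵒ) d₁ d₂

  size-R : ∀ x → countFin (R x) ≡ 1 + r'
  size-R x = trans (deg-R-D x) (cong suc (deg-const {D} D-inv x x₀))

  1≤r' : 1 ≤ r'
  1≤r' = subst (1 ≤_) (deg-const {D} D-inv d₁ x₀) (count-pos (D d₁) d₂ D₀)

  N-B-Bᵒ : ∀ {x y} → D x y ≡ true → N B (B ᵒ) x y ≡ ƛ
  N-B-Bᵒ h = N-inv {B} {B ᵒ} B-inv (flip-inv {B} B-inv) (D-hom h D₀)

  N-B-Bᵒ-diag : ∀ x → N B (B ᵒ) x x ≡ b
  N-B-Bᵒ-diag x = trans (count-cong {f = λ z → B x z ∧ B x z} {B x} λ z →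
    bool-ext (λ k → proj₁ (∧-true⁻ k)) (λ k → ∧-true k k)) (degB x x₀)

  -- Counts the pairs (y , z) with B-arcs x₀ → y and z → y. By `Bᵒ-part` every z lies in the part of
  -- x₀; z = x₀ contributes b, each mate contributes `ƛ`.
  b²-via-mates : b *ℕ b ≡ b + r' *ℕ ƛ
  b²-via-mates = begin
    b *ℕ b
      ≡⟨ sum-on (B x₀) (λ y → countFin (λ z → B z y ∧ R x₀ z)) b (λ y h → trans
           (count-cong {f = λ z → B z y ∧ R x₀ z} {λ z → B z y} λ z →
              bool-ext (λ k → proj₁ (∧-true⁻ k)) (λ k → ∧-true k (Bᵒ-part h k)))
           (degBᵒ y x₀)) ⟨
    sum (λ y → 𝟙 (B x₀ y) *ℕ countFin (λ z → B z y ∧ R x₀ z))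
      ≡⟨ exchange B (B ᵒ) x₀ (R x₀) ⟨
    sum (λ z → 𝟙 (R x₀ z) *ℕ N B (B ᵒ) x₀ z)
      ≡⟨ sum-point (R x₀) (N B (B ᵒ) x₀) x₀ ƛ r' (R-refl x₀) (size-R x₀) (λ z h k → N-B-Bᵒ (mk-D h k)) ⟩
    N B (B ᵒ) x₀ x₀ + r' *ℕ ƛ
      ≡⟨ cong (_+ r' *ℕ ƛ) (N-B-Bᵒ-diag x₀) ⟩
    b + r' *ℕ ƛ ∎
    where open ≡-Reasoning

  -- The parts are paired off by E, and each pair turns out to be a 4-cycle of B-arcs.
  module CaseS (S-hyp : ∀ {x y} → B x y ≡ true → E y x ≡ true) where

    E-sym : ∀ {x y} → E x y ≡ true → E y x ≡ true
    E-sym h with E⁻ h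
    ... | z , p , q = E-row q (S-hyp p)

    μ : ℕ
    μ = N B B d₁ d₂

    -- Here the B-paths are x₀ → y → z. By `S-hyp` the second step returns to the part of x₀, but
    -- never to x₀ itself, since B-arcs are one-way.
    b²-via-squares : b *ℕ b ≡ r' *ℕ μ
    b²-via-squares = begin
      b *ℕ b
        ≡⟨ sum-on (B x₀) (λ y → countFin (λ z → B y z ∧ R x₀ z)) b (λ y h → trans
             (count-cong {f = λ z → B y z ∧ R x₀ z} {B y} λ z →
                bool-ext (λ k → proj₁ (∧-true⁻ k)) (λ k → ∧-true k (E-fun (S-hyp h) (B⇒E k))))
             (degB y x₀)) ⟨
      sum (λ y → 𝟙 (B x₀ y) *ℕ countFin (λ z → B y z ∧ R x₀ z))
        ≡⟨ exchange B B x₀ (R x₀) ⟨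
      sum (λ z → 𝟙 (R x₀ z) *ℕ N B B x₀ z)
        ≡⟨ sum-point (R x₀) (N B B x₀) x₀ μ r' (R-refl x₀) (size-R x₀)
             (λ z h k → N-inv {B} {B} B-inv B-inv (D-hom (mk-D h k) D₀)) ⟩
      N B B x₀ x₀ + r' *ℕ μ
        ≡⟨ cong (_+ r' *ℕ μ) (count-none λ z → ≢true⇒≡false λ k →
             let p , q = ∧-true⁻ {B x₀ z} k in clash (B⇒a q) (f⇒¬a (B⇒f p))) ⟩
      r' *ℕ μ ∎
      where open ≡-Reasoning

    around : X → X → X → Bool
    around x y z = (B x z ∧ R z y) ∨ (B z x ∧ R z y)

    -- B-successors and B-predecessors of x in the part of y are disjoint, and by `E-sym` both sets
    -- have size b.
    around-size : ∀ {x y} → E x y ≡ true → countFin (around x y) ≡ b + b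
    around-size {x} {y} h = trans (count-⊎ {f = λ z → B x z ∧ R z y} {λ z → B z x ∧ R z y}
        (λ z k → ∨-trueˡ k) (λ z k → ∨-trueʳ {B x z ∧ R z y} k) (λ z k → ∨-true⁻ k)
        (λ z k → ≢true⇒≡false λ l → clash (B⇒a (proj₁ (∧-true⁻ {B z x} l)))
                                           (f⇒¬a (B⇒f (proj₁ (∧-true⁻ {B x z} k))))))
      (cong₂ _+_ (cnt-B h) (trans (sym (cnt-flip {B} B-inv y x)) (cnt-B (E-sym h))))

    around⊆ : ∀ x y z → around x y z ≡ true → R y z ≡ true
    around⊆ x y z k with ∨-true⁻ {B x z ∧ R z y} k
    ... | inj₁ l = R-sym (proj₂ (∧-true⁻ {B x z} l))
    ... | inj₂ l = R-sym (proj₂ (∧-true⁻ {B z x} l))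

    2b≤1+r' : b + b ≤ 1 + r'
    2b≤1+r' = ℕₚ.≤-trans (ℕₚ.≤-reflexive (sym (around-size (B⇒E B₀))))
      (ℕₚ.≤-trans (count-⊆ (around⊆ x₀ y₀)) (ℕₚ.≤-reflexive (size-R y₀)))

    -- The two equations give b = r (m - λ'), a positive multiple of r, so r ≤ b. Then b + b ≤ 1 + r
    -- leaves only b = 1 and r = 1.
    solve-S : ∀ b r λ' m → 1 ≤ b → 1 ≤ r → b *ℕ b ≡ b + r *ℕ λ' → b *ℕ b ≡ r *ℕ m → b + b ≤ 1 + r → b ≡ 1 × r ≡ 1
    solve-S b r λ' m 1≤b 1≤r h₁ h₂ h₃ = b≡1 , ℕₚ.≤-antisym (ℕₚ.≤-trans r≤b (ℕₚ.≤-reflexive b≡1)) 1≤r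
      where
      h₄ : b + r *ℕ λ' ≡ r *ℕ m
      h₄ = trans (sym h₁) h₂
      λ<m : λ' < m
      λ<m = ℕₚ.*-cancelˡ-< r λ' m (ℕₚ.≤-trans (ℕₚ.+-monoˡ-≤ (r *ℕ λ') 1≤b) (ℕₚ.≤-reflexive h₄))
      r≤b : r ≤ b
      r≤b = ℕₚ.+-cancelʳ-≤ (r *ℕ λ') r b (ℕₚ.≤-trans (ℕₚ.≤-reflexive (sym (ℕₚ.*-suc r λ')))
        (ℕₚ.≤-trans (ℕₚ.*-monoʳ-≤ r λ<m) (ℕₚ.≤-reflexive (sym h₄))))
      b≡1 : b ≡ 1
      b≡1 = ℕₚ.≤-antisym (ℕₚ.+-cancelʳ-≤ b b 1 (ℕₚ.≤-trans h₃ (s≤s r≤b))) 1≤b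

    solution : b ≡ 1 × r' ≡ 1
    solution = solve-S b r' ƛ μ 1≤b 1≤r' b²-via-mates b²-via-squares 2b≤1+r'

    abstract
      -- Parts now have size 2 = b + b, so `around` fills the whole part of y.
      E-split : ∀ {x y} → E x y ≡ true → B x y ≡ true ⊎ B y x ≡ true
      E-split {x} {y} h = [ (λ k → inj₁ (proj₁ (∧-true⁻ k))) , (λ k → inj₂ (proj₁ (∧-true⁻ {B y x} k))) ]′
        (∨-true⁻ {B x y ∧ R y y} (count-⊆-≥ {f = around x y} (around⊆ x y)
          (ℕₚ.≤-reflexive (trans (size-R y) (trans (cong suc (proj₂ solution))
            (trans (sym (cong (λ c → c + c) (proj₁ solution))) (sym (around-size h)))))) y (R-refl y)))

    -- A B-arc from y leads back into the part of x, and `B-out≤in` for that arc is the reverse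
    -- inequality.
    B-out≡in : ∀ {x y} → B x y ≡ true → cnt a x y ≡ cnt (a ᵒ) x y
    B-out≡in {x} {y} h with E⁻ (S-hyp h)
    ... | z , p , q = ℕₚ.≤-antisym (B-out≤in h) (begin
      cnt (a ᵒ) x y ≡⟨ cnt-flip {a} a-inv y x ⟨
      cnt a y x     ≡⟨ cnt-col a (R-sym q) ⟩
      cnt a y z     ≤⟨ B-out≤in p ⟩
      cnt (a ᵒ) y z ≡⟨ cnt-col (a ᵒ) q ⟩
      cnt (a ᵒ) y x ≡⟨ cnt-flip {a} a-inv x y ⟨
      cnt a x y     ∎)
      where open ℕₚ.≤-Reasoning

    inflow-≡ : ∀ {x y} → B x y ≡ true → inflow y x ≡ inflow x y
    inflow-≡ {x} {y} h = ℕₚ.+-cancelˡ-≡ (cnt a x y) _ _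
      (trans (flow {x} {y}) (cong (_+ inflow x y) (sym (B-out≡in h))))

    -- With equal inflows the inclusion of `push'` is an equality, so outside both parts x and y
    -- have the same in-neighbours.
    twin-back : ∀ {x y w} → B x y ≡ true → R w x ≡ false → a w y ≡ true → a w x ≡ true
    twin-back {x} {y} {w} h k p = proj₁ (∧-true⁻ {a w x} (count-⊆-≥
      {f = λ w → a w x ∧ not (R w y)} {λ w → a w y ∧ not (R w x)}
      (λ w l → f-inflow≤ x y w (push' h w l)) (ℕₚ.≤-reflexive (inflow-≡ h)) w (∧-true p (not-true k))))

    twin-strict : ∀ {x y w} → B x y ≡ true → R w x ≡ false → a w y ≡ true → f w y ≡ true
    twin-strict {x} {y} {w} h k p = push h (twin-back h k p) (a⇒¬R p)

    abstract
      -- A block is a part together with its partner under E; the blocks become the vertices of the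
      -- first factor Σ.
      U : Rel (n Δ)
      U x y = R x y ∨ E x y

      R⇒U : ∀ {x y} → R x y ≡ true → U x y ≡ true
      R⇒U h = ∨-trueˡ h

      E⇒U : ∀ {x y} → E x y ≡ true → U x y ≡ true
      E⇒U {x} {y} h = ∨-trueʳ {R x y} h

      U⁻ : ∀ {x y} → U x y ≡ true → R x y ≡ true ⊎ E x y ≡ true
      U⁻ h = ∨-true⁻ h

      U-inv : Inv U
      U-inv = ∨-inv {R} {E} R-inv E-inv

    ¬U⇒¬R : ∀ {x y} → U x y ≡ false → R x y ≡ false
    ¬U⇒¬R h = ≢true⇒≡false λ k → clash (R⇒U k) h

    U-sym : ∀ {x y} → U x y ≡ true → U y x ≡ true
    U-sym h = [ (λ k → R⇒U (R-sym k)) , (λ k → E⇒U (E-sym k)) ]′ (U⁻ h)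

    U-trans : ∀ {x y z} → U x y ≡ true → U y z ≡ true → U x z ≡ true
    U-trans h k with U⁻ h | U⁻ k
    ... | inj₁ p | inj₁ q = R⇒U (R-trans p q)
    ... | inj₁ p | inj₂ q = E⇒U (E-row (R-sym p) q)
    ... | inj₂ p | inj₁ q = E⇒U (E-col q p)
    ... | inj₂ p | inj₂ q = R⇒U (E-fun (E-sym p) q)

    U-equivalence : Equivalence U
    U-equivalence = record { reflexive = λ x → R⇒U (R-refl x) ; symmetric = U-sym ; transitive = U-trans }

    -- Take a B-predecessor x of y. An arc w → y from outside the block forces w → x, and pushing
    -- that along x → y shows that w → y is one-way.
    strict-outside : ∀ {w y} → U w y ≡ false → a w y ≡ true → f w y ≡ true
    strict-outside {w} {y} h p with predecessor y
    ... | x , q = twin-strict q (≢true⇒≡false λ k → clash (E⇒U (E-row (R-sym k) (B⇒E q))) h) p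

    B-twin : ∀ {x y w} → B x y ≡ true → U w x ≡ false → a w x ≡ a w y
    B-twin {x} {y} {w} h k = bool-ext
      (λ p → f⇒a (push h p (≢true⇒≡false λ l → clash (U-trans (R⇒U l) (U-sym (E⇒U (B⇒E h)))) k)))
      (λ p → twin-back h (¬U⇒¬R k) p)

    E-twin : ∀ {x y w} → E x y ≡ true → U w x ≡ false → a w x ≡ a w y
    E-twin {x} {y} {w} h k with E-split h
    ... | inj₁ p = B-twin p k
    ... | inj₂ p = sym (B-twin p (≢true⇒≡false λ l → clash (U-trans l (E⇒U (B⇒E p))) k))

    in-twin : ∀ {x y w} → U x y ≡ true → U w x ≡ false → a w x ≡ a w y
    in-twin {x} {y} {w} h k with U⁻ h
    ... | inj₂ p = E-twin p k
    ... | inj₁ p with successor x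
    -- Mates x and y are compared through a successor z of x, whose part is paired with theirs.
    ...   | z , q = trans (E-twin (B⇒E q) k) (E-twin (E-col p (S-hyp q))
                      (≢true⇒≡false λ l → clash (U-trans l (E⇒U (S-hyp q))) k))

    reverse : ∀ {x w} → U w x ≡ false → a x w ≡ not (a w x)
    reverse {x} {w} h with bool (a w x)
    ... | inj₁ p = trans (f⇒¬a (strict-outside h p)) (sym (cong not p))
    ... | inj₂ p with total (¬U⇒¬R h)
    ...   | inj₁ q = clash q p
    ...   | inj₂ q = trans q (sym (cong not p))

    -- `in-twin` moves the head of an arc inside its block. Between blocks exactly one direction
    -- occurs, so reversing the pair lets the same fact move the tail.
    U-lift : ∀ {x x' y y'} → U x x' ≡ true → U y y' ≡ true → U x y ≡ false → a x y ≡ a x' y'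
    U-lift {x} {x'} {y} {y'} h k l = begin
      a x y         ≡⟨ in-twin k l ⟩
      a x y'        ≡⟨ reverse y'x ⟩
      not (a y' x)  ≡⟨ cong not (in-twin h y'x) ⟩
      not (a y' x') ≡⟨ reverse (≢true⇒≡false λ m → clash (U-trans m (U-sym h)) y'x) ⟨
      a x' y'       ∎
      where
      open ≡-Reasoning
      y'x : U y' x ≡ false
      y'x = ≢true⇒≡false λ m → clash (U-sym (U-trans k m)) l

    a-inside : ∀ {x y} → U x y ≡ true → a x y ≡ true → B x y ≡ true
    a-inside h p with U⁻ h
    ... | inj₁ k = clash p (R⇒¬a k)
    ... | inj₂ k with E-split k
    ...   | inj₁ q = q
    ...   | inj₂ q = clash p (f⇒¬a (B⇒f q))

    -- Arcs inside a block are B-arcs, so any C-arc joins different blocks. It will witness that the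
    -- quotient is not symmetric.
    outside-arc : ∃[ x ] ∃[ y ] U x y ≡ false × f x y ≡ true
    outside-arc = proj₁ some-C , proj₁ (proj₂ some-C) ,
      ≢true⇒≡false (λ k → clash (C⇒two h) (B⇒¬two (a-inside k (C⇒a h)))) , C⇒f h
      where
      h = proj₂ (proj₂ some-C)

    s : X → X
    s x = proj₁ (successor x)

    B-s : ∀ x → B x (s x) ≡ true
    B-s x = proj₂ (successor x)

    s-unique : ∀ {x y} → B x y ≡ true → y ≡ s x
    s-unique {x} {y} h = count-unique (B x) (ℕₚ.≤-reflexive (trans (degB x x₀) (proj₁ solution))) h (B-s x)

    s-injective : ∀ {x y} → s x ≡ s y → x ≡ y
    s-injective {x} {y} h = count-unique (λ z → B z (s y))
      (ℕₚ.≤-reflexive (trans (degBᵒ (s y) x₀) (proj₁ solution)))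
      (subst (λ z → B x z ≡ true) h (B-s x)) (B-s y)

    s² : ∀ x → D x (s (s x)) ≡ true
    s² x = mk-D (E-fun (S-hyp (B-s x)) (B⇒E (B-s (s x))))
      (λ q → clash (subst (λ z → a (s x) z ≡ true) (sym q) (B⇒a (B-s (s x)))) (f⇒¬a (B⇒f (B-s x))))

    D-unique : ∀ {x y z} → D x y ≡ true → D x z ≡ true → y ≡ z
    D-unique {x} = count-unique (D x) (ℕₚ.≤-reflexive (trans (deg-const {D} D-inv x x₀) (proj₂ solution)))

    s⁴ : ∀ x → s (s (s (s x))) ≡ x
    s⁴ x = D-unique (s² (s (s x))) (D-sym (s² x))

-- E permutes the parts without 2-cycles, and all numbers turn out to be 1.
module CaseN {Δ : Digraph} (T : Twinless Δ)
             (some-B : ∃[ x ] ∃[ y ] Relations.B T x y ≡ true)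
             (some-C : ∃[ x ] ∃[ y ] Relations.C T x y ≡ true)
             (N-hyp : ∀ {x y} → Relations.B T x y ≡ true → TwoClasses.E T some-B some-C y x ≡ false) where
  open Relations T
  open TwoClasses T some-B some-C

  e-E : ∀ {x y} → e x y ≡ true → E x y ≡ E y x
  e-E h = E-inv (e-hom h (e-sym h))

  abstract
    -- `return` gives an arc from y₀ back into the part of x₀. As a digon or a B-arc it would yield
    -- E y₀ x₀, against `N-hyp`. So it is a C-arc running against E, and all C-arcs have one type.
    C-E : ∀ {y z} → C y z ≡ true → E z y ≡ true
    C-E {y} {z} h with return B₀
    ... | w , d , p with a-split p
    ...   | inj₁ q = clash (E-col (R-sym (D⇒R d)) (trans (e-E q) (E-row (D⇒R d) (B⇒E B₀)))) (N-hyp B₀)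
    ...   | inj₂ q with f-split q
    ...     | inj₁ r = clash (E-col (R-sym (D⇒R d)) (B⇒E r)) (N-hyp B₀)
    ...     | inj₂ r = trans (E-inv (ty-flip (C-hom h r))) (E-row (D⇒R d) (B⇒E B₀))

    -- Between the part of x and its image under E, every other kind of arc would make E hold in the
    -- reverse direction too: digons by their symmetric type, forward C-arcs by `C-E`, backward
    -- B-arcs directly.
    B-or-C : ∀ {x y w} → B x y ≡ true → R y w ≡ true → B x w ≡ true ⊎ C w x ≡ true
    B-or-C {x} {y} {w} h k with position x w
    ... | here refl = clash (R-sym k) (a⇒¬R (B⇒a h))
    ... | mate d    = clash (R-trans (D⇒R d) (R-sym k)) (a⇒¬R (B⇒a h))
    ... | both p    = clash (E-row (R-sym k) (trans (sym (e-E p)) (E-col k (B⇒E h)))) (N-hyp h)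
    ... | into p    with f-split p
    ...   | inj₁ q = inj₁ q
    ...   | inj₂ q = clash (E-row (R-sym k) (C-E q)) (N-hyp h)
    B-or-C {x} {y} {w} h k | outof p with f-split p
    ...   | inj₁ q = clash (E-row (R-sym k) (B⇒E q)) (N-hyp h)
    ...   | inj₂ q = inj₂ q

    -- For a digon on x and w and a B-arc x → y, pushing gives a one-way arc w → y, which must be a
    -- C-arc. So y has a B-successor v in the part of w, and pulling gives a C-arc x → v. Thus E
    -- leads from w to x, and, the digon having a symmetric type, from x to w, which puts w into the
    -- part of y.
    no-edges : ∀ x w → e x w ≡ false
    no-edges x w = ≢true⇒≡false λ h → edge h
      where
      edge : e x w ≡ true → ⊥
      edge h with successor x
      ... | y , p with bool (R y w)
      ...   | inj₁ k = clash (E-row (R-sym k) (trans (sym (e-E h)) (E-col k (B⇒E p)))) (N-hyp p)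
      ...   | inj₂ k with f-split (push p (e⇒aᵒ h) (¬R-sym k))
      ...     | inj₁ q = clash (Bᵒ-part p q) (a⇒¬R (e⇒a h))
      ...     | inj₂ q with E⁻ (C-E q)
      ...       | v , r , t with f-split (pull p (B⇒a r) (≢true⇒≡false λ l → clash (R-trans l t) (a⇒¬R (e⇒a h))))
      ...         | inj₁ u = clash (B-part p u) (a⇒¬R (B⇒a r))
      ...         | inj₂ u = clash (B-part′ (trans (e-E h) (E-row t (C-E u)))) k
        where
        B-part′ : E x w ≡ true → R y w ≡ true
        B-part′ l = E-fun (B⇒E p) l

    -- Pushing makes w → y one-way, and it is no B-arc, since B-successors of w share a part. With
    -- `C-E` this means that E returns every part to itself after three steps.
    B² : ∀ {w x y} → B w x ≡ true → B x y ≡ true → C w y ≡ true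
    B² {w} {x} {y} p q with f-split (push q (B⇒a p) (≢true⇒≡false λ k → clash (E-col (R-sym k) (B⇒E q)) (N-hyp p)))
    ... | inj₁ r = clash (B-part p r) (a⇒¬R (B⇒a q))
    ... | inj₂ r = r

  u₀ v₀ : X
  u₀ = proj₁ some-C
  v₀ = proj₁ (proj₂ some-C)

  C₀ : C u₀ v₀ ≡ true
  C₀ = proj₂ (proj₂ some-C)

  c μ : ℕ
  c = countFin (C x₀)
  μ = N B B u₀ v₀

  degC : ∀ x → countFin (C x) ≡ c
  degC x = deg-const {C} C-inv x x₀

  1≤c : 1 ≤ c
  1≤c = subst (1 ≤_) (degC u₀) (count-pos (C u₀) v₀ C₀)

  N-B-B : ∀ {x y} → C x y ≡ true → N B B x y ≡ μ
  N-B-B h = N-inv {B} {B} B-inv B-inv (C-hom h C₀)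

  -- By `B²` every B-path x₀ → y → z ends at a C-successor of x₀, and each such end is reached `μ`
  -- times.
  b²-via-squares : b *ℕ b ≡ c *ℕ μ
  b²-via-squares = begin
    b *ℕ b
      ≡⟨ sum-on (B x₀) (λ y → countFin (λ z → B y z ∧ C x₀ z)) b (λ y h → trans
           (count-cong {f = λ z → B y z ∧ C x₀ z} {B y} λ z →
              bool-ext (λ k → proj₁ (∧-true⁻ k)) (λ k → ∧-true k (B² h k)))
           (degB y x₀)) ⟨
    sum (λ y → 𝟙 (B x₀ y) *ℕ countFin (λ z → B y z ∧ C x₀ z))
      ≡⟨ exchange B B x₀ (C x₀) ⟨
    sum (λ z → 𝟙 (C x₀ z) *ℕ N B B x₀ z)
      ≡⟨ sum-on (C x₀) (N B B x₀) μ (λ z h → N-B-B h) ⟩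
    c *ℕ μ ∎
    where open ≡-Reasoning

  -- Both sides count the pairs (y' , w) with x₀ → y' → w and y₀ → w, all steps in B.
  common-paths : ∀ {q} → b ≡ 1 + q → b *ℕ μ ≡ b + q *ℕ ƛ
  common-paths {q} size = begin
    b *ℕ μ
      ≡⟨ cong (_*ℕ μ) (degB x₀ y₀) ⟩
    countFin (B y₀) *ℕ μ
      ≡⟨ sum-on (B y₀) (N B B x₀) μ (λ w h → N-B-B (B² B₀ h)) ⟨
    sum (λ w → 𝟙 (B y₀ w) *ℕ N B B x₀ w)
      ≡⟨ exchange B B x₀ (B y₀) ⟩
    sum (λ y' → 𝟙 (B x₀ y') *ℕ N B (B ᵒ) y' y₀)
      ≡⟨ sum-point (B x₀) (λ y' → N B (B ᵒ) y' y₀) y₀ ƛ q B₀ size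
           (λ z h k → N-B-Bᵒ (mk-D (B-part h B₀) (λ l → k (sym l)))) ⟩
    N B (B ᵒ) y₀ y₀ + q *ℕ ƛ
      ≡⟨ cong (_+ q *ℕ ƛ) (N-B-Bᵒ-diag y₀) ⟩
    b + q *ℕ ƛ ∎
    where open ≡-Reasoning

  -- By `B-or-C` the part of y₀ consists of the B-successors and the C-predecessors of x₀.
  part-split : 1 + r' ≡ b + c
  part-split = begin
    1 + r'                                   ≡⟨ size-R y₀ ⟨
    countFin (R y₀)                          ≡⟨ count-⊎ {f = B x₀} {λ w → C w x₀}
                                                  (λ w h → B-part B₀ h) (λ w h → E-fun (B⇒E B₀) (C-E h))
                                                  (λ w h → B-or-C B₀ h)
                                                  (λ w h → ≢true⇒≡false λ k → clash (B⇒a h) (f⇒¬a (C⇒f k))) ⟩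
    b + countFin (λ w → C w x₀)              ≡⟨ cong (b +_) (deg-flip {C} C-inv x₀ x₀) ⟩
    b + c                                    ∎
    where open ≡-Reasoning

  -- Write b = 1 + q. The first equation gives b q = r λ', and r ≥ b because c ≥ 1, so λ' ≤ q. The
  -- third becomes b m + λ' = b + b λ'. If m ≤ λ', its left side is too small; so m ≥ λ' + 1, and
  -- then λ' = 0. Hence q = 0, and c m = 1 settles the rest.
  solve-N : ∀ b c r λ' m → 1 ≤ b → 1 ≤ c → b *ℕ b ≡ b + r *ℕ λ' → b *ℕ b ≡ c *ℕ m →
            (∀ {q} → b ≡ 1 + q → b *ℕ m ≡ b + q *ℕ λ') → 1 + r ≡ b + c → b ≡ 1 × c ≡ 1 × r ≡ 1
  solve-N (suc q) (suc c) r λ' m (s≤s z≤n) (s≤s z≤n) h₁ h₂ h₃ h₄ =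
    cong suc q≡0 , c≡1 , trans r≡ (trans (cong (_+ suc c) q≡0) c≡1)
    where
    r≡ : r ≡ q + suc c
    r≡ = ℕₚ.suc-injective h₄
    v : ℕ
    v = suc q
    v≤r : v ≤ r
    v≤r = ℕₚ.≤-trans (ℕₚ.≤-reflexive (ℕₚ.+-comm 1 q)) (ℕₚ.≤-trans (ℕₚ.+-monoʳ-≤ q (s≤s z≤n)) (ℕₚ.≤-reflexive (sym r≡)))
    vq≡ : v *ℕ q ≡ r *ℕ λ'
    vq≡ = ℕₚ.+-cancelˡ-≡ v _ _ (trans (sym (ℕₚ.*-suc v q)) h₁)
    λ≤q : λ' ≤ q
    λ≤q = ℕₚ.*-cancelˡ-≤ v (ℕₚ.≤-trans (ℕₚ.*-monoˡ-≤ λ' v≤r) (ℕₚ.≤-reflexive (sym vq≡)))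
    rearrange : ∀ v q l → v + q *ℕ l + l ≡ v + (1 + q) *ℕ l
    rearrange = solve-∀
    key : v *ℕ m + λ' ≡ v + v *ℕ λ'
    key = trans (cong (_+ λ') (h₃ refl)) (rearrange v q λ')
    λ<m : λ' < m
    λ<m = ℕₚ.≰⇒> λ m≤λ → ℕₚ.<⇒≢ (begin-strict
      v *ℕ m + λ'  ≤⟨ ℕₚ.+-mono-≤ (ℕₚ.*-monoʳ-≤ v m≤λ) λ≤q ⟩
      v *ℕ λ' + q  <⟨ ℕₚ.+-monoʳ-< (v *ℕ λ') (ℕₚ.n<1+n q) ⟩
      v *ℕ λ' + v  ≡⟨ ℕₚ.+-comm (v *ℕ λ') v ⟩
      v + v *ℕ λ'  ∎) key
      where open ℕₚ.≤-Reasoning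
    λ≡0 : λ' ≡ 0
    λ≡0 = ℕₚ.n≤0⇒n≡0 (ℕₚ.+-cancelˡ-≤ (v + v *ℕ λ') λ' 0 (begin
      v + v *ℕ λ' + λ'  ≡⟨ cong (_+ λ') (ℕₚ.*-suc v λ') ⟨
      v *ℕ suc λ' + λ'  ≤⟨ ℕₚ.+-monoˡ-≤ λ' (ℕₚ.*-monoʳ-≤ v λ<m) ⟩
      v *ℕ m + λ'       ≡⟨ key ⟩
      v + v *ℕ λ'       ≡⟨ ℕₚ.+-identityʳ _ ⟨
      v + v *ℕ λ' + 0   ∎))
      where open ℕₚ.≤-Reasoning
    q≡0 : q ≡ 0
    q≡0 = ℕₚ.m+n≡0⇒m≡0 q (trans vq≡ (trans (cong (r *ℕ_) λ≡0) (ℕₚ.*-zeroʳ r)))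
    c≡1 : suc c ≡ 1
    c≡1 = ℕₚ.m*n≡1⇒m≡1 (suc c) m (trans (sym h₂) (cong (λ q → suc q *ℕ suc q) q≡0))

  solution : b ≡ 1 × c ≡ 1 × r' ≡ 1
  solution = solve-N b c r' ƛ μ 1≤b 1≤c b²-via-mates b²-via-squares common-paths part-split

  s : X → X
  s x = proj₁ (successor x)

  B-s : ∀ x → B x (s x) ≡ true
  B-s x = proj₂ (successor x)

  s-unique : ∀ {x y} → B x y ≡ true → y ≡ s x
  s-unique {x} {y} h = count-unique (B x) (ℕₚ.≤-reflexive (trans (degB x x₀) (proj₁ solution))) h (B-s x)

  C-unique : ∀ {x y} → C x y ≡ true → y ≡ s (s x)
  C-unique {x} {y} h = count-unique (C x) (ℕₚ.≤-reflexive (trans (degC x) (proj₁ (proj₂ solution)))) h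
    (B² (B-s x) (B-s (s x)))

  D-unique : ∀ {x y z} → D x y ≡ true → D x z ≡ true → y ≡ z
  D-unique {x} = count-unique (D x) (ℕₚ.≤-reflexive (trans (deg-const {D} D-inv x x₀) (proj₂ (proj₂ solution))))

  -- Three steps pass once around the three parts, and x itself is excluded because x → s (s x) is
  -- one-way. So s cubed exchanges mates.
  s³ : ∀ x → D x (s (s (s x))) ≡ true
  s³ x = mk-D (E-fun (C-E (B² (B-s x) (B-s (s x)))) (B⇒E (B-s (s (s x)))))
    (λ q → clash (subst (λ z → a (s (s x)) z ≡ true) (sym q) (B⇒a (B-s (s (s x)))))
                 (f⇒¬a (C⇒f (B² (B-s x) (B-s (s x))))))

  s⁶ : ∀ x → s (s (s (s (s (s x))))) ≡ x
  s⁶ x = D-unique (s³ (s (s (s x)))) (D-sym (s³ x))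

  a-s : ∀ {x y} → a x y ≡ true → y ≡ s x ⊎ y ≡ s (s x)
  a-s {x} {y} h with a-split h
  ... | inj₁ k = clash k (no-edges x y)
  ... | inj₂ k = [ (λ q → inj₁ (s-unique q)) , (λ q → inj₂ (C-unique q)) ]′ (f-split k)

  a-s₁ : ∀ x → a x (s x) ≡ true
  a-s₁ x = B⇒a (B-s x)

  a-s₂ : ∀ x → a x (s (s x)) ≡ true
  a-s₂ x = C⇒a (B² (B-s x) (B-s (s x)))

-- Girth of semicomplete digraphs

module Girths (Δ : Digraph) (wdr : WeaklyDistanceRegular Δ) (comm : Commutative Δ) where
  open Distance Δ (proj₁ wdr)
  open Scheme (scheme Δ wdr comm) using (deg-const)

  digon⇒walk : ∀ {x y} → arc Δ x y ≡ true → arc Δ y x ≡ true → walk Δ 2 x x ≡ true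
  digon⇒walk {x} {y} p q = step-walk {x} {y} {x} {1} p (arc⇒walk {y} {x} q)

  walk⇒digon : ∀ {x} → walk Δ 2 x x ≡ true → ∃[ y ] arc Δ x y ≡ true × arc Δ y x ≡ true
  walk⇒digon {x} w with ⨾-true⁻ (arc Δ) (walk Δ 1) {x} {x} w
  ... | y , p , q = y , p , walk⇒arc {y} {x} q

  no-loop : ∀ x → walk Δ 1 x x ≡ false
  no-loop x = ≢true⇒≡false λ k → clash {b = arc Δ x x} (walk⇒arc {x} {x} k) (arc-irrefl x)

  girth-2 : ∀ {x y} → arc Δ x y ≡ true → arc Δ y x ≡ true → Girth Δ 2
  girth-2 {x} {y} p q = s≤s z≤n , (x , digon⇒walk p q) , short
    where
    short : ∀ r x → 1 ≤ r → r < 2 → walk Δ r x x ≡ false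
    short 1 x _ _ = no-loop x
    short (suc (suc r)) x _ (s≤s (s≤s ()))

  -- For a one-way arc x → y, equal out-degrees give z with y → z but not x → z; completeness then
  -- supplies z → x.
  triangle : Semicomplete Δ → (∀ {x y} → arc Δ x y ≡ true → arc Δ y x ≡ true → ⊥) →
             ∃[ x ] ∃[ y ] ∃[ z ] arc Δ x y ≡ true × arc Δ y z ≡ true × arc Δ z x ≡ true
  triangle semi no-digon = close (count-exchange (arc Δ x) (arc Δ y)
      (ℕₚ.≤-reflexive (deg-const {arc Δ} (arc-inv Δ wdr comm) x y)) {y} p (arc-irrefl y))
    where
    x y : V Δ
    x = proj₁ (proj₁ (proj₂ wdr))
    y = proj₁ (proj₂ (proj₁ (proj₂ wdr)))
    p : arc Δ x y ≡ true
    p = proj₁ (proj₂ (proj₂ (proj₁ (proj₂ wdr))))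
    q : arc Δ y x ≡ false
    q = proj₂ (proj₂ (proj₂ (proj₁ (proj₂ wdr))))
    close : (∃[ z ] arc Δ y z ≡ true × arc Δ x z ≡ false) →
            ∃[ x ] ∃[ y ] ∃[ z ] arc Δ x y ≡ true × arc Δ y z ≡ true × arc Δ z x ≡ true
    close (z , u , v) = x , y , z , p , u ,
      [ (λ k → clash {b = arc Δ x z} k v) , id ]′
        (∨-true⁻ {arc Δ x z} {arc Δ z x} (semi x z λ x≡z →
          clash {b = arc Δ y x} (subst (λ w → arc Δ y w ≡ true) (sym x≡z) u) q))

  girth-3 : Semicomplete Δ → (∀ {x y} → arc Δ x y ≡ true → arc Δ y x ≡ true → ⊥) → Girth Δ 3
  girth-3 semi no-digon = s≤s z≤n , cycle (triangle semi no-digon) , short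
    where
    cycle : ∃[ x ] ∃[ y ] ∃[ z ] arc Δ x y ≡ true × arc Δ y z ≡ true × arc Δ z x ≡ true → ∃[ x ] walk Δ 3 x x ≡ true
    cycle (x , y , z , p , q , r) =
      x , step-walk {x} {y} {x} {2} p (step-walk {y} {z} {x} {1} q (arc⇒walk {z} {x} r))
    short : ∀ r x → 1 ≤ r → r < 3 → walk Δ r x x ≡ false
    short 1 x _ _ = no-loop x
    short 2 x _ _ = ≢true⇒≡false λ w → digon (walk⇒digon w)
      where
      digon : ∃[ y ] arc Δ x y ≡ true × arc Δ y x ≡ true → ⊥
      digon (y , p , q) = no-digon p q
    short (suc (suc (suc r))) x _ (s≤s (s≤s (s≤s ())))

  semicomplete-girth : Semicomplete Δ → Girth Δ 2 ⊎ Girth Δ 3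
  semicomplete-girth semi with bool (anyFin (λ x → anyFin (λ y → arc Δ x y ∧ arc Δ y x)))
  ... | inj₂ h = inj₂ (girth-3 semi λ {x} {y} p q → clash (∧-true {arc Δ x y} {arc Δ y x} p q)
          (anyFin-false⁻ (λ y → arc Δ x y ∧ arc Δ y x) (anyFin-false⁻ (λ x → anyFin (λ y → arc Δ x y ∧ arc Δ y x)) h x) y))
  ... | inj₁ h with anyFin-true⁻ (λ x → anyFin (λ y → arc Δ x y ∧ arc Δ y x)) h
  ...   | x , k with anyFin-true⁻ (λ y → arc Δ x y ∧ arc Δ y x) k
  ...     | y , l = inj₁ (girth-2 {x} {y} (proj₁ (∧-true⁻ {arc Δ x y} {arc Δ y x} l)) (proj₂ (∧-true⁻ {arc Δ x y} {arc Δ y x} l)))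

-- Orbits, and the digraphs Cay(Z₆,{1,2}) and Σ ∘ C₄

module Orbit {A : Set} (s : A → A) where

  iter : ℕ → A → A
  iter zero    x = x
  iter (suc k) x = s (iter k x)

  iter-+ : ∀ i j x → iter (i + j) x ≡ iter i (iter j x)
  iter-+ zero    j x = refl
  iter-+ (suc i) j x = cong s (iter-+ i j x)

  module _ (s-inj : ∀ {x y} → s x ≡ s y → x ≡ y) where

    iter-injective : ∀ i {x y} → iter i x ≡ iter i y → x ≡ y
    iter-injective zero    h = h
    iter-injective (suc i) h = iter-injective i (s-inj h)

    module _ {m} (free : ∀ x d → 1 ≤ d → d < m → iter d x ≢ x) where

      -- Cancelling the first `toℕ i` steps would leave a return after fewer than m steps.
      orbit-distinct : ∀ x (i j : Fin m) → toℕ i < toℕ j → iter (toℕ i) x ≢ iter (toℕ j) x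
      orbit-distinct x i j lt h = free x (toℕ j ∸ toℕ i) (ℕₚ.m<n⇒0<n∸m lt)
        (ℕₚ.≤-<-trans (ℕₚ.m∸n≤m (toℕ j) (toℕ i)) (toℕ<n j))
        (iter-injective (toℕ i) (trans (sym (iter-+ (toℕ i) (toℕ j ∸ toℕ i) x))
          (trans (cong (λ k → iter k x) (ℕₚ.m+[n∸m]≡n (ℕₚ.<⇒≤ lt))) (sym h))))

      orbit-injective : ∀ x (i j : Fin m) → iter (toℕ i) x ≡ iter (toℕ j) x → i ≡ j
      orbit-injective x i j h with ℕₚ.<-cmp (toℕ i) (toℕ j)
      ... | tri< lt _ _ = contradiction h (orbit-distinct x i j lt)
      ... | tri≈ _ q _  = toℕ-injective q
      ... | tri> _ _ lt = contradiction (sym h) (orbit-distinct x j i lt)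

pattern f0 = zero
pattern f1 = suc f0
pattern f2 = suc f1
pattern f3 = suc f2
pattern f4 = suc f3
pattern f5 = suc f4

next : ∀ {m} → Fin (suc m) → Fin (suc m)
next {m} i = suc (toℕ i) mod suc m

cay6-arc : ∀ i j → arc cay6 i j ≡ (j == next i) ∨ (j == next (next i))
cay6-arc = from-yes (all? λ i → all? λ j → arc cay6 i j ≟ᵇ ((j == next i) ∨ (j == next (next i))))

C4-arc : ∀ i j → arc C4 i j ≡ (j == next i)
C4-arc = from-yes (all? λ i → all? λ j → arc C4 i j ≟ᵇ (j == next i))

module Cayley {Δ : Digraph} (T : Twinless Δ)
              (some-B : ∃[ x ] ∃[ y ] Relations.B T x y ≡ true)
              (some-C : ∃[ x ] ∃[ y ] Relations.C T x y ≡ true)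
              (N-hyp : ∀ {x y} → Relations.B T x y ≡ true → TwoClasses.E T some-B some-C y x ≡ false) where
  open Relations T
  open TwoClasses T some-B some-C
  open CaseN T some-B some-C N-hyp
  open Orbit s

  s-injective : ∀ {x y} → s x ≡ s y → x ≡ y
  s-injective {x} {y} h = trans (sym (s⁶ x)) (trans (cong (iter 5) h) (s⁶ y))

  s≢ : ∀ x → s x ≢ x
  s≢ x = a⇒≢ᵒ (a-s₁ x)

  s²≢ : ∀ x → s (s x) ≢ x
  s²≢ x = a⇒≢ᵒ (a-s₂ x)

  free : ∀ x d → 1 ≤ d → d < 6 → iter d x ≢ x
  free x 1 _ _ h = s≢ x h
  free x 2 _ _ h = s²≢ x h
  free x 3 _ _ h = D⇒≢ (s³ x) (sym h)
  -- By `s⁶`, a return after four or five steps is a return after two or one.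
  free x 4 _ _ h = s²≢ x (trans (cong (iter 2) (sym h)) (s⁶ x))
  free x 5 _ _ h = s≢ x (trans (cong s (sym h)) (s⁶ x))
  free x (suc (suc (suc (suc (suc (suc d)))))) _ (s≤s (s≤s (s≤s (s≤s (s≤s (s≤s ()))))))

  orbit : Fin 6 → X
  orbit i = iter (toℕ i) x₀

  orbit-inj : ∀ {i j} → orbit i ≡ orbit j → i ≡ j
  orbit-inj {i} {j} = orbit-injective s-injective free x₀ i j

  orbit-next : ∀ i → s (orbit i) ≡ orbit (next i)
  orbit-next f0 = refl
  orbit-next f1 = refl
  orbit-next f2 = refl
  orbit-next f3 = refl
  orbit-next f4 = refl
  orbit-next f5 = s⁶ x₀

  -- Every vertex other than x₀ is its mate or is joined to it by an arc. The mate is the third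
  -- iterate and the out-neighbours are the first two; in-neighbours are inverse iterates, which
  -- `s⁶` turns into the fourth and fifth.
  covered : ∀ w → ∃[ i ] orbit i ≡ w
  covered w with position x₀ w
  ... | here q  = f0 , q
  ... | mate d  = f3 , D-unique (s³ x₀) d
  ... | both p  = clash p (no-edges x₀ w)
  ... | into p with a-s (f⇒a p)
  ...   | inj₁ q = f1 , sym q
  ...   | inj₂ q = f2 , sym q
  covered w | outof p with a-s (f⇒a p)
  ...   | inj₁ q = f5 , trans (cong (iter 5) q) (s⁶ w)
  ...   | inj₂ q = f4 , trans (cong (iter 4) q) (s⁶ w)

  orbit-arc : ∀ i j → arc Δ (orbit i) (orbit j) ≡ arc cay6 i j
  orbit-arc i j = trans (sym (a-def (orbit i) (orbit j))) (trans (bool-ext to from) (sym (cay6-arc i j)))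
    where
    second : s (s (orbit i)) ≡ orbit (next (next i))
    second = trans (cong s (orbit-next i)) (orbit-next (next i))

    to : a (orbit i) (orbit j) ≡ true → (j == next i) ∨ (j == next (next i)) ≡ true
    to h with a-s h
    ... | inj₁ q = ∨-trueˡ (≡⇒== (orbit-inj {j} {next i} (trans q (orbit-next i))))
    ... | inj₂ q = ∨-trueʳ {j == next i} (≡⇒== (orbit-inj {j} {next (next i)} (trans q second)))

    from : (j == next i) ∨ (j == next (next i)) ≡ true → a (orbit i) (orbit j) ≡ true
    from h with ∨-true⁻ {j == next i} h
    ... | inj₁ q = subst (λ z → a (orbit i) z ≡ true) (trans (orbit-next i) (cong orbit (sym (==⇒≡ q)))) (a-s₁ (orbit i))
    ... | inj₂ q = subst (λ z → a (orbit i) z ≡ true) (trans second (cong orbit (sym (==⇒≡ q)))) (a-s₂ (orbit i))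

  ≅cay6 : Δ ≅ cay6
  ≅cay6 = mk↔ₛ′ (λ x → proj₁ (covered x)) orbit (λ i → orbit-inj {proj₁ (covered (orbit i))} {i} (proj₂ (covered (orbit i)))) (λ x → proj₂ (covered x)) ,
    λ x y → trans (sym (orbit-arc (proj₁ (covered x)) (proj₁ (covered y))))
                  (cong₂ (arc Δ) (proj₂ (covered x)) (proj₂ (covered y)))

module Lexicographic {Δ : Digraph} (T : Twinless Δ)
                     (some-B : ∃[ x ] ∃[ y ] Relations.B T x y ≡ true)
                     (some-C : ∃[ x ] ∃[ y ] Relations.C T x y ≡ true)
                     (S-hyp : ∀ {x y} → Relations.B T x y ≡ true → TwoClasses.E T some-B some-C y x ≡ true) where
  open Relations T
  open TwoClasses T some-B some-C
  open CaseS S-hyp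
  open Orbit s

  Q : Quotient U
  Q = quotient U-equivalence

  open Quotient Q

  U-inv' : Scheme.Inv (scheme Δ wdr comm) U
  U-inv' = subst (λ sc → Scheme.Inv sc U) S-def U-inv

  arc-lift : ∀ {x x' y y'} → U x x' ≡ true → U y y' ≡ true → U x y ≡ false → arc Δ x y ≡ arc Δ x' y'
  arc-lift {x} {x'} {y} {y'} h k l = trans (sym (a-def x y)) (trans (U-lift h k l) (a-def x' y'))

  open Collapse Δ wdr comm U-equivalence Q U-inv' arc-lift using (Γ/F; arc-/; wdr-/; comm-/)

  -- Written as a successor so that the collapse can cancel the class size.
  class-size : ∀ x → countFin (U x) ≡ suc (countFin (U x₀) ∸ 1)
  class-size x = trans (deg-const {U} U-inv x x₀)
    (sym (ℕₚ.m+[n∸m]≡n {1} (count-pos (U x₀) x₀ (R⇒U (R-refl x₀)))))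

  wdr/ : WeaklyDistanceRegular Γ/F
  wdr/ = wdr-/ class-size (proj₁ outside-arc , proj₁ (proj₂ outside-arc) , proj₁ (proj₂ (proj₂ outside-arc)) ,
    trans (sym (a-def _ _)) (f⇒a f-arc) , trans (sym (a-def _ _)) (f⇒¬a f-arc))
    where
    f-arc : f (proj₁ outside-arc) (proj₁ (proj₂ outside-arc)) ≡ true
    f-arc = proj₂ (proj₂ (proj₂ outside-arc))

  repr-apart : ∀ {i j} → i ≢ j → U (repr i) (repr j) ≡ false
  repr-apart h = ≢true⇒≡false λ k → h (trans (sym (π-repr _)) (trans (π-cong k) (π-repr _)))

  arc-repr : ∀ {i j} → i ≢ j → arc Γ/F i j ≡ a (repr i) (repr j)
  arc-repr {i} {j} h = trans (sym (cong₂ (arc Γ/F) (π-repr i) (π-repr j)))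
    (trans (arc-/ (repr-apart h)) (sym (a-def (repr i) (repr j))))

  semicomplete/ : Semicomplete Γ/F
  semicomplete/ i j h = [ (λ k → ∨-trueˡ (trans (arc-repr h) k)) ,
                          (λ k → ∨-trueʳ {arc Γ/F i j} (trans (arc-repr (λ q → h (sym q))) k)) ]′
    (total (¬U⇒¬R (repr-apart h)))

  girth/ : Girth Γ/F 3
  girth/ = Girths.girth-3 Γ/F wdr/ (comm-/ class-size) semicomplete/ no-digon
    where
    no-digon : ∀ {i j} → arc Γ/F i j ≡ true → arc Γ/F j i ≡ true → ⊥
    no-digon {i} {j} p q = clash {b = a (repr j) (repr i)} (trans (sym (arc-repr (λ e → i≢j (sym e)))) q)
        (f⇒¬a (strict-outside (repr-apart i≢j) (trans (sym (arc-repr i≢j)) p)))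
      where
      i≢j : i ≢ j
      i≢j refl = clash {b = arc Γ/F i i} p (Distance.arc-irrefl Γ/F (proj₁ wdr/) i)

  free : ∀ x d → 1 ≤ d → d < 4 → iter d x ≢ x
  free x 1 _ _ h = a⇒≢ᵒ (B⇒a (B-s x)) h
  free x 2 _ _ h = D⇒≢ (s² x) (sym h)
  free x 3 _ _ h = a⇒≢ᵒ (B⇒a (B-s x)) (trans (cong s (sym h)) (s⁴ x))
  free x (suc (suc (suc (suc d)))) _ (s≤s (s≤s (s≤s (s≤s ()))))

  point : Fin size × Fin 4 → X
  point (i , k) = iter (toℕ k) (repr i)

  U-s : ∀ x → U x (s x) ≡ true
  U-s x = E⇒U (B⇒E (B-s x))

  U-iter : ∀ k x → U x (iter k x) ≡ true
  U-iter zero    x = R⇒U (R-refl x)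
  U-iter (suc k) x = U-trans (U-iter k x) (U-s (iter k x))

  π-point : ∀ p → π (point p) ≡ proj₁ p
  π-point (i , k) = trans (sym (π-cong (U-iter (toℕ k) (repr i)))) (π-repr i)

  point-inj : ∀ {p q} → point p ≡ point q → p ≡ q
  point-inj {i , k} {j , l} h with trans (sym (π-point (i , k))) (trans (cong π h) (π-point (j , l)))
  ... | refl = cong (i ,_) (orbit-injective s-injective free (repr i) k l h)

  -- From the representative of its block, a vertex is the B-successor, the B-predecessor (third
  -- iterate by `s⁴`), the representative itself or its only mate.
  covered : ∀ x → ∃[ p ] point p ≡ x
  covered x with U⁻ (U-sym (repr-related x))
  ... | inj₂ h with E-split h
  ...   | inj₁ k = (π x , f1) , sym (s-unique k)
  ...   | inj₂ k = (π x , f3) , trans (cong (iter 3) (s-unique k)) (s⁴ x)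
  covered x | inj₁ h with repr (π x) ≟ᶠ x
  ...   | yes q = (π x , f0) , q
  ...   | no q  = (π x , f2) , D-unique (s² (repr (π x))) (mk-D h q)

  point-next : ∀ i k → s (point (i , k)) ≡ point (i , next k)
  point-next i f0 = refl
  point-next i f1 = refl
  point-next i f2 = refl
  point-next i f3 = s⁴ (repr i)

  inside : ∀ i k l → arc Δ (point (i , k)) (point (i , l)) ≡ arc C4 k l
  inside i k l = trans (sym (a-def (point (i , k)) (point (i , l)))) (trans (bool-ext to from) (sym (C4-arc k l)))
    where
    to : a (point (i , k)) (point (i , l)) ≡ true → (l == next k) ≡ true
    to h = ≡⇒== (cong proj₂ (point-inj (trans (s-unique (a-inside
      (U-trans (U-sym (U-iter (toℕ k) (repr i))) (U-iter (toℕ l) (repr i))) h)) (point-next i k))))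
    from : (l == next k) ≡ true → a (point (i , k)) (point (i , l)) ≡ true
    from h = subst (λ z → a (point (i , k)) z ≡ true)
      (trans (point-next i k) (cong (λ l → point (i , l)) (sym (==⇒≡ h)))) (B⇒a (B-s (point (i , k))))

  point-arc : ∀ p q → arc Δ (point p) (point q) ≡
                      arc Γ/F (proj₁ p) (proj₁ q) ∨ ((proj₁ p == proj₁ q) ∧ arc C4 (proj₂ p) (proj₂ q))
  point-arc (i , k) (j , l) = by-block (i ≟ᶠ j)
    where
    by-block : Dec (i ≡ j) → arc Δ (point (i , k)) (point (j , l)) ≡ arc Γ/F i j ∨ ((i == j) ∧ arc C4 k l)
    by-block (yes refl) = trans (inside i k l)
      (sym (cong₂ (λ b c → b ∨ (c ∧ arc C4 k l)) (Distance.arc-irrefl Γ/F (proj₁ wdr/) i) (==-refl i)))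
    by-block (no i≢j) = trans (sym (arc-/ (≢true⇒≡false λ h → i≢j
        (trans (sym (π-point (i , k))) (trans (π-cong h) (π-point (j , l)))))))
      (trans (cong₂ (arc Γ/F) (π-point (i , k)) (π-point (j , l)))
        (trans (sym (∨-identityʳ _)) (cong (λ c → arc Γ/F i j ∨ (c ∧ arc C4 k l)) (sym (≢⇒== i≢j)))))

  ≅lex : Δ ≅ (Γ/F ∘ₗ C4)
  ≅lex = lex-iso Δ Γ/F C4 (record
    { to = λ x → proj₁ (covered x) ; from = point
    ; to-from = λ p → point-inj (proj₂ (covered (point p))) ; from-to = λ x → proj₂ (covered x) }) point-arc

-- Matrix equations and digraphs of Type II

open import Data.Integer using (ℤ; +_; _*_; 0ℤ; 1ℤ)

infix 8 ⟦_⟧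
⟦_⟧ : Bool → ℤ
⟦ b ⟧ = if b then 1ℤ else 0ℤ

sumFin-count : ∀ {n} (g : Fin n → ℤ) (b : Fin n → Bool) → (∀ z → g z ≡ ⟦ b z ⟧) → sumFin g ≡ + countFin b
sumFin-count {zero}  g b h = refl
sumFin-count {suc n} g b h rewrite h zero | sumFin-count (λ z → g (suc z)) (λ z → b (suc z)) (λ z → h (suc z))
  with b zero
... | true  = refl
... | false = ℤₚ.+-identityˡ _

⊗-N : ∀ {n} (A A' : Mat n) (ρ σ : Rel n) → (∀ x y → A x y ≡ ⟦ ρ x y ⟧) → (∀ x y → A' x y ≡ ⟦ σ x y ⟧) →
      ∀ x y → (A ⊗ A') x y ≡ + N ρ σ x y
⊗-N A A' ρ σ h k x y = sumFin-count _ (λ z → ρ x z ∧ σ z y) λ z →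
  trans (cong₂ _*_ (h x z) (k z y)) (product (ρ x z) (σ z y))
  where
  product : ∀ b c → ⟦ b ⟧ * ⟦ c ⟧ ≡ ⟦ b ∧ c ⟧
  product true  c = ℤₚ.*-identityˡ ⟦ c ⟧
  product false c = ℤₚ.*-zeroˡ ⟦ c ⟧

module _ (a b c d e : ℤ) where

  -- One entry of the right-hand side of the doubly regular equations, as a function of which basic
  -- relation the pair satisfies; e belongs to distinct vertices of one part.
  combination : Bool → Bool → Bool → Bool → ℤ
  combination i f f' s = a * ⟦ i ⟧ ℤ.+ b * ⟦ f ⟧ ℤ.+ c * ⟦ f' ⟧ ℤ.+ d * ⟦ s ⟧
                         ℤ.+ e * (1ℤ ℤ.- ⟦ i ⟧ ℤ.- ⟦ f ⟧ ℤ.- ⟦ f' ⟧ ℤ.- ⟦ s ⟧)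

  combination-cong : ∀ {i i' f f' g g' s s'} → i ≡ i' → f ≡ f' → g ≡ g' → s ≡ s' →
                     combination i f g s ≡ combination i' f' g' s'
  combination-cong refl refl refl refl = refl

  on-identity : combination true false false false ≡ a
  on-identity = lem a b c d e
    where
    lem : ∀ a b c d e → a * 1ℤ ℤ.+ b * 0ℤ ℤ.+ c * 0ℤ ℤ.+ d * 0ℤ ℤ.+ e * (1ℤ ℤ.- 1ℤ ℤ.- 0ℤ ℤ.- 0ℤ ℤ.- 0ℤ) ≡ a
    lem = ℤ-Solver.solve-∀

  on-arcs : combination false true false false ≡ b
  on-arcs = lem a b c d e
    where
    lem : ∀ a b c d e → a * 0ℤ ℤ.+ b * 1ℤ ℤ.+ c * 0ℤ ℤ.+ d * 0ℤ ℤ.+ e * (1ℤ ℤ.- 0ℤ ℤ.- 1ℤ ℤ.- 0ℤ ℤ.- 0ℤ) ≡ b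
    lem = ℤ-Solver.solve-∀

  on-reversed : combination false false true false ≡ c
  on-reversed = lem a b c d e
    where
    lem : ∀ a b c d e → a * 0ℤ ℤ.+ b * 0ℤ ℤ.+ c * 1ℤ ℤ.+ d * 0ℤ ℤ.+ e * (1ℤ ℤ.- 0ℤ ℤ.- 0ℤ ℤ.- 1ℤ ℤ.- 0ℤ) ≡ c
    lem = ℤ-Solver.solve-∀

  on-edges : combination false false false true ≡ d
  on-edges = lem a b c d e
    where
    lem : ∀ a b c d e → a * 0ℤ ℤ.+ b * 0ℤ ℤ.+ c * 0ℤ ℤ.+ d * 1ℤ ℤ.+ e * (1ℤ ℤ.- 0ℤ ℤ.- 0ℤ ℤ.- 0ℤ ℤ.- 1ℤ) ≡ d
    lem = ℤ-Solver.solve-∀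

  on-mates : combination false false false false ≡ e
  on-mates = lem a b c d e
    where
    lem : ∀ a b c d e → a * 0ℤ ℤ.+ b * 0ℤ ℤ.+ c * 0ℤ ℤ.+ d * 0ℤ ℤ.+ e * (1ℤ ℤ.- 0ℤ ℤ.- 0ℤ ℤ.- 0ℤ ℤ.- 0ℤ) ≡ e
    lem = ℤ-Solver.solve-∀

2≤parts : ∀ {m} {i j : Fin m} → i ≢ j → 2 ≤ m
2≤parts {suc zero}    {zero} {zero} h = contradiction refl h
2≤parts {suc (suc m)} h = s≤s (s≤s z≤n)

module TypeII {Δ : Digraph} (T : Twinless Δ) where
  open Relations T
  open SingleClass T

  private
    x₀ y₀ d₁ d₂ : X
    x₀ = proj₁ arc-pair
    y₀ = proj₁ (proj₂ arc-pair)
    d₁ = proj₁ mates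
    d₂ = proj₁ (proj₂ mates)

    f₀ : f x₀ y₀ ≡ true
    f₀ = proj₂ (proj₂ arc-pair)

    D₀ : D d₁ d₂ ≡ true
    D₀ = mk-D (part⇒R (proj₁ (proj₂ (proj₂ mates)))) (proj₂ (proj₂ (proj₂ mates)))

  r : ℕ
  r = countFin (R x₀)

  2≤r : 2 ≤ r
  2≤r = subst (2 ≤_) (deg-R d₁ x₀) (count-two (R d₁) (R-refl d₁) (D⇒R D₀) (D⇒≢ D₀))

  parts≥2 : 2 ≤ parts
  parts≥2 = 2≤parts (λ q → clash (part⇒R q) (a⇒¬R (f⇒a f₀)))

  team : TeamBy Δ parts r part
  team = parts≥2 , 2≤r , (λ i → part-size i x₀) , multi

  regular : Regular Δ
  regular = countFin (a x₀) , λ x →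
    trans (count-cong λ y → sym (a-def x y)) (deg-a x x₀) ,
    trans (count-cong λ y → sym (a-def y x)) (deg-flip {a} a-inv x x₀)

  into-section : ∀ y j → (part y == j) ≡ R y (section j)
  into-section y j = trans (cong (part y ==_) (sym (part-sec j))) (sym (R-def y (section j)))

  sym≡e : ∀ x y → sym? Δ x y ≡ e x y
  sym≡e x y = trans (cong₂ _∧_ (sym (a-def x y)) (sym (a-def y x))) (sym (e-def x y))

  asym≡f : ∀ x y → asym? Δ x y ≡ f x y
  asym≡f x y = trans (cong₂ (λ b c → b ∧ not c) (sym (a-def x y)) (sym (a-def y x))) (sym (f-def x y))

  record Bits (x y : X) (i g g' s : Bool) : Set where
    constructor bits
    field
      bit-i  : (x == y) ≡ i
      bit-f  : f x y ≡ g
      bit-fᵒ : f y x ≡ g'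
      bit-e  : e x y ≡ s

  private
    no-f : ∀ {x y} → a x y ≡ false → f x y ≡ false
    no-f h = ≢true⇒≡false λ k → clash (f⇒a k) h
    no-fᵒ : ∀ {x y} → a y x ≡ true → f x y ≡ false
    no-fᵒ h = ≢true⇒≡false λ k → clash h (f⇒¬a k)
    no-e : ∀ {x y} → a x y ≡ false → e x y ≡ false
    no-e h = ≢true⇒≡false λ k → clash (e⇒a k) h

  bits-here : ∀ x → Bits x x true false false false
  bits-here x = bits (==-refl x) (no-f (a-irrefl x)) (no-f (a-irrefl x)) (no-e (a-irrefl x))

  bits-mate : ∀ {x y} → D x y ≡ true → Bits x y false false false false
  bits-mate h = bits (≢⇒== (D⇒≢ h)) (no-f (R⇒¬a (D⇒R h))) (no-f (R⇒¬a (D⇒R (D-sym h)))) (no-e (R⇒¬a (D⇒R h)))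

  bits-both : ∀ {x y} → e x y ≡ true → Bits x y false false false true
  bits-both h = bits (≢⇒== (a⇒≢ (e⇒a h))) (no-fᵒ (e⇒aᵒ h)) (no-fᵒ (e⇒a h)) h

  bits-into : ∀ {x y} → f x y ≡ true → Bits x y false true false false
  bits-into h = bits (≢⇒== (a⇒≢ (f⇒a h))) h (no-f (f⇒¬a h))
    (≢true⇒≡false λ k → clash (e⇒aᵒ k) (f⇒¬a h))

  bits-outof : ∀ {x y} → f y x ≡ true → Bits x y false false true false
  bits-outof h = bits (≢⇒== (a⇒≢ᵒ (f⇒a h))) (no-f (f⇒¬a h)) h (no-e (f⇒¬a h))

  evaluate : ∀ {x y i g g' s} → Bits x y i g g' s → ∀ t α β γ η →
    (t · Im ⊕ α · A₁ Δ ⊕ β · ᵀ (A₁ Δ) ⊕ γ · A₀ Δ ⊕ η · (Jm ⊖ Im ⊖ A₁ Δ ⊖ ᵀ (A₁ Δ) ⊖ A₀ Δ)) x y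
      ≡ combination t α β γ η i g g' s
  evaluate {x} {y} (bits p q r s) t α β γ η =
    combination-cong t α β γ η p (trans (asym≡f x y) q) (trans (asym≡f y x) r) (trans (sym≡e x y) s)

  module _ (f-hom : Homogeneous f) where

    private
      family : Fin 2 → Rel (n Δ)
      family zero    = e
      family (suc _) = f

      family-inv : ∀ i → Inv (family i)
      family-inv zero    = e-inv
      family-inv (suc _) = f-inv

      Amat-family : ∀ i x y → Amat Δ i x y ≡ ⟦ family i x y ⟧
      Amat-family zero    x y = cong ⟦_⟧ (sym≡e x y)
      Amat-family (suc _) x y = cong ⟦_⟧ (asym≡f x y)

      paths : Fin 3 → X → X → ℕ
      paths zero          = N e e
      paths (suc zero)    = N e f
      paths (suc (suc _)) = N f f

      paths-inv : ∀ s {x y x' y'} → ty x y ≡ ty x' y' → paths s x y ≡ paths s x' y'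
      paths-inv zero          = N-inv {e} {e} e-inv e-inv
      paths-inv (suc zero)    = N-inv {e} {f} e-inv f-inv
      paths-inv (suc (suc _)) = N-inv {f} {f} f-inv f-inv

      product-paths : ∀ i j x y → (Amat Δ i ⊗ Amat Δ j) x y ≡ + paths (idx Δ i j) x y
      product-paths i j x y =
        trans (⊗-N (Amat Δ i) (Amat Δ j) (family i) (family j) (Amat-family i) (Amat-family j) x y)
              (cong +_ (lem i j))
        where
        lem : ∀ i j → N (family i) (family j) x y ≡ paths (idx Δ i j) x y
        lem zero    zero    = refl
        lem zero    (suc _) = refl
        -- Both mixed products are governed by the same coefficients, so they must agree;
        -- commutativity provides this.
        lem (suc _) zero    = N-comm {f} {e} f-inv e-inv x y
        lem (suc _) (suc _) = refl

      t : ℤ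
      t = + countFin (e x₀)

      -- Each coefficient is the path count at one sample pair of the relation that it multiplies,
      -- which suffices because these relations are single classes.
      α β γ η : Fin 3 → ℤ
      α s = + paths s x₀ y₀
      β s = + paths s y₀ x₀
      γ s with bool (anyFin (λ x → anyFin (e x)))
      ... | inj₁ h = let x , k = anyFin-true⁻ (λ x → anyFin (e x)) h ; y , _ = anyFin-true⁻ (e x) k in
                     + paths s x y
      -- Without digons A₀ vanishes, so any coefficient would serve.
      ... | inj₂ _ = 0ℤ
      η s = + paths s d₁ d₂

      γ-correct : ∀ s {x y} → e x y ≡ true → + paths s x y ≡ γ s
      γ-correct s {x} {y} h with bool (anyFin (λ x → anyFin (e x)))
      ... | inj₂ k = clash (anyFin-true (λ x → anyFin (e x)) x (anyFin-true (e x) y h)) k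
      ... | inj₁ k with anyFin-true⁻ (λ x → anyFin (e x)) k
      ...   | x' , k' with anyFin-true⁻ (e x') k'
      ...     | y' , q = cong +_ (paths-inv s (e-hom h q))

      diagonal : ∀ s x → + paths s x x ≡ t * δ0 Δ s
      diagonal zero x = trans (cong +_ (trans
        (count-cong {f = λ z → e x z ∧ e z x} {e x} λ z → bool-ext (λ h → proj₁ (∧-true⁻ h)) (λ h → ∧-true h (e-sym h)))
        (deg-const {e} e-inv x x₀))) (sym (ℤₚ.*-identityʳ t))
      diagonal (suc zero) x = trans (cong +_ (count-none λ z → ≢true⇒≡false λ h →
        let p , q = ∧-true⁻ {e x z} h in clash (e⇒a p) (f⇒¬a q))) (sym (ℤₚ.*-zeroʳ t))
      diagonal (suc (suc _)) x = trans (cong +_ (count-none λ z → ≢true⇒≡false λ h →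
        let p , q = ∧-true⁻ {f x z} h in clash (f⇒a p) (f⇒¬a q))) (sym (ℤₚ.*-zeroʳ t))

      equations : DRSCMPEqns Δ t α β γ η
      equations i j x y = trans (product-paths i j x y) (entry (idx Δ i j) (position x y))
        where
        entry : ∀ s → Position x y → + paths s x y ≡
          ((t * δ0 Δ s) · Im ⊕ α s · A₁ Δ ⊕ β s · ᵀ (A₁ Δ) ⊕ γ s · A₀ Δ
            ⊕ η s · (Jm ⊖ Im ⊖ A₁ Δ ⊖ ᵀ (A₁ Δ) ⊖ A₀ Δ)) x y
        entry s (here refl) = trans (diagonal s x) (sym (trans
          (evaluate (bits-here x) (t * δ0 Δ s) (α s) (β s) (γ s) (η s)) (on-identity _ (α s) (β s) (γ s) (η s))))
        entry s (mate h)  = trans (cong +_ (paths-inv s (D-hom h D₀))) (sym (trans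
          (evaluate (bits-mate h) (t * δ0 Δ s) (α s) (β s) (γ s) (η s)) (on-mates (t * δ0 Δ s) (α s) (β s) (γ s) _)))
        entry s (both h)  = trans (γ-correct s h) (sym (trans
          (evaluate (bits-both h) (t * δ0 Δ s) (α s) (β s) (γ s) (η s)) (on-edges (t * δ0 Δ s) (α s) (β s) _ (η s))))
        entry s (into h)  = trans (cong +_ (paths-inv s (f-hom h f₀))) (sym (trans
          (evaluate (bits-into h) (t * δ0 Δ s) (α s) (β s) (γ s) (η s)) (on-arcs (t * δ0 Δ s) _ (β s) (γ s) (η s))))
        entry s (outof h) = trans (cong +_ (paths-inv s (ty-flip (f-hom h f₀)))) (sym (trans
          (evaluate (bits-outof h) (t * δ0 Δ s) (α s) (β s) (γ s) (η s)) (on-reversed (t * δ0 Δ s) (α s) _ (γ s) (η s))))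

      -- a is the disjoint union of e and f, so α₁ + α₂ and β₁ + β₂ are the values of `N a f` at a
      -- one-way arc and at its reverse.
      balance : β (suc zero) ℤ.+ β (suc (suc zero)) ℤ.- α (suc zero) ℤ.- α (suc (suc zero)) ≡ 0ℤ
      balance = trans (regroup (β (suc zero)) (β (suc (suc zero))) (α (suc zero)) (α (suc (suc zero))))
        (ℤₚ.i≡j⇒i-j≡0 (cong +_ (trans (sym (N-a-f-split f-hom y₀ x₀))
          (trans (N-a-f-sym f-hom y₀ x₀) (N-a-f-split f-hom x₀ y₀)))))
        where
        regroup : ∀ b b' a a' → b ℤ.+ b' ℤ.- a ℤ.- a' ≡ (b ℤ.+ b') ℤ.- (a ℤ.+ a')
        regroup = ℤ-Solver.solve-∀

      eSize-cnt : ∀ x j → eSize Δ part x j ≡ cnt e x (section j)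
      eSize-cnt x j = count-cong λ y → trans (∧-comm _ (sym? Δ x y)) (cong₂ _∧_ (sym≡e x y) (into-section y j))

      aSize-cnt : ∀ x j → aSize Δ part x j ≡ cnt f x (section j)
      aSize-cnt x j = count-cong λ y → trans (∧-comm _ (asym? Δ x y)) (cong₂ _∧_ (asym≡f x y) (into-section y j))

      R-section : ∀ x → R x (section (part x)) ≡ true
      R-section x = part⇒R (sym (part-sec (part x)))

    semicomplete-typeII : DRTeamSCMPTypeII Δ parts r
    semicomplete-typeII = part , team , regular , t , α , β , γ , η , equations , balance ,
      (λ i j → cnt e (section i) (section j)) , (λ i j → cnt f (section i) (section j)) ,
      λ i j i≢j →
        (λ { x refl → trans (eSize-cnt x j) (cnt-row {e} e-inv (R-section x)) ,
                      trans (aSize-cnt x j) (cnt-row {f} f-inv (R-section x)) }) ,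
        cnt-f-sym f-hom (section i) (section j) ,
        trans (cnt-f-e-total f-hom (≢true⇒≡false λ q → i≢j
                 (trans (sym (part-sec i)) (trans (R⇒part q) (part-sec j)))))
              (deg-R (section i) x₀)

    module _ (no-edges : ∀ x y → e x y ≡ false) where

      private
        α' γ' : ℕ
        α' = N a a x₀ y₀
        γ' = N a a d₁ d₂

        arc≡f : ∀ x y → arc Δ x y ≡ f x y
        arc≡f x y = trans (sym (a-def x y)) (a≡f no-edges f-hom x y)

        a₀ : a x₀ y₀ ≡ true
        a₀ = f⇒a f₀

        paths-D : ∀ {x y} → D x y ≡ true → N a a x y ≡ γ'
        paths-D h = N-inv {a} {a} a-inv a-inv (D-hom h D₀)

        paths-f : ∀ {x y} → f x y ≡ true → N a a x y ≡ α'
        paths-f h = N-inv {a} {a} a-inv a-inv (f-hom h f₀)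

        evaluate' : ∀ {x y i g g' s} → Bits x y i g g' s →
          ((+ α') · adjMat Δ ⊕ (+ α') · ᵀ (adjMat Δ) ⊕ (+ γ') · (Jm ⊖ Im ⊖ adjMat Δ ⊖ ᵀ (adjMat Δ))) x y
            ≡ combination 0ℤ (+ α') (+ α') (+ γ') (+ γ') i g g' false
        evaluate' {x} {y} (bits p q r s) = trans
          (lem (+ α') (+ γ') ⟦ x == y ⟧ (adjMat Δ x y) (adjMat Δ y x))
          (combination-cong 0ℤ (+ α') (+ α') (+ γ') (+ γ') {s = false} p (trans (arc≡f x y) q) (trans (arc≡f y x) r) refl)
          where
          lem : ∀ a c i g g' → a * g ℤ.+ a * g' ℤ.+ c * (1ℤ ℤ.- i ℤ.- g ℤ.- g') ≡
            0ℤ * i ℤ.+ a * g ℤ.+ a * g' ℤ.+ c * 0ℤ ℤ.+ c * (1ℤ ℤ.- i ℤ.- g ℤ.- g' ℤ.- 0ℤ)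
          lem = ℤ-Solver.solve-∀

        square : adjMat Δ ⊗ adjMat Δ ≈ₘ
          ((+ α') · adjMat Δ ⊕ (+ α') · ᵀ (adjMat Δ) ⊕ (+ γ') · (Jm ⊖ Im ⊖ adjMat Δ ⊖ ᵀ (adjMat Δ)))
        square x y = trans (⊗-N (adjMat Δ) (adjMat Δ) a a
            (λ x y → cong ⟦_⟧ (sym (a-def x y))) (λ x y → cong ⟦_⟧ (sym (a-def x y))) x y) (entry (position x y))
          where
          entry : Position x y → + N a a x y ≡
            ((+ α') · adjMat Δ ⊕ (+ α') · ᵀ (adjMat Δ) ⊕ (+ γ') · (Jm ⊖ Im ⊖ adjMat Δ ⊖ ᵀ (adjMat Δ))) x y
          entry (here refl) = trans (cong +_ (count-none λ z → ≢true⇒≡false λ h →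
              let p , q = ∧-true⁻ {a x z} h in clash q (f⇒¬a (a⇒f no-edges f-hom p))))
            (sym (trans (evaluate' (bits-here x)) (on-identity 0ℤ (+ α') (+ α') (+ γ') (+ γ'))))
          entry (mate h)  = trans (cong +_ (paths-D h))
            (sym (trans (evaluate' (bits-mate h)) (on-mates 0ℤ (+ α') (+ α') (+ γ') (+ γ'))))
          entry (both h)  = clash h (no-edges x y)
          entry (into h)  = trans (cong +_ (paths-f h))
            (sym (trans (evaluate' (bits-into h)) (on-arcs 0ℤ (+ α') (+ α') (+ γ') (+ γ'))))
          entry (outof h) = trans (cong +_ (trans (N-a-a-sym no-edges f-hom x y) (paths-f h)))
            (sym (trans (evaluate' (bits-outof h)) (on-reversed 0ℤ (+ α') (+ α') (+ γ') (+ γ'))))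

        u k c l-1 : ℕ
        u   = cnt a x₀ y₀
        k   = countFin (a x₀)
        c   = countFin (λ z → a x₀ z ∧ not (R z y₀))
        l-1 = countFin (D x₀)

        1≤u : 1 ≤ u
        1≤u = cnt-pos {a} a₀

        2u≡r : 2 *ℕ u ≡ r
        2u≡r = cnt-a-half no-edges f-hom (a⇒¬R a₀)

        k≡u+c : k ≡ u + c
        k≡u+c = count-split (a x₀) (λ z → R z y₀)

        rα : r *ℕ α' ≡ c *ℕ u
        rα = paths-to-part no-edges f-hom a₀

        l-1γ : l-1 *ℕ γ' ≡ k *ℕ u
        l-1γ = trans (cong (_*ℕ γ') (deg-const {D} D-inv x₀ d₁))
          (trans (paths-to-mates no-edges f-hom D₀ a₀) (cong (_*ℕ u) (deg-a d₁ x₀)))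

        order₀ : parts *ℕ r ≡ 2 *ℕ k + r
        order₀ = order-a no-edges f-hom x₀

        r≡ : r ≡ 1 + l-1
        r≡ = deg-R-D x₀

        -- k = (m - 1) u and c = (m - 2) u for m parts.
        solve-parameters : ∀ m u k c r q α γ → 2 ≤ m → 1 ≤ u → 2 *ℕ u ≡ r → k ≡ u + c →
          r *ℕ α ≡ c *ℕ u → q *ℕ γ ≡ k *ℕ u → m *ℕ r ≡ 2 *ℕ k + r → r ≡ 1 + q →
          4 *ℕ α ≡ (m ∸ 2) *ℕ r × 4 *ℕ (r ∸ 1) *ℕ γ ≡ r *ℕ r *ℕ (m ∸ 1)
        -- From here m is the number of parts less two. With r = 2 v and k = v + c, the count of all
        -- vertices yields c = m v.
        solve-parameters (suc (suc m)) (suc w) k c r q α γ (s≤s (s≤s z≤n)) (s≤s z≤n) refl refl h₁ h₂ h₃ h₄ =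
          ℕₚ.*-cancelˡ-≡ _ _ v (trans (e₁ v α) (trans (cong (2 *ℕ_) h₁) (trans (cong (λ c → 2 *ℕ (c *ℕ v)) c≡) (e₂ m v)))) ,
          trans (cong (λ j → 4 *ℕ j *ℕ γ) (cong (_∸ 1) h₄))
            (trans (ℕₚ.*-assoc 4 q γ) (trans (cong (4 *ℕ_) h₂) (trans (cong (λ c → 4 *ℕ ((v + c) *ℕ v)) c≡) (e₃ m v))))
          where
          v = suc w
          e₀ : ∀ m v → suc (suc m) *ℕ (2 *ℕ v) ≡ 2 *ℕ (v + m *ℕ v) + 2 *ℕ v
          e₀ = solve-∀
          c≡ : c ≡ m *ℕ v
          c≡ = ℕₚ.+-cancelˡ-≡ v _ _ (ℕₚ.*-cancelˡ-≡ _ _ 2 (ℕₚ.+-cancelʳ-≡ (2 *ℕ v) _ _ (trans (sym h₃) (e₀ m v))))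
          e₁ : ∀ v α → v *ℕ (4 *ℕ α) ≡ 2 *ℕ (2 *ℕ v *ℕ α)
          e₁ = solve-∀
          e₂ : ∀ m v → 2 *ℕ (m *ℕ v *ℕ v) ≡ v *ℕ (m *ℕ (2 *ℕ v))
          e₂ = solve-∀
          e₃ : ∀ m v → 4 *ℕ ((v + m *ℕ v) *ℕ v) ≡ 2 *ℕ v *ℕ (2 *ℕ v) *ℕ suc m
          e₃ = solve-∀

        parameters : 4 *ℕ α' ≡ (parts ∸ 2) *ℕ r × 4 *ℕ (r ∸ 1) *ℕ γ' ≡ r *ℕ r *ℕ (parts ∸ 1)
        parameters = solve-parameters parts u k c r l-1 α' γ' parts≥2 1≤u 2u≡r k≡u+c rα l-1γ order₀ r≡

        no-two-circuits : GirthAtLeast3 Δ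
        no-two-circuits x = ≢true⇒≡false λ h → case two⁻ (walk-two⁻ h) of λ
          { (z , p , q) → clash q (f⇒¬a (a⇒f no-edges f-hom p)) }

        halves : ∀ i x → part x ≢ i → 2 *ℕ countFin (λ y → arc Δ x y ∧ (part y == i)) ≡ r
        halves i x h = trans (cong (2 *ℕ_) (count-cong λ y → cong₂ _∧_ (sym (a-def x y)) (into-section y i)))
          (trans (cnt-a-half no-edges f-hom (≢true⇒≡false λ q → h (trans (R⇒part q) (part-sec i)))) (deg-R x x₀))

      tournament-typeII : Σ ℤ λ α → Σ ℤ λ β → Σ ℤ λ γ →
        + 4 * α ≡ + ((parts ∸ 2) *ℕ r) × + 4 * β ≡ + ((parts ∸ 2) *ℕ r) ×
        + (4 *ℕ (r ∸ 1)) * γ ≡ + (r *ℕ r *ℕ (parts ∸ 1)) × DRTeamTournamentTypeII Δ parts r α β γ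
      tournament-typeII = + α' , + α' , + γ' , α-eq , α-eq ,
        trans (sym (ℤₚ.pos-* (4 *ℕ (r ∸ 1)) γ')) (cong +_ (proj₂ parameters)) ,
        part , (team , no-two-circuits , regular , square) , refl , (u , sym 2u≡r) , halves
        where
        α-eq : + 4 * + α' ≡ + ((parts ∸ 2) *ℕ r)
        α-eq = trans (sym (ℤₚ.pos-* 4 α')) (cong +_ (proj₁ parameters))

-- Classification of twinless digraphs

any-pair : ∀ {n} (ρ : Rel n) → (∃[ x ] ∃[ y ] ρ x y ≡ true) ⊎ (∀ x y → ρ x y ≡ false)
any-pair ρ with bool (anyFin (λ x → anyFin (ρ x)))
... | inj₂ h = inj₂ λ x → anyFin-false⁻ (ρ x) (anyFin-false⁻ (λ x → anyFin (ρ x)) h x)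
... | inj₁ h with anyFin-true⁻ (λ x → anyFin (ρ x)) h
...   | x , k = inj₁ (x , anyFin-true⁻ (ρ x) k)

data Shape {Δ : Digraph} (T : Twinless Δ) : Set where
  cayley   : Δ ≅ cay6 → Shape T
  lex      : ∀ Σ' → Semicomplete Σ' → WeaklyDistanceRegular Σ' → Girth Σ' 3 → Δ ≅ (Σ' ∘ₗ C4) → Shape T
  typeII   : Relations.Homogeneous T (Relations.f T) → Shape T

classify : ∀ {Δ} (T : Twinless Δ) → Shape T
classify {Δ} T with any-pair (Relations.B T) | any-pair (Relations.C T)
... | inj₂ no-B | _ = typeII λ h k → C-hom (only-C h) (only-C k)
  where
  open Relations T
  only-C : ∀ {x y} → f x y ≡ true → C x y ≡ true
  only-C {x} {y} h = [ (λ k → clash k (no-B x y)) , id ]′ (f-split h)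
... | inj₁ _ | inj₂ no-C = typeII λ h k → B-hom (only-B h) (only-B k)
  where
  open Relations T
  only-B : ∀ {x y} → f x y ≡ true → B x y ≡ true
  only-B {x} {y} h = [ id , (λ k → clash k (no-C x y)) ]′ (f-split h)
... | inj₁ some-B | inj₁ some-C = dichotomy (bool (E y₀ x₀))
  where
  open Relations T
  open TwoClasses T some-B some-C
  -- All B-arcs have one type and E is invariant, so the sample arc x₀ → y₀ decides between the two
  -- cases for all of them.
  reverse-E : ∀ {x y} → B x y ≡ true → E y x ≡ E y₀ x₀
  reverse-E h = E-inv (ty-flip (B-hom h B₀))
  dichotomy : E y₀ x₀ ≡ true ⊎ E y₀ x₀ ≡ false → Shape T
  dichotomy (inj₁ h) = lex Γ/F semicomplete/ wdr/ girth/ ≅lex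
    where
    open Lexicographic T some-B some-C (λ k → trans (reverse-E k) h)
    Γ/F = Collapse.Γ/F Δ wdr comm (TwoClasses.CaseS.U-equivalence T some-B some-C (λ k → trans (reverse-E k) h)) Q U-inv' arc-lift
  dichotomy (inj₂ h) = cayley (Cayley.≅cay6 T some-B some-C (λ k → trans (reverse-E k) h))

-- Twins and their quotient

module Twins (Γ : Digraph) (wdr : WeaklyDistanceRegular Γ) (comm : Commutative Γ) where
  open Distance Γ (proj₁ wdr) hiding (ty)

  abstract
    S : Scheme (n Γ)
    S = scheme Γ wdr comm

    S-def : S ≡ scheme Γ wdr comm
    S-def = refl

    A : Rel (n Γ)
    A = arc Γ

    A-def : ∀ x y → A x y ≡ arc Γ x y
    A-def x y = refl

    A-inv : Scheme.Inv S A
    A-inv = arc-inv Γ wdr comm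

    tw : Rel (n Γ)
    tw x y = not (anyFin (λ z → not ⌊ A x z ≟ᵇ A y z ⌋))

    tw⇒≡ : ∀ {x y} → tw x y ≡ true → ∀ z → A x z ≡ A y z
    tw⇒≡ {x} {y} h z = ⌊⌋-true⁻ (A x z ≟ᵇ A y z) (not-false⁻ (anyFin-false⁻ (λ z → not ⌊ A x z ≟ᵇ A y z ⌋) (not-true⁻ h) z))

    ≡⇒tw : ∀ {x y} → (∀ z → A x z ≡ A y z) → tw x y ≡ true
    ≡⇒tw {x} {y} h = not-true (≢true⇒≡false differ)
      where
      differ : anyFin (λ z → not ⌊ A x z ≟ᵇ A y z ⌋) ≡ true → ⊥
      differ k with anyFin-true⁻ (λ z → not ⌊ A x z ≟ᵇ A y z ⌋) k
      ... | z , l = ⌊⌋-false⁻ (A x z ≟ᵇ A y z) (not-true⁻ l) (h z)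

    ¬tw⇒ : ∀ {x y} → tw x y ≡ false → ∃[ z ] A x z ≢ A y z
    ¬tw⇒ {x} {y} h with anyFin-true⁻ (λ z → not ⌊ A x z ≟ᵇ A y z ⌋) (not-false⁻ h)
    ... | z , k = z , ⌊⌋-false⁻ (A x z ≟ᵇ A y z) (not-true⁻ k)

  open Scheme S

  tw-equivalence : Equivalence tw
  tw-equivalence = record
    { reflexive  = λ x → ≡⇒tw λ z → refl
    ; symmetric  = λ h → ≡⇒tw λ z → sym (tw⇒≡ h z)
    ; transitive = λ h k → ≡⇒tw λ z → trans (tw⇒≡ h z) (tw⇒≡ k z)
    }

  deg-A : ∀ x y → countFin (A x) ≡ countFin (A y)
  deg-A = deg-const {A} A-inv

  -- Twins are the pairs with as many common out-neighbours as possible.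
  tw⇒common : ∀ {x y} → tw x y ≡ true → N A (A ᵒ) x y ≡ countFin (A x)
  tw⇒common {x} {y} h = count-cong {f = λ z → A x z ∧ A y z} {A x} λ z →
    bool-ext (λ k → proj₁ (∧-true⁻ k)) (λ k → ∧-true k (trans (sym (tw⇒≡ h z)) k))

  common⇒tw : ∀ {x y} → countFin (A x) ≤ N A (A ᵒ) x y → tw x y ≡ true
  common⇒tw {x} {y} h = ≡⇒tw λ z → bool-ext
    (λ k → proj₂ (∧-true⁻ {A x z} (count-⊆-≥ {f = λ z → A x z ∧ A y z} {A x}
      (λ z l → proj₁ (∧-true⁻ l)) h z k)))
    (λ k → proj₁ (∧-true⁻ {A x z} (count-⊆-≥ {f = λ z → A x z ∧ A y z} {A y}
      (λ z l → proj₂ (∧-true⁻ {A x z} l)) (subst (_≤ N A (A ᵒ) x y) (deg-A x y) h) z k)))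

  tw-inv : Inv tw
  tw-inv e = bool-ext (half e) (half (sym e))
    where
    half : ∀ {x y x' y'} → ty x y ≡ ty x' y' → tw x y ≡ true → tw x' y' ≡ true
    half {x} {y} {x'} {y'} e h = common⇒tw (ℕₚ.≤-reflexive (trans (deg-A x' x)
      (trans (sym (tw⇒common h)) (N-inv {A} {A ᵒ} A-inv (flip-inv {A} A-inv) e))))

  -- Commutativity equates the numbers of common in-neighbours and common out-neighbours, so twins
  -- also have as many common in-neighbours as possible.
  tw⇒in : ∀ {x y} → tw x y ≡ true → ∀ z → A z x ≡ A z y
  tw⇒in {x} {y} h z = bool-ext (half h) (half (Equivalence.symmetric tw-equivalence h))
    where
    half : ∀ {x y} → tw x y ≡ true → A z x ≡ true → A z y ≡ true
    half {x} {y} h k = proj₂ (∧-true⁻ {A z x} (count-⊆-≥ {f = λ z → A z x ∧ A z y} {λ z → A z x}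
      (λ z l → proj₁ (∧-true⁻ l))
      (ℕₚ.≤-reflexive (trans (deg-flip {A} A-inv x x) (trans (sym (tw⇒common h))
        (N-comm {A} {A ᵒ} A-inv (flip-inv {A} A-inv) x y)))) z k))

  tw⇒¬A : ∀ {x y} → tw x y ≡ true → A x y ≡ false
  tw⇒¬A {x} {y} h = trans (tw⇒≡ h y) (trans (A-def y y) (arc-irrefl y))

  Q : Quotient tw
  Q = quotient tw-equivalence

  open Quotient Q public

  tw-inv' : Scheme.Inv (scheme Γ wdr comm) tw
  tw-inv' = subst (λ sc → Scheme.Inv sc tw) S-def tw-inv

  arc-lift : ∀ {x x' y y'} → tw x x' ≡ true → tw y y' ≡ true → tw x y ≡ false → arc Γ x y ≡ arc Γ x' y'
  arc-lift {x} {x'} {y} {y'} h k _ = begin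
    arc Γ x y   ≡⟨ A-def x y ⟨
    A x y       ≡⟨ tw⇒≡ h y ⟩
    A x' y      ≡⟨ tw⇒in k x' ⟩
    A x' y'     ≡⟨ A-def x' y' ⟩
    arc Γ x' y' ∎
    where open ≡-Reasoning

  open Collapse Γ wdr comm tw-equivalence Q tw-inv' arc-lift using (Γ/F; arc-/; arc-/⁻; δ-/; wdr-/; comm-/) public

  t : ℕ
  t = countFin (tw (proj₁ (proj₁ (proj₂ wdr))))

  class-size : ∀ x → countFin (tw x) ≡ t
  class-size x = deg-const {tw} tw-inv x _

  1≤t : 1 ≤ t
  1≤t = count-pos (tw _) _ (Equivalence.reflexive tw-equivalence _)

  class-size' : ∀ x → countFin (tw x) ≡ suc (t ∸ 1)
  class-size' x = trans (class-size x) (sym (ℕₚ.m+[n∸m]≡n {1} 1≤t))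

  -- `arc-/` concerns different classes; inside a class both sides are false, since twins are not
  -- adjacent.
  arc-A : ∀ x y → arc Γ/F (π x) (π y) ≡ A x y
  arc-A x y with bool (tw x y)
  ... | inj₂ h = trans (arc-/ h) (sym (A-def x y))
  ... | inj₁ h = trans (≢true⇒≡false λ k → clash {b = arc Γ x y} (arc-/⁻ k) (trans (sym (A-def x y)) (tw⇒¬A h))) (sym (tw⇒¬A h))

  wdr/ : WeaklyDistanceRegular Γ/F
  wdr/ = wdr-/ class-size' (x , y , ≢true⇒≡false (λ h → clash {b = A x y} (trans (A-def x y) p) (tw⇒¬A h)) , p , q)
    where
    x y : V Γ
    x = proj₁ (proj₁ (proj₂ wdr))
    y = proj₁ (proj₂ (proj₁ (proj₂ wdr)))
    p : arc Γ x y ≡ true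
    p = proj₁ (proj₂ (proj₂ (proj₁ (proj₂ wdr))))
    q : arc Γ y x ≡ false
    q = proj₂ (proj₂ (proj₂ (proj₁ (proj₂ wdr))))

  comm/ : Commutative Γ/F
  comm/ = comm-/ class-size'

  arc-repr : ∀ i j → arc Γ/F i j ≡ A (repr i) (repr j)
  arc-repr i j = trans (sym (cong₂ (arc Γ/F) (π-repr i) (π-repr j))) (arc-A (repr i) (repr j))

  ≅coclique : Γ ≅ cocliqueExt Γ/F t
  ≅coclique = lex-iso Γ Γ/F (emptyDigraph t) (proj₁ coordinates) λ p q → begin
    arc Γ (from p) (from q)                    ≡⟨ A-def (from p) (from q) ⟨
    A (from p) (from q)                        ≡⟨ arc-A (from p) (from q) ⟨
    arc Γ/F (π (from p)) (π (from q))          ≡⟨ cong₂ (arc Γ/F) (proj₂ coordinates p) (proj₂ coordinates q) ⟩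
    arc Γ/F (proj₁ p) (proj₁ q)                ≡⟨ ∨-identityʳ _ ⟨
    arc Γ/F (proj₁ p) (proj₁ q) ∨ false        ≡⟨ cong (arc Γ/F (proj₁ p) (proj₁ q) ∨_) (∧-zeroʳ (proj₁ p == proj₁ q)) ⟨
    _                                          ∎
    where
    open ≡-Reasoning
    coordinates = class-coordinates tw-equivalence Q class-size
    from = _≃×_.from (proj₁ coordinates)

  ≅/ : t ≡ 1 → Γ ≅ Γ/F
  ≅/ t≡1 = mk↔ₛ′ π repr π-repr (λ x → sym (count-unique (tw x)
      (ℕₚ.≤-reflexive (trans (class-size x) t≡1)) (Equivalence.reflexive tw-equivalence x) (repr-related x))) ,
    λ x y → trans (arc-A x y) (A-def x y)

  separated : ∀ {i j} → i ≢ j → tw (repr i) (repr j) ≡ false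
  separated h = ≢true⇒≡false λ k → h (trans (sym (π-repr _)) (trans (π-cong k) (π-repr _)))

  -- If the difference found lies on the wrong side, equal out-degrees provide one on the other
  -- side.
  ¬tw-witness : ∀ {x y} → tw x y ≡ false → ∃[ z ] A x z ≡ true × A y z ≡ false
  ¬tw-witness {x} {y} h with ¬tw⇒ h
  ... | z , d with bool (A x z) | bool (A y z)
  ...   | inj₁ p | inj₂ q = z , p , q
  ...   | inj₁ p | inj₁ q = contradiction (trans p (sym q)) d
  ...   | inj₂ p | inj₂ q = contradiction (trans p (sym q)) d
  ...   | inj₂ p | inj₁ q = count-exchange (A y) (A x) (ℕₚ.≤-reflexive (deg-A y x)) q p

  module Parts {m} (p : V Γ → Fin m) (multi : MultipartiteBy Γ p)
               (inhabited : ∀ i → ∃[ x ] p x ≡ i) where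

    p-related : ∀ {x y} → tw x y ≡ true → p x ≡ p y
    p-related {x} {y} h = ==⇒≡ (not-false⁻ (trans (sym (multi x y)) (cong₂ _∨_
      (trans (sym (A-def x y)) (tw⇒¬A h))
      (trans (sym (A-def y x)) (tw⇒¬A (Equivalence.symmetric tw-equivalence h))))))

    multi/ : MultipartiteBy Γ/F (λ i → p (repr i))
    multi/ i j = trans (cong₂ _∨_ (trans (arc-repr i j) (A-def _ _)) (trans (arc-repr j i) (A-def _ _))) (multi (repr i) (repr j))

    twinless : ∀ {x y} → p x ≡ p y → tw x y ≡ false → Twinless Γ/F
    twinless {x} {y} same apart = record
      { wdr = wdr/ ; comm = comm/ ; part = λ i → p (repr i)
      ; section = λ i → π (proj₁ (inhabited i))
      ; part-sec = λ i → trans (sym (p-related (repr-related (proj₁ (inhabited i))))) (proj₂ (inhabited i))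
      ; multi = multi/
      ; separate = λ {i} {j} _ h → let z , u , v = ¬tw-witness (separated h) in
          π z , trans (cong (λ k → arc Γ/F k (π z)) (sym (π-repr i))) (trans (arc-A (repr i) z) u) ,
                trans (cong (λ k → arc Γ/F k (π z)) (sym (π-repr j))) (trans (arc-A (repr j) z) v)
      ; mates = π x , π y , trans (sym (p-related (repr-related x))) (trans same (p-related (repr-related y))) , π-≢ apart
      }

    semicomplete/ : (∀ x y → (p x == p y) ∧ not (tw x y) ≡ false) → Semicomplete Γ/F
    semicomplete/ h i j i≢j = trans (multi/ i j) (not-true (≢true⇒≡false λ k →
      clash (∧-true k (not-true (separated i≢j))) (h (repr i) (repr j))))

    2≤t : (∀ x y → (p x == p y) ∧ not (tw x y) ≡ false) → ∀ {x y} → p x ≡ p y → x ≢ y → 2 ≤ t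
    2≤t h {x} {y} q x≢y = subst (2 ≤_) (class-size x) (count-two (tw x)
      (Equivalence.reflexive tw-equivalence x)
      (not-false⁻ (≢true⇒≡false λ k → clash (∧-true (≡⇒== q) k) (h x y))) x≢y)

    -- A nontrivial twin pair on a digon has type (2,2), the type of the non-twin pairs inside a part.
    module _ {y y'} (same : p y ≡ p y') (apart : tw y y' ≡ false) (2≤t : 2 ≤ t) where

      private
        T = twinless same apart
        module R = Relations T

      no-digons : ∀ i j → R.e i j ≡ false
      -- The digon valency is constant, so a digon anywhere yields one at the class of y, which has
      -- a second member.
      no-digons i j = ≢true⇒≡false λ h → digon (count-pos⁻ (R.e (π y))
          (subst (1 ≤_) (R.deg-const {R.e} R.e-inv i (π y)) (count-pos (R.e i) j h)))
          (count-two⁻ (tw y) (Equivalence.reflexive tw-equivalence y) (subst (2 ≤_) (sym (class-size y)) 2≤t))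
        where
        A-of : ∀ {x j} → arc Γ/F (π x) j ≡ true → A x (repr j) ≡ true
        A-of {x} {j} h = trans (sym (arc-A x (repr j))) (trans (cong (arc Γ/F (π x)) (π-repr j)) h)
        Aᵒ-of : ∀ {x j} → arc Γ/F j (π x) ≡ true → A (repr j) x ≡ true
        Aᵒ-of {x} {j} h = trans (sym (arc-A (repr j) x)) (trans (cong (λ i → arc Γ/F i (π x)) (π-repr j)) h)

        two-two : ∀ {x} → y ≢ x → tw y x ≡ true → ∀ z → A y z ≡ true → A z y ≡ true → δ y x ≡ 2 × δ x y ≡ 2
        two-two {x} y≢x h z p q =
          δ-two y≢x (trans (sym (A-def y x)) (tw⇒¬A h))
            (step-walk {y} {z} {x} {1} (arc⁺ p) (arc⇒walk {z} {x} (arc⁺ (trans (sym (tw⇒in h z)) q)))) ,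
          δ-two (λ e → y≢x (sym e)) (trans (sym (A-def x y)) (tw⇒¬A (Equivalence.symmetric tw-equivalence h)))
            (step-walk {x} {z} {y} {1} (arc⁺ (trans (sym (tw⇒≡ h z)) p)) (arc⇒walk {z} {y} (arc⁺ q)))
          where
          arc⁺ : ∀ {u v} → A u v ≡ true → arc Γ u v ≡ true
          arc⁺ {u} {v} k = trans (sym (A-def u v)) k

        D-mates : R.D (π y) (π y') ≡ true
        D-mates = R.mk-D (R.part⇒R (proj₁ (proj₂ (proj₂ R.mates)))) (π-≢ apart)

        mates-two : ∀ {x x'} → tw x x' ≡ false → R.D (π x) (π x') ≡ true → δ x x' ≡ 2
        mates-two h d = trans (sym (δ-/ h)) (R.δ≡2 (R.D⇒≢ d) (R.R⇒¬a (R.D⇒R d)) (R.D-two d))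

        digon : (∃[ j ] R.e (π y) j ≡ true) → (∃[ x ] tw y x ≡ true × y ≢ x) → ⊥
        digon (j , h) (x , k , y≢x) = clash {b = tw y x} k (trans (tw-inv' types) apart)
          where
          twos = two-two y≢x k (repr j) (A-of {y} (trans (sym (R.a-def _ _)) (R.e⇒a h)))
                                        (Aᵒ-of {y} (trans (sym (R.a-def _ _)) (R.e⇒aᵒ h)))
          types : Scheme.ty (scheme Γ wdr comm) y x ≡ Scheme.ty (scheme Γ wdr comm) y y'
          types = cong₂ _,_ (trans (proj₁ twos) (sym (mates-two apart D-mates)))
            (trans (proj₂ twos) (sym (mates-two (≢true⇒≡false λ l →
               clash (Equivalence.symmetric tw-equivalence l) apart) (R.D-sym D-mates))))

-- Isomorphisms of lexicographic products

fst-lex : ∀ Δ Σ' → V (Δ ∘ₗ Σ') → V Δ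
fst-lex Δ Σ' u = proj₁ (remQuot {n Δ} (n Σ') u)

snd-lex : ∀ Δ Σ' → V (Δ ∘ₗ Σ') → V Σ'
snd-lex Δ Σ' u = proj₂ (remQuot {n Δ} (n Σ') u)

arc-lex : ∀ Δ Σ' u v → arc (Δ ∘ₗ Σ') u v ≡
          arc Δ (fst-lex Δ Σ' u) (fst-lex Δ Σ' v) ∨
          ((fst-lex Δ Σ' u == fst-lex Δ Σ' v) ∧ arc Σ' (snd-lex Δ Σ' u) (snd-lex Δ Σ' v))
arc-lex Δ Σ' u v = trans
  (sym (cong₂ (arc (Δ ∘ₗ Σ')) (combine-remQuot {n Δ} (n Σ') u) (combine-remQuot {n Δ} (n Σ') v)))
  (lex-arc Δ Σ' _ _ _ _)

arc-coclique : ∀ Δ k u v → arc (cocliqueExt Δ k) u v ≡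
               arc Δ (fst-lex Δ (emptyDigraph k) u) (fst-lex Δ (emptyDigraph k) v)
arc-coclique Δ k u v = trans (arc-lex Δ (emptyDigraph k) u v)
  (trans (cong (arc Δ _ _ ∨_) (∧-zeroʳ _)) (∨-identityʳ _))

≅-trans : ∀ {Γ Δ Θ} → Γ ≅ Δ → Δ ≅ Θ → Γ ≅ Θ
≅-trans (φ , h) (ψ , k) =
  mk↔ₛ′ (λ x → Inverse.to ψ (Inverse.to φ x)) (λ z → Inverse.from φ (Inverse.from ψ z))
    (λ z → trans (cong (Inverse.to ψ) (Inverse.strictlyInverseˡ φ _)) (Inverse.strictlyInverseˡ ψ z))
    (λ x → trans (cong (Inverse.from φ) (Inverse.strictlyInverseʳ ψ _)) (Inverse.strictlyInverseʳ φ x)) ,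
  λ x y → trans (k _ _) (h x y)

coclique-cong : ∀ {Γ Δ} t → Γ ≅ Δ → cocliqueExt Γ t ≅ cocliqueExt Δ t
coclique-cong {Γ} {Δ} t (φ , h) = lex-iso (cocliqueExt Γ t) Δ (emptyDigraph t) (record
    { to      = λ u → Inverse.to φ (proj₁ (remQuot {n Γ} t u)) , proj₂ (remQuot {n Γ} t u)
    ; from    = from
    ; to-from = λ p → trans (cong (λ q → Inverse.to φ (proj₁ q) , proj₂ q) (remQuot-combine (Inverse.from φ (proj₁ p)) (proj₂ p)))
                            (cong (_, proj₂ p) (Inverse.strictlyInverseˡ φ (proj₁ p)))
    ; from-to = λ u → trans (cong (λ i → combine i (proj₂ (remQuot {n Γ} t u))) (Inverse.strictlyInverseʳ φ _))
                            (combine-remQuot {n Γ} t u)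
    }) λ { (i , k) (j , l) → trans (lex-arc Γ (emptyDigraph t) (Inverse.from φ i) k (Inverse.from φ j) l)
           (cong₂ _∨_ (trans (sym (h _ _)) (cong₂ (arc Δ) (Inverse.strictlyInverseˡ φ i) (Inverse.strictlyInverseˡ φ j)))
             (trans (∧-zeroʳ _) (sym (∧-zeroʳ _)))) }
  where
  from : V Δ × Fin t → Fin (n Γ *ℕ t)
  from (i , k) = combine (Inverse.from φ i) k

-- The parts of the listed digraphs

record Multipartite (Γ : Digraph) : Set where
  constructor multipartite
  field
    {parts}  : ℕ
    part     : V Γ → Fin parts
    2≤m      : 2 ≤ parts
    distinct : ∀ i → ∃[ x ] ∃[ y ] part x ≡ i × part y ≡ i × x ≢ y
    multi    : MultipartiteBy Γ part

multipartite⁻ : ∀ {Γ} → Multipartite Γ → SemicompleteMultipartite Γ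
multipartite⁻ M = parts , part , 2≤m , (λ i → let x , y , p , q , d = distinct i in
    count-two (λ z → part z == i) (≡⇒== p) (≡⇒== q) d) , multi
  where open Multipartite M

multipartite⁺ : ∀ {Γ} → SemicompleteMultipartite Γ → Multipartite Γ
multipartite⁺ (m , p , 2≤m , sizes , multi) = multipartite p 2≤m (λ i → two i) multi
  where
  two : ∀ i → ∃[ x ] ∃[ y ] p x ≡ i × p y ≡ i × x ≢ y
  two i with count-pos⁻ (λ z → p z == i) (ℕₚ.≤-trans (s≤s z≤n) (sizes i))
  ... | x , h with count-two⁻ (λ z → p z == i) h (sizes i)
  ...   | y , k , d = x , y , ==⇒≡ h , ==⇒≡ k , d

multipartite-≅ : ∀ {Γ Δ} → Multipartite Δ → Γ ≅ Δ → Multipartite Γ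
multipartite-≅ {Γ} {Δ} M (φ , h) = multipartite (λ x → part (to x)) 2≤m
    (λ i → let x , y , p , q , d = distinct i in
       from x , from y , trans (cong part (Inverse.strictlyInverseˡ φ x)) p ,
       trans (cong part (Inverse.strictlyInverseˡ φ y)) q ,
       λ e → d (trans (sym (Inverse.strictlyInverseˡ φ x)) (trans (cong to e) (Inverse.strictlyInverseˡ φ y))))
    (λ x y → trans (sym (cong₂ _∨_ (h x y) (h y x))) (multi (to x) (to y)))
  where
  open Multipartite M
  open Inverse φ using (to; from)

pick : ∀ {k} → 1 ≤ k → Fin k
pick {suc k} _ = zero

multipartite-coclique : ∀ {Δ k} → 1 ≤ k → Multipartite Δ → Multipartite (cocliqueExt Δ k)
multipartite-coclique {Δ} {k} 1≤k M = multipartite (λ u → part (fst-lex Δ (emptyDigraph k) u)) 2≤m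
    (λ i → let x , y , p , q , d = distinct i in
       combine x z , combine y z , trans (cong (λ w → part (proj₁ w)) (remQuot-combine x z)) p ,
       trans (cong (λ w → part (proj₁ w)) (remQuot-combine y z)) q ,
       λ e → d (cong proj₁ (trans (sym (remQuot-combine x z)) (trans (cong (remQuot {n Δ} k) e) (remQuot-combine y z)))))
    (λ u v → trans (cong₂ _∨_ (arc-coclique Δ k u v) (arc-coclique Δ k v u)) (multi _ _))
  where
  open Multipartite M
  z : Fin k
  z = pick 1≤k

und-irrefl : ∀ Δ x → und Δ x x ≡ false
und-irrefl Δ x rewrite ==-refl x | ∧-zeroʳ (adj Δ x x) = refl

und-semicomplete : ∀ {Δ} → Semicomplete Δ → ∀ x y → und Δ x y ≡ not (x == y)
und-semicomplete {Δ} semi x y = compare (x ≟ᶠ y)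
  where
  compare : Dec (x ≡ y) → und Δ x y ≡ not (x == y)
  compare (yes refl) = trans (und-irrefl Δ x) (cong not (sym (==-refl x)))
  compare (no q)     = trans (semi x y q) (sym (not-true (≢⇒== q)))

multipartite-semicomplete : ∀ {Δ k} → 2 ≤ k → 2 ≤ n Δ → Semicomplete Δ → Multipartite (cocliqueExt Δ k)
multipartite-semicomplete {Δ} {suc (suc k)} (s≤s (s≤s z≤n)) 2≤n semi =
  multipartite (fst-lex Δ (emptyDigraph (suc (suc k)))) 2≤n
    (λ i → combine i zero , combine i (suc zero) , cong proj₁ (remQuot-combine i zero) ,
       cong proj₁ (remQuot-combine i (suc zero)) , λ e → case
         cong proj₂ (trans (sym (remQuot-combine {n Δ} i zero)) (trans (cong (remQuot {n Δ} (suc (suc k))) e)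
           (remQuot-combine i (suc zero)))) of λ ())
    (λ u v → trans (cong₂ _∨_ (arc-coclique Δ _ u v) (arc-coclique Δ _ v u)) (und-semicomplete {Δ} semi _ _))

-- The only non-adjacent pairs of distinct vertices are x and x + 3, so the parts are the residue
-- classes modulo 3.
multipartite-cay6 : Multipartite cay6
multipartite-cay6 = multipartite (λ x → toℕ x mod 3) (s≤s (s≤s z≤n))
  (λ { f0 → f0 , f3 , refl , refl , λ () ; f1 → f1 , f4 , refl , refl , λ () ; f2 → f2 , f5 , refl , refl , λ () })
  (from-yes (all? λ x → all? λ y → und cay6 x y ≟ᵇ not ((toℕ x mod 3) == (toℕ y mod 3))))

-- Each copy of C₄ contributes two parts, its pairs of opposite vertices, told apart by parity.
multipartite-lex-C4 : ∀ {Σ'} → 1 ≤ n Σ' → Semicomplete Σ' → Multipartite (Σ' ∘ₗ C4)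
multipartite-lex-C4 {Σ'} 1≤n semi = multipartite p (ℕₚ.*-monoˡ-≤ 2 1≤n) two multi
  where
  side : Fin 4 → Fin 2
  side k = toℕ k mod 2

  fst = fst-lex Σ' C4
  snd = snd-lex Σ' C4

  p : V (Σ' ∘ₗ C4) → Fin (n Σ' *ℕ 2)
  p u = combine (fst u) (side (snd u))

  p-combine : ∀ i k → p (combine i k) ≡ combine i (side k)
  p-combine i k = cong (λ w → combine (proj₁ w) (side (proj₂ w))) (remQuot-combine {n Σ'} {4} i k)

  opposite : ∀ e → ∃[ k ] ∃[ l ] side k ≡ e × side l ≡ e × k ≢ l
  opposite f0 = f0 , f2 , refl , refl , λ ()
  opposite f1 = f1 , f3 , refl , refl , λ ()

  two : ∀ j → ∃[ u ] ∃[ v ] p u ≡ j × p v ≡ j × u ≢ v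
  two j = let i , e = remQuot {n Σ'} 2 j ; k , l , q , r , d = opposite e in
    combine i k , combine i l ,
    trans (p-combine i k) (trans (cong (combine i) q) (combine-remQuot {n Σ'} 2 j)) ,
    trans (p-combine i l) (trans (cong (combine i) r) (combine-remQuot {n Σ'} 2 j)) ,
    λ h → d (cong proj₂ (trans (sym (remQuot-combine {n Σ'} {4} i k)) (trans (cong (remQuot {n Σ'} 4) h) (remQuot-combine {n Σ'} {4} i l))))

  und-C4 : ∀ k l → und C4 k l ≡ not (side k == side l)
  und-C4 = from-yes (all? λ k → all? λ l → und C4 k l ≟ᵇ not (side k == side l))

  join : ∀ i k j l → Dec (i ≡ j) →
    (arc Σ' i j ∨ ((i == j) ∧ arc C4 k l)) ∨ (arc Σ' j i ∨ ((j == i) ∧ arc C4 l k)) ≡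
    not (combine i (side k) == combine j (side l))
  join i k j l (yes refl) = trans
    (cong₂ (λ b c → (b ∨ (c ∧ arc C4 k l)) ∨ (b ∨ (c ∧ arc C4 l k)))
      (proj₁ (∨-false⁻ {arc Σ' i i} (und-irrefl Σ' i))) (==-refl i))
    (trans (und-C4 k l) (cong not (sym (==-cong-injective (combine i)
      (λ {x} {y} h → cong proj₂ (trans (sym (remQuot-combine i x)) (trans (cong (remQuot {n Σ'} 2) h) (remQuot-combine i y)))) (side k) (side l)))))
  join i k j l (no i≢j) = trans (joined (∨-true⁻ {arc Σ' i j} (semi i j i≢j))) (sym (not-true (≢⇒== λ h →
    i≢j (cong proj₁ (trans (sym (remQuot-combine i (side k))) (trans (cong (remQuot {n Σ'} 2) h) (remQuot-combine j (side l))))))))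
    where
    joined : arc Σ' i j ≡ true ⊎ arc Σ' j i ≡ true →
      (arc Σ' i j ∨ ((i == j) ∧ arc C4 k l)) ∨ (arc Σ' j i ∨ ((j == i) ∧ arc C4 l k)) ≡ true
    joined (inj₁ h) = ∨-trueˡ (∨-trueˡ h)
    joined (inj₂ h) = ∨-trueʳ {arc Σ' i j ∨ ((i == j) ∧ arc C4 k l)} (∨-trueˡ h)

  multi : MultipartiteBy (Σ' ∘ₗ C4) p
  multi u v = trans (cong₂ _∨_ (arc-lex Σ' C4 u v) (arc-lex Σ' C4 v u))
    (join (fst u) (snd u) (fst v) (snd v) (fst u ≟ᶠ fst v))

multipartite-team : ∀ {Δ m r p} → TeamBy Δ m r p → Multipartite Δ
multipartite-team (2≤m , 2≤r , sizes , multi) =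
  multipartite⁺ (_ , _ , 2≤m , (λ i → subst (2 ≤_) (sym (sizes i)) 2≤r) , multi)

2≤order : ∀ {Δ} → WeaklyDistanceRegular Δ → 2 ≤ n Δ
2≤order {Δ} (_ , (x , y , p , q) , _) = 2≤parts {i = x} {y} λ x≡y →
  clash {b = arc Δ x y} p (subst (λ z → arc Δ z y ≡ false) (sym x≡y) (subst (λ z → arc Δ y z ≡ false) x≡y q))

-- Assembling the equivalence

Classified : Digraph → Set
Classified Γ =
    ( (∃[ n ] (1 ≤ n × Γ ≅ cocliqueExt cay6 n))
    ⊎ (Σ Digraph λ Δ → ∃[ l ] (2 ≤ l × Semicomplete Δ × WeaklyDistanceRegular Δ
          × (Girth Δ 2 ⊎ Girth Δ 3) × Γ ≅ cocliqueExt Δ l))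
    ⊎ (Σ Digraph λ Σ' → ∃[ n ] (1 ≤ n × Semicomplete Σ' × WeaklyDistanceRegular Σ'
          × Girth Σ' 3 × Γ ≅ cocliqueExt (Σ' ∘ₗ C4) n))
    ⊎ (Σ Digraph λ Δ → ∃[ k ] ∃[ l ] ∃[ n ] Σ ℤ λ α → Σ ℤ λ β → Σ ℤ λ γ →
          2 ≤ k × 2 ≤ l × 1 ≤ n
          × + 4 * α ≡ + ((k ∸ 2) Data.Nat.* l)
          × + 4 * β ≡ + ((k ∸ 2) Data.Nat.* l)
          × + (4 Data.Nat.* (l ∸ 1)) * γ ≡ + (l Data.Nat.* l Data.Nat.* (k ∸ 1))
          × DRTeamTournamentTypeII Δ k l α β γ
          × Γ ≅ cocliqueExt Δ n)
    ⊎ (Σ Digraph λ Δ → ∃[ k ] ∃[ m ] (2 ≤ k × 2 ≤ m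
          × DRTeamSCMPTypeII Δ k m × Γ ≅ Δ)) )

module Forward (Γ : Digraph) (wdr : WeaklyDistanceRegular Γ) (comm : Commutative Γ)
               {m} (p : V Γ → Fin m) (sizes : ∀ i → 2 ≤ countFin (λ x → p x == i))
               (multi : MultipartiteBy Γ p) where
  open Twins Γ wdr comm

  inhabited : ∀ i → ∃[ x ] p x ≡ i
  inhabited i = let x , h = count-pos⁻ (λ x → p x == i) (ℕₚ.≤-trans (s≤s z≤n) (sizes i)) in x , ==⇒≡ h

  open Parts p multi inhabited

  part-twin : ∃[ x ] ∃[ y ] p x ≡ p y × x ≢ y
  part-twin = let x = proj₁ (proj₁ (proj₂ wdr)) ; y , h , d = count-two⁻ (λ y → p y == p x) (==-refl (p x)) (sizes (p x)) in
    x , y , sym (==⇒≡ h) , d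

  cocliques : ∀ Δ → Γ/F ≅ Δ → Γ ≅ cocliqueExt Δ t
  cocliques Δ φ = ≅-trans {Γ} {cocliqueExt Γ/F t} {cocliqueExt Δ t} ≅coclique (coclique-cong {Γ/F} {Δ} t φ)

  by-multiplicity : ∀ {y y'} (same : p y ≡ p y') (apart : tw y y' ≡ false) →
                    let T = twinless same apart in
                    Relations.Homogeneous T (Relations.f T) → Dec (t ≡ 1) → Classified Γ
  by-multiplicity same apart f-hom (yes t≡1) =
    inj₂ (inj₂ (inj₂ (inj₂ (Γ/F , m , r , parts≥2 , 2≤r , semicomplete-typeII f-hom , ≅/ t≡1))))
    where open TypeII (twinless same apart)
  by-multiplicity same apart f-hom (no t≢1) = conclude
    (tournament-typeII f-hom (no-digons same apart (ℕₚ.≤∧≢⇒< 1≤t (λ q → t≢1 (sym q)))))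
    where
    open TypeII (twinless same apart)
    conclude : (Σ ℤ λ α → Σ ℤ λ β → Σ ℤ λ γ →
        + 4 * α ≡ + ((m ∸ 2) *ℕ r) × + 4 * β ≡ + ((m ∸ 2) *ℕ r) ×
        + (4 *ℕ (r ∸ 1)) * γ ≡ + (r *ℕ r *ℕ (m ∸ 1)) × DRTeamTournamentTypeII Γ/F m r α β γ) → Classified Γ
    conclude (α , β , γ , α-eq , β-eq , γ-eq , tournament) = inj₂ (inj₂ (inj₂ (inj₁
      (Γ/F , m , r , t , α , β , γ , parts≥2 , 2≤r , 1≤t , α-eq , β-eq , γ-eq , tournament , ≅coclique))))

  by-shape : ∀ {y y'} (same : p y ≡ p y') (apart : tw y y' ≡ false) → Shape (twinless same apart) → Classified Γ
  by-shape same apart (cayley φ) = inj₁ (t , 1≤t , cocliques cay6 φ)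
  by-shape same apart (lex Σ' semi wdr' girth φ) =
    inj₂ (inj₂ (inj₁ (Σ' , t , 1≤t , semi , wdr' , girth , cocliques (Σ' ∘ₗ C4) φ)))
  by-shape same apart (typeII f-hom) = by-multiplicity same apart f-hom (t ℕₚ.≟ 1)

  by-twins : (∃[ x ] ∃[ y ] (p x == p y) ∧ not (tw x y) ≡ true) ⊎ (∀ x y → (p x == p y) ∧ not (tw x y) ≡ false) →
             Classified Γ
  by-twins (inj₁ (x , y , h)) = by-shape same apart (classify (twinless same apart))
    where
    same : p x ≡ p y
    same = ==⇒≡ (proj₁ (∧-true⁻ h))
    apart : tw x y ≡ false
    apart = not-true⁻ (proj₂ (∧-true⁻ {p x == p y} h))
  by-twins (inj₂ h) = inj₂ (inj₁ (Γ/F , t , 2≤t h (proj₁ (proj₂ (proj₂ part-twin))) (proj₂ (proj₂ (proj₂ part-twin))) ,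
    semicomplete/ h , wdr/ , Girths.semicomplete-girth Γ/F wdr/ comm/ (semicomplete/ h) , ≅coclique))

  classified : Classified Γ
  classified = by-twins (any-pair (λ x y → (p x == p y) ∧ not (tw x y)))

classified⇒multipartite : ∀ {Γ} → Classified Γ → Multipartite Γ
classified⇒multipartite (inj₁ (k , 1≤k , φ)) =
  multipartite-≅ (multipartite-coclique {cay6} 1≤k multipartite-cay6) φ
classified⇒multipartite (inj₂ (inj₁ (Δ , l , 2≤l , semi , wdr , _ , φ))) =
  multipartite-≅ (multipartite-semicomplete {Δ} 2≤l (2≤order {Δ} wdr) semi) φ
classified⇒multipartite (inj₂ (inj₂ (inj₁ (Σ' , k , 1≤k , semi , wdr , _ , φ)))) =
  multipartite-≅ (multipartite-coclique {Σ' ∘ₗ C4} 1≤k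
    (multipartite-lex-C4 {Σ'} (ℕₚ.≤-trans (s≤s z≤n) (2≤order {Σ'} wdr)) semi)) φ
classified⇒multipartite (inj₂ (inj₂ (inj₂ (inj₁
    (Δ , _ , _ , k , _ , _ , _ , _ , _ , 1≤k , _ , _ , _ , (p , (team , _) , _) , φ))))) =
  multipartite-≅ (multipartite-coclique {Δ} 1≤k (multipartite-team {Δ} {p = p} team)) φ
classified⇒multipartite (inj₂ (inj₂ (inj₂ (inj₂ (Δ , _ , _ , _ , _ , (p , team , _) , φ))))) =
  multipartite-≅ (multipartite-team {Δ} {p = p} team) φ

theorem1p1 : (Γ : Digraph) → WeaklyDistanceRegular Γ → Commutative Γ →
  SemicompleteMultipartite Γ ⇔
    ( (∃[ n ] (1 ≤ n × Γ ≅ cocliqueExt cay6 n))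
    ⊎ (Σ Digraph λ Δ → ∃[ l ] (2 ≤ l × Semicomplete Δ × WeaklyDistanceRegular Δ
          × (Girth Δ 2 ⊎ Girth Δ 3) × Γ ≅ cocliqueExt Δ l))
    ⊎ (Σ Digraph λ Σ' → ∃[ n ] (1 ≤ n × Semicomplete Σ' × WeaklyDistanceRegular Σ'
          × Girth Σ' 3 × Γ ≅ cocliqueExt (Σ' ∘ₗ C4) n))
    ⊎ (Σ Digraph λ Δ → ∃[ k ] ∃[ l ] ∃[ n ] Σ ℤ λ α → Σ ℤ λ β → Σ ℤ λ γ →
          2 ≤ k × 2 ≤ l × 1 ≤ n
          × + 4 * α ≡ + ((k ∸ 2) Data.Nat.* l)
          × + 4 * β ≡ + ((k ∸ 2) Data.Nat.* l)
          × + (4 Data.Nat.* (l ∸ 1)) * γ ≡ + (l Data.Nat.* l Data.Nat.* (k ∸ 1))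
          × DRTeamTournamentTypeII Δ k l α β γ
          × Γ ≅ cocliqueExt Δ n)
    ⊎ (Σ Digraph λ Δ → ∃[ k ] ∃[ m ] (2 ≤ k × 2 ≤ m
          × DRTeamSCMPTypeII Δ k m × Γ ≅ Δ)) )
theorem1p1 Γ wdr comm = mk⇔
  (λ { (m , p , _ , sizes , multi) → Forward.classified Γ wdr comm p sizes multi })
  (λ c → multipartite⁻ (classified⇒multipartite c))
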